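{- Let $n\geq 7$. Then every line-like crescent configuration in $L^\infty$ of size $n$ is a perpendicular perturbation of a horizontal or vertical line.
   Context: The $L^\infty$ norm on $\mathbb{R}^2$ is $\|(x,y)\|_\infty=\max\{|x|,|y|\}$; an $L^\infty$ circle is a set $\{q:\|q-p\|_\infty=r\}$ with $p\in\mathbb{R}^2$, $r>0$ (the boundary of an axis-parallel square). A set $S\subset\mathbb{R}^2$ of $n$ points is a line-like configuration in $L^\infty$ if its distance graph is isomorphic to that of $n$ equally spaced points on a line, i.e. there is a bijection $\phi: S\to\{1,\dots,n\}$ such that for all $a,b,c,d\in S$: $\|a-b\|_\infty=\|c-d\|_\infty$ if and only if $|\phi(a)-\phi(b)|=|\phi(c)-\phi(d)|$. It is a line-like crescent configuration in $L^\infty$ of size $n$ if, in addition, no three of its points lie on a common line and no four of its points lie on a common $L^\infty$ circle. A set of $n$ points is a perpendicular perturbation of a line $\ell$ if its points can be enumerated as $P_1,\dots,P_n$ so that there exist (distinct) equally spaced points $Q_1,\dots,Q_n$ on $\ell$, i.e. $Q_i=Q_1+(i-1)v$ for some nonzero vector $v$ parallel to $\ell$, such that for every $i$ the orthogonal projection of $P_i$ onto $\ell$ is $Q_i$. -}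

module Defs where

open import Algebra.Bundles using (CommutativeRing)
open import Algebra.Core using (Op₁; Op₂)
open import Algebra.Structures using (IsCommutativeRing)
import Algebra.Construct.NaturalChoice.Max as Max
import Algebra.Definitions.RawMonoid as RawMonoidDefinitions
open import Data.Fin.Base using (Fin; toℕ)
open import Data.Fin.Permutation using (Permutation′; _⟨$⟩ʳ_)
open import Data.Nat.Base as ℕ using (ℕ)
open import Data.Product.Base using (_×_; _,_; proj₁; proj₂; ∃; ∃₂; Σ-syntax)
open import Data.Product.Relation.Binary.Pointwise.NonDependent using (×-setoid)
open import Function.Bundles using (Injection; _↣_; _⇔_)
open import Level using (Level; _⊔_; suc)
open import Relation.Binary.Bundles using (DecTotalOrder; Setoid)
open import Relation.Binary.Core using (Rel)
import Relation.Binary.Construct.NonStrictToStrict as NonStrictToStrict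
open import Relation.Binary.PropositionalEquality.Core using (_≡_)
open import Relation.Binary.PropositionalEquality.Properties using () renaming (setoid to ≡-setoid)
open import Relation.Binary.Structures using (IsDecTotalOrder)
open import Relation.Nullary.Negation.Core using (¬_)
open import Relation.Unary using (Pred)

-- The real numbers, given axiomatically as a Dedekind-complete ordered field.
-- The theory is classical, so the order and equality are decidable.
record RealNumbers (c ℓ₁ ℓ₂ : Level) : Set (suc (c ⊔ ℓ₁ ⊔ ℓ₂)) where
  infix  4 _≈_ _≉_ _≤_
  infixl 6 _+_
  infixl 7 _*_
  infix  8 -_
  field
    Carrier : Set c
    _≈_     : Rel Carrier ℓ₁
    _≤_     : Rel Carrier ℓ₂
    _+_ _*_ : Op₂ Carrier
    -_      : Op₁ Carrier
    0# 1#   : Carrier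

    isCommutativeRing : IsCommutativeRing _≈_ _+_ _*_ -_ 0# 1#
    isDecTotalOrder   : IsDecTotalOrder _≈_ _≤_

  _≉_ : Rel Carrier ℓ₁
  x ≉ y = ¬ (x ≈ y)

  _IsUpperBoundOf_ : ∀ {ℓ} → Carrier → Pred Carrier ℓ → Set (c ⊔ ℓ₂ ⊔ ℓ)
  u IsUpperBoundOf A = ∀ x → A x → x ≤ u

  field
    1≉0        : 1# ≉ 0#
    invertible : ∀ x → x ≉ 0# → ∃ λ y → x * y ≈ 1#

    +-monoˡ-≤   : ∀ z {x y} → x ≤ y → x + z ≤ y + z
    *-nonneg    : ∀ {x y} → 0# ≤ x → 0# ≤ y → 0# ≤ x * y

    supremum : (A : Pred Carrier (c ⊔ ℓ₁ ⊔ ℓ₂)) →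
               ∃ A → ∃ (_IsUpperBoundOf A) →
               ∃ λ s → s IsUpperBoundOf A × (∀ u → u IsUpperBoundOf A → s ≤ u)

  commutativeRing : CommutativeRing c ℓ₁
  commutativeRing = record { isCommutativeRing = isCommutativeRing }

  decTotalOrder : DecTotalOrder c ℓ₁ ℓ₂
  decTotalOrder = record { isDecTotalOrder = isDecTotalOrder }

  open CommutativeRing commutativeRing public using (_-_; setoid; +-rawMonoid)
  open NonStrictToStrict _≈_ _≤_ public using (_<_)
  open Max (DecTotalOrder.totalOrder decTotalOrder) public
    using () renaming (_⊔_ to max)
  open RawMonoidDefinitions +-rawMonoid public using () renaming (_×_ to _ℕ×_)

  ∣_∣ : Op₁ Carrier
  ∣ x ∣ = max x (- x)

module Plane {c ℓ₁ ℓ₂ : Level} (ℝ : RealNumbers c ℓ₁ ℓ₂) where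

  open RealNumbers ℝ

  infix  4 _∈ˡ_ _∈ᶜ_ _∥_
  infixl 6 _⊕_ _⊖_
  infixr 7 _·_

  ℝ²-setoid : Setoid c ℓ₁
  ℝ²-setoid = ×-setoid setoid setoid

  open Setoid ℝ²-setoid public using () renaming (Carrier to ℝ²; _≈_ to _≈₂_)

  0₂ : ℝ²
  0₂ = 0# , 0#

  _⊕_ _⊖_ : Op₂ ℝ²
  (x , y) ⊕ (x′ , y′) = x + x′ , y + y′
  (x , y) ⊖ (x′ , y′) = x - x′ , y - y′

  _·_ : Carrier → ℝ² → ℝ²
  t · (x , y) = t * x , t * y

  ⟨_,_⟩ : ℝ² → ℝ² → Carrier
  ⟨ (x , y) , (x′ , y′) ⟩ = x * x′ + y * y′

  ∥_∥∞ : ℝ² → Carrier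
  ∥ x , y ∥∞ = max ∣ x ∣ ∣ y ∣

  record Line : Set (c ⊔ ℓ₁) where
    field
      base        : ℝ²
      direction   : ℝ²
      direction≉0 : ¬ (direction ≈₂ 0₂)

  open Line public

  _∈ˡ_ : ℝ² → Line → Set (c ⊔ ℓ₁)
  p ∈ˡ l = ∃ λ t → p ≈₂ base l ⊕ t · direction l

  _∥_ : ℝ² → Line → Set (c ⊔ ℓ₁)
  v ∥ l = ∃ λ t → v ≈₂ t · direction l

  Horizontal Vertical : Line → Set ℓ₁
  Horizontal l = proj₂ (direction l) ≈ 0#
  Vertical   l = proj₁ (direction l) ≈ 0#

  IsOrthogonalProjection : (q p : ℝ²) → Line → Set (c ⊔ ℓ₁)
  IsOrthogonalProjection q p l = q ∈ˡ l × ⟨ p ⊖ q , direction l ⟩ ≈ 0#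

  record Circle∞ : Set (c ⊔ ℓ₁ ⊔ ℓ₂) where
    field
      centre   : ℝ²
      radius   : Carrier
      radius>0 : 0# < radius

  open Circle∞ public

  _∈ᶜ_ : ℝ² → Circle∞ → Set ℓ₁
  p ∈ᶜ C = ∥ p ⊖ centre C ∥∞ ≈ radius C

  -- A set of n points, presented by a listing without repetitions; the order
  -- of the listing carries no meaning, and other enumerations of the same set
  -- are obtained by permuting the indices.
  PointSet : ℕ → Set (c ⊔ ℓ₁)
  PointSet n = Injection (≡-setoid (Fin n)) ℝ²-setoid

  point : ∀ {n} → PointSet n → Fin n → ℝ²
  point = Injection.to

  -- The labels are 0, …, n-1 rather than 1, …, n.
  LineLike : ∀ {n} → PointSet n → Set ℓ₁
  LineLike {n} S = Σ[ φ ∈ Permutation′ n ] (∀ a b c d →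
    (∥ point S a ⊖ point S b ∥∞ ≈ ∥ point S c ⊖ point S d ∥∞) ⇔
    (ℕ.∣ toℕ (φ ⟨$⟩ʳ a) - toℕ (φ ⟨$⟩ʳ b) ∣ ≡ ℕ.∣ toℕ (φ ⟨$⟩ʳ c) - toℕ (φ ⟨$⟩ʳ d) ∣))

  NoThreeOnALine : ∀ {n} → PointSet n → Set (c ⊔ ℓ₁)
  NoThreeOnALine {n} S = (f : Fin 3 ↣ Fin n) →
    ¬ (∃ λ (l : Line) → ∀ i → point S (Injection.to f i) ∈ˡ l)

  NoFourOnACircle∞ : ∀ {n} → PointSet n → Set (c ⊔ ℓ₁ ⊔ ℓ₂)
  NoFourOnACircle∞ {n} S = (f : Fin 4 ↣ Fin n) →
    ¬ (∃ λ (C : Circle∞) → ∀ i → point S (Injection.to f i) ∈ᶜ C)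

  record LineLikeCrescent {n : ℕ} (S : PointSet n) : Set (c ⊔ ℓ₁ ⊔ ℓ₂) where
    field
      lineLike         : LineLike S
      noThreeOnALine   : NoThreeOnALine S
      noFourOnACircle∞ : NoFourOnACircle∞ S

  EquallySpacedOn : ∀ {n} → Line → (Fin n → ℝ²) → Set (c ⊔ ℓ₁)
  EquallySpacedOn l Q =
    (∀ i → Q i ∈ˡ l) ×
    ∃₂ λ q v → ¬ (v ≈₂ 0₂) × v ∥ l × (∀ i → Q i ≈₂ q ⊕ ((toℕ i ℕ× 1#) · v))

  PerpendicularPerturbation : ∀ {n} → PointSet n → Line → Set (c ⊔ ℓ₁)
  PerpendicularPerturbation {n} S l =
    Σ[ σ ∈ Permutation′ n ] Σ[ Q ∈ (Fin n → ℝ²) ]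
      EquallySpacedOn l Q ×
      (∀ i → IsOrthogonalProjection (Q i) (point S (σ ⟨$⟩ʳ i)) l)

module Submission where

-- Label the points P₀, …, Pₙ₋₁ as the equally spaced points of the line are
-- labelled, and let Dₖ be the distance of points whose labels differ by k.
-- Each distance is attained by one coordinate with one sign, so once such a
-- choice is made for some pairs, the hypotheses on seven consecutive points
-- become linear inequalities in the coordinates and the Dₖ. A finite tree of
-- choices settles the matter; in each leaf nonnegative combinations of the
-- inequalities yield Dₖ ≤ 0, or Dₖ = Dₗ, or three points on a line of slope ±1,
-- or four points on a square, or the desired conclusion. The first tree shows
-- that the distances D₂ among six consecutive points are all attained by the same
-- coordinate with the same sign; the second tree deduces that one coordinate of
-- seven consecutive points is an arithmetic progression. This coordinate is the
-- same for overlapping windows of seven points, as three points that form an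
-- arithmetic progression in both coordinates are collinear.

open import Defs
open import Algebra.Bundles using (CommutativeRing)
import Algebra.Construct.NaturalChoice.Max as NaturalMax
import Algebra.Construct.NaturalChoice.MaxOp as MaxOperatorProperties
import Algebra.Properties.AbelianGroup as AbelianGroupProperties
import Algebra.Properties.CommutativeSemigroup as CommutativeSemigroupProperties
import Algebra.Properties.Ring as RingProperties
import Algebra.Solver.CommutativeMonoid.Normal as CommutativeMonoidNormal
open import Level using (Level; _⊔_)
open import Data.Bool.Base using (Bool; true; false; T; _∧_; if_then_else_)
open import Data.Empty using (⊥-elim)
open import Data.Fin.Base using (Fin; zero; suc; toℕ; inject₁; _↑ˡ_; _↑ʳ_)
open import Data.Fin.Patterns
open import Data.Fin.Permutation using (Permutation′; _⟨$⟩ʳ_; _⟨$⟩ˡ_; flip; inverseʳ)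
open import Data.Fin.Properties using (_≟_; all?; toℕ-injective; toℕ-fromℕ<; toℕ<n; toℕ-inject₁)
open import Data.List.Base as List using (List; []; _∷_; concatMap)
open import Data.List.Relation.Unary.All using (All; []; _∷_)
open import Data.Nat.Base as ℕ using (ℕ; zero; suc; z≤n; s≤s; NonZero)
open import Data.Nat.DivMod using (_mod_; m<n⇒m%n≡m; m%n<n)
import Data.Nat.Properties as ℕ
open import Data.Product.Base using (_×_; _,_; proj₁; proj₂; ∃)
open import Data.Sum.Base using (_⊎_; inj₁; inj₂; [_,_]′)
open import Data.Unit.Base using (tt)
open import Data.Vec.Base using (Vec; []; _∷_; tabulate; lookup; _++_)
open import Data.Vec.Properties using (lookup-++ˡ; lookup-++ʳ; lookup∘tabulate)
open import Function.Base using (_∘_; _$_; id)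
open import Function.Bundles using (Equivalence; Injection; _⇔_; mk↣)
open import Relation.Binary.Bundles using (DecTotalOrder)
open import Relation.Binary.PropositionalEquality.Core as ≡ using (_≡_; _≢_; refl; cong; subst)
import Relation.Binary.Reasoning.PartialOrder as PosetReasoning
open import Relation.Nullary.Decidable.Core using (Dec; yes; no; ⌊_⌋; toWitness; _→-dec_; ¬?)
open import Relation.Nullary.Negation.Core using (¬_; contradiction)

-- Interchanging or reflecting the axes preserves every hypothesis. So the first tree may assume
-- that points 2 and 3 are D₁ apart in the direction of increasing X and that Y₂ ≤ Y₃, and the
-- second that the D₂ run in the direction of increasing X and that Y₀ ≤ Y₁. A choice for a pair
-- supplies only the reverse of a bound that holds anyway, hence an equation.
--
-- The D₂ are the intermediate goal because they chain: X₄ - X₀ = 2 D₂ ≤ D₄, and if Y attained D₄,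
-- then D₄ ≤ 2 D₂ would put points 0, 2, 4 on a diagonal; likewise 1, 3, 5. So these D₄ run along X
-- too, which leaves open how the odd points interleave with the even ones. Point 6 helps to settle
-- this: X₁ + D₄ ≤ X₅ ≤ X₀ + D₅ and X₁ + D₅ ≤ X₆ ≤ X₂ + D₄ add up to 2 X₁ ≤ X₀ + X₂.
--
-- Certificates are plain data. Their checker is a Boolean function that never touches a real
-- number, so it runs during type checking while `ℝ` stays abstract, and one soundness proof serves
-- both trees.

data Axis : Set where
  X Y : Axis

other : Axis → Axis
other X = Y
other Y = X

-- The difference of two labels, kept in `Fin n` so that it indexes the distances directly; on
-- literals it computes, so terms with equal differences become the same variable.
gap : ∀ {n} → Fin n → Fin n → Fin n
gap zero    j       = j
gap (suc i) zero    = suc i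
gap (suc i) (suc j) = inject₁ (gap i j)

∧-split : ∀ a {b} → T (a ∧ b) → T a × T b
∧-split true ok = tt , ok

-- Syntax of linear inequalities and of certificates.

infix  4 _⇐_
infix  6 _≼_
infixl 7 _⊞_
infixr 8 _⊠_

-- Linear forms with natural coefficients. Without subtraction, two terms agree as soon as they
-- contain the same variables equally often, which a normal form for commutative monoids decides;
-- negative parts are moved across the inequality.
data Term : Set where
  at   : Axis → Fin 7 → Term
  dist : Fin 7 → Term
  𝟘    : Term
  _⊞_  : Term → Term → Term

_⊠_ : ℕ → Term → Term
zero  ⊠ t = 𝟘
suc m ⊠ t = t ⊞ m ⊠ t

record Inequality : Set where
  constructor _≼_
  field
    lhs rhs : Term

open Inequality

Context : Set
Context = List Inequality

-- `bounded` holds for all pairs, as no coordinate difference exceeds the distance. `reaching` is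
-- the opposite inequality, so assuming it makes the difference from `i` to `j` equal to the
-- distance. `below` only serves to fix an orientation.
bounded reaching below : Axis → (i j : Fin 7) → Inequality
bounded  a i j = at a i ≼ at a j ⊞ dist (gap i j)
reaching a i j = at a i ⊞ dist (gap i j) ≼ at a j
below    a i j = at a i ≼ at a j

-- given k is the k-th most recent assumption, or 0 ≤ 0 if there is none.
data Fact : Set where
  short : Axis → (i j : Fin 7) → Fact
  given : ℕ → Fact

-- The claim that the sum of the facts in the list is a positive multiple of the
-- inequality to be proved.
record Farkas : Set where
  constructor _⇐_
  field
    multiple    : ℕ
    combination : List Fact

fact : Context → Fact → Inequality
fact Γ       (short a i j)   = bounded a i j
fact []      (given k)       = 𝟘 ≼ 𝟘
fact (h ∷ Γ) (given zero)    = h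
fact (h ∷ Γ) (given (suc k)) = fact Γ (given k)

combine : Context → List Fact → Inequality
combine Γ []      = 𝟘 ≼ 𝟘
combine Γ (f ∷ c) = lhs (fact Γ f) ⊞ lhs (combine Γ c) ≼ rhs (fact Γ f) ⊞ rhs (combine Γ c)

data Slope : Set where
  rising falling : Slope

-- Compares x - y for slope 1 and x + y for slope -1, the forms that are constant along such lines.
level : Slope → (i j : Fin 7) → Inequality
level rising  i j = at X i ⊞ at Y j ≼ at X j ⊞ at Y i
level falling i j = at X i ⊞ at Y i ≼ at X j ⊞ at Y j

levels : Slope → (i j k : Fin 7) → List Inequality
levels s i j k = level s i j ∷ level s j i ∷ level s i k ∷ level s k i ∷ []

data Side : Set where
  low high : Side

-- As terms have no subtraction, the coordinates of the lower left corner and the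
-- width are given as differences of terms.
record Square : Set where
  field
    corner⁺ corner⁻ : Axis → Term
    width⁺ width⁻   : Term

open Square

-- The square whose sides on the axis a pass through p and q and whose low or
-- high side on the other axis passes through r.
spanned : (a : Axis) (p q r : Fin 7) → Side → Square
spanned a p q r s = record
  { corner⁺ = λ b → if same a b then at a p else cross⁺ s
  ; corner⁻ = λ b → if same a b then 𝟘 else cross⁻ s
  ; width⁺  = at a q
  ; width⁻  = at a p
  }
  where
  same : Axis → Axis → Bool
  same X X = true
  same Y Y = true
  same _ _ = false
  cross⁺ cross⁻ : Side → Term
  cross⁺ low  = at (other a) r
  cross⁺ high = at (other a) r ⊞ at a p
  cross⁻ low  = 𝟘
  cross⁻ high = at a q

-- The subtracted parts of corner and width appear on the opposite side of the inequality. `beyond`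
-- is the converse of `within`, so both together place a point on that side of the square.
within beyond : Square → Axis → Side → Fin 7 → Inequality
within S a low  i = corner⁺ S a ≼ at a i ⊞ corner⁻ S a
within S a high i = at a i ⊞ (corner⁻ S a ⊞ width⁻ S) ≼ corner⁺ S a ⊞ width⁺ S
beyond S a s    i = rhs (within S a s i) ≼ lhs (within S a s i)

record Position : Set where
  constructor position
  field
    vertex                      : Fin 7
    X-low X-high Y-low Y-high   : Farkas
    axis                        : Axis
    side                        : Side
    border                      : Farkas

open Position

-- A `split` has one subtree for each way to attain the distance of `i` and `j`: by X or Y,
-- increasing or decreasing from `i` to `j`. The next four constructors are contradictions. A
-- `conclude` names the goal that it reaches, since different leaves may reach different ones.
data Certificate (I : Set) : Set where
  split    : (i j : Fin 7) (X⁺ X⁻ Y⁺ Y⁻ : Certificate I) → Certificate I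
  vanish   : (k : Fin 7) → Farkas → Certificate I
  equal    : (k l : Fin 7) (k≤l l≤k : Farkas) → Certificate I
  line     : Slope → (i j k : Fin 7) (i≤j j≤i i≤k k≤i : Farkas) → Certificate I
  circle   : Square → Vec Position 4 → Certificate I
  conclude : I → List Farkas → Certificate I

Injective : ∀ {m n} → (Fin m → Fin n) → Set
Injective f = ∀ i j → f i ≡ f j → i ≡ j

injective? : ∀ {m n} (f : Fin m → Fin n) → Dec (Injective f)
injective? f = all? λ i → all? λ j → (f i ≟ f j) →-dec (i ≟ j)

allFin : ∀ {n} → (Fin n → Bool) → Bool
allFin {zero}  f = true
allFin {suc n} f = f zero ∧ allFin (f ∘ suc)

-- The index is a direction: an axis and whether the coordinate increases with the label.
half : Axis × Bool → List Inequality
half (a , true)  = reaching a 0F 2F ∷ reaching a 1F 3F ∷ reaching a 2F 4F ∷ reaching a 3F 5F ∷ []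
half (a , false) = reaching a 2F 0F ∷ reaching a 3F 1F ∷ reaching a 4F 2F ∷ reaching a 5F 3F ∷ []

double ends : Axis → (i : Fin 5) → Term
double a i = at a (inject₁ (suc i)) ⊞ at a (inject₁ (suc i))
ends   a i = at a (inject₁ (inject₁ i)) ⊞ at a (suc (suc i))

-- Each vanishing second difference is given as two inequalities, since a combination of facts
-- proves inequalities only.
progression : Axis → List Inequality
progression a = concatMap (λ i → double a i ≼ ends a i ∷ ends a i ≼ double a i ∷ []) (List.allFin 5)

-- The two trees.

-- The trees below were found by a computer search, their combinations by linear
-- programming.
half-certificate : Certificate (Axis × Bool)
half-certificate =
  split 1F 3F
    (split 1F 2F
      (split 2F 4F
        (split 0F 3F
          (split 1F 5F
            -- The pairs 1, 3 and 2, 4 were split on, so their facts are assumptions. The other two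
            -- follow indirectly: X₁ + D₁ ≤ X₂, X₂ + D₂ ≤ X₄ and X₀ + D₃ ≤ X₃ with the bounds X₃ ≤
            -- X₂ + D₁ and X₄ ≤ X₁ + D₃ add up to X₀ + D₂ ≤ X₂.
            (conclude (X , true) ((1 ⇐ given 3 ∷ given 2 ∷ given 1 ∷ short X 3F 2F ∷ short X 4F 1F ∷
               []) ∷ (1 ⇐ given 4 ∷ []) ∷ (1 ⇐ given 2 ∷ []) ∷ (1 ⇐ given 3 ∷ given 2 ∷ given 2 ∷
               given 1 ∷ given 0 ∷ short X 3F 1F ∷ short X 3F 2F ∷ short X 4F 0F ∷ short X 4F 1F ∷
               []) ∷ []))
            (vanish 4F (1 ⇐ given 4 ∷ given 0 ∷ short X 3F 5F ∷ []))
            (line rising 1F 2F 3F (1 ⇐ given 3 ∷ short Y 2F 1F ∷ []) (1 ⇐ given 2 ∷ given 1 ∷ given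
               0 ∷ short X 3F 1F ∷ short X 4F 0F ∷ short Y 5F 2F ∷ []) (1 ⇐ given 4 ∷ short Y 3F 1F
               ∷ []) (1 ⇐ given 3 ∷ given 2 ∷ given 2 ∷ given 1 ∷ given 0 ∷ short X 3F 1F ∷ short X
               3F 2F ∷ short X 4F 0F ∷ short X 4F 1F ∷ short Y 5F 3F ∷ []))
            (vanish 1F (1 ⇐ given 6 ∷ given 3 ∷ given 3 ∷ given 2 ∷ given 2 ∷ given 1 ∷ given 0 ∷
               short X 3F 1F ∷ short X 4F 0F ∷ short X 4F 1F ∷ short Y 1F 2F ∷ short Y 3F 5F ∷ [])))
          (vanish 2F (2 ⇐ given 3 ∷ given 2 ∷ given 1 ∷ given 0 ∷ short X 0F 1F ∷ short X 4F 1F ∷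
             []))
          (line rising 1F 2F 3F (1 ⇐ given 2 ∷ short Y 2F 1F ∷ []) (1 ⇐ given 4 ∷ given 2 ∷ given 1
             ∷ given 0 ∷ short X 3F 1F ∷ short X 4F 1F ∷ short Y 1F 0F ∷ short Y 3F 2F ∷ []) (1 ⇐
             given 3 ∷ short Y 3F 1F ∷ []) (1 ⇐ given 2 ∷ given 1 ∷ given 0 ∷ short X 3F 1F ∷ short
             X 4F 1F ∷ short Y 1F 0F ∷ []))
          (vanish 1F (1 ⇐ given 5 ∷ given 2 ∷ given 1 ∷ given 0 ∷ short X 4F 1F ∷ short Y 0F 2F ∷
             [])))
        (vanish 2F (1 ⇐ given 3 ∷ given 0 ∷ short X 3F 4F ∷ []))
        (split 1F 4F
          (split 3F 5F
            (line rising 2F 3F 4F (1 ⇐ given 5 ∷ short Y 3F 2F ∷ []) (1 ⇐ given 3 ∷ given 2 ∷ short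
               X 3F 1F ∷ short Y 4F 3F ∷ []) (1 ⇐ given 5 ∷ given 0 ∷ short X 5F 4F ∷ short Y 4F 2F
               ∷ []) (1 ⇐ given 2 ∷ short X 4F 2F ∷ []))
            (equal 1F 3F (1 ⇐ given 5 ∷ given 3 ∷ short X 0F 1F ∷ short X 3F 0F ∷ []) (1 ⇐ given 1 ∷
               given 0 ∷ short X 3F 1F ∷ short X 4F 5F ∷ []))
            (line rising 2F 3F 4F (1 ⇐ given 5 ∷ short Y 3F 2F ∷ []) (1 ⇐ given 3 ∷ given 2 ∷ short
               X 3F 1F ∷ short Y 4F 3F ∷ []) (1 ⇐ given 5 ∷ given 1 ∷ given 0 ∷ short X 3F 1F ∷
               short Y 4F 3F ∷ short Y 5F 2F ∷ []) (1 ⇐ given 2 ∷ short X 4F 2F ∷ []))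
            (vanish 2F (1 ⇐ given 5 ∷ given 3 ∷ given 2 ∷ given 0 ∷ short X 3F 1F ∷ short Y 3F 2F ∷
               short Y 4F 5F ∷ [])))
          (vanish 3F (2 ⇐ given 3 ∷ given 2 ∷ given 0 ∷ given 0 ∷ short X 2F 4F ∷ short X 3F 4F ∷
             []))
          (split 0F 2F
            (line rising 1F 2F 3F (1 ⇐ given 3 ∷ short Y 2F 1F ∷ []) (1 ⇐ given 5 ∷ given 1 ∷ given
               0 ∷ short X 2F 1F ∷ short X 3F 0F ∷ short Y 4F 2F ∷ []) (1 ⇐ given 4 ∷ short Y 3F 1F
               ∷ []) (1 ⇐ given 5 ∷ given 1 ∷ given 0 ∷ short X 3F 0F ∷ short X 3F 1F ∷ short Y 4F
               3F ∷ []))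
            (vanish 2F (1 ⇐ given 3 ∷ given 0 ∷ short X 0F 1F ∷ []))
            (line rising 1F 2F 3F (1 ⇐ given 3 ∷ short Y 2F 1F ∷ []) (1 ⇐ given 5 ∷ given 0 ∷ short
               X 3F 1F ∷ short Y 1F 0F ∷ []) (1 ⇐ given 4 ∷ short Y 3F 1F ∷ []) (1 ⇐ given 5 ∷ given
               3 ∷ given 2 ∷ given 0 ∷ short X 3F 1F ∷ short X 3F 1F ∷ short Y 1F 0F ∷ short Y 4F 3F
               ∷ []))
            (equal 1F 3F (1 ⇐ given 5 ∷ given 3 ∷ short X 0F 1F ∷ short X 3F 0F ∷ []) (1 ⇐ given 1 ∷
               given 0 ∷ short Y 0F 1F ∷ short Y 4F 2F ∷ [])))
          (vanish 2F (1 ⇐ given 4 ∷ given 2 ∷ given 1 ∷ given 0 ∷ short X 0F 1F ∷ short X 3F 0F ∷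
             short Y 1F 2F ∷ [])))
        (vanish 1F (1 ⇐ given 4 ∷ given 3 ∷ given 1 ∷ given 0 ∷ short X 3F 1F ∷ short Y 3F 4F ∷ [])))
      (vanish 2F (1 ⇐ given 1 ∷ given 0 ∷ short X 3F 2F ∷ []))
      (split 0F 2F
        (split 2F 5F
          (conclude (X , true) ((1 ⇐ given 1 ∷ []) ∷ (1 ⇐ given 3 ∷ []) ∷ (1 ⇐ given 4 ∷ given 1 ∷
             given 0 ∷ short X 3F 0F ∷ short X 5F 4F ∷ []) ∷ (1 ⇐ given 1 ∷ given 0 ∷ short X 3F 0F
             ∷ []) ∷ []))
          (vanish 1F (2 ⇐ given 4 ∷ given 4 ∷ given 1 ∷ given 0 ∷ short X 3F 0F ∷ short X 3F 5F ∷
             []))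
          (line rising 1F 2F 3F (1 ⇐ given 3 ∷ given 1 ∷ given 0 ∷ short X 3F 0F ∷ short Y 3F 1F ∷
             short Y 5F 3F ∷ []) (1 ⇐ given 2 ∷ short X 2F 1F ∷ []) (1 ⇐ given 3 ∷ short Y 3F 1F ∷
             []) (1 ⇐ given 2 ∷ given 1 ∷ given 0 ∷ short X 2F 1F ∷ short X 3F 0F ∷ short Y 5F 3F ∷
             []))
          (vanish 1F (1 ⇐ given 5 ∷ given 4 ∷ given 1 ∷ given 0 ∷ short X 3F 0F ∷ short Y 3F 5F ∷
             [])))
        (equal 1F 2F (1 ⇐ given 4 ∷ given 1 ∷ short Y 3F 1F ∷ []) (2 ⇐ given 2 ∷ given 0 ∷ short X
           0F 1F ∷ short X 3F 2F ∷ []))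
        (split 2F 5F
          (split 0F 1F
            (conclude (X , true) ((1 ⇐ given 4 ∷ given 0 ∷ short X 3F 2F ∷ []) ∷ (1 ⇐ given 4 ∷ [])
               ∷ (1 ⇐ given 4 ∷ given 1 ∷ given 0 ∷ short X 3F 0F ∷ short X 5F 4F ∷ []) ∷ (1 ⇐ given
               4 ∷ given 1 ∷ given 0 ∷ short X 3F 0F ∷ short X 3F 2F ∷ []) ∷ []))
            (split 0F 3F
              (vanish 1F (1 ⇐ given 7 ∷ given 3 ∷ given 1 ∷ given 0 ∷ short X 3F 1F ∷ short Y 3F 0F
                 ∷ []))
              (vanish 1F (1 ⇐ given 7 ∷ given 6 ∷ given 3 ∷ given 0 ∷ short X 0F 2F ∷ short Y 3F 0F
                 ∷ []))
              (split 2F 4F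
                (split 0F 4F
                  (vanish 2F (1 ⇐ given 7 ∷ given 4 ∷ given 3 ∷ given 0 ∷ short X 3F 2F ∷ short X 4F
                     1F ∷ short X 5F 1F ∷ []))
                  (vanish 4F (1 ⇐ given 1 ∷ given 0 ∷ short X 0F 2F ∷ []))
                  (line rising 1F 3F 4F (1 ⇐ given 7 ∷ short Y 3F 1F ∷ []) (1 ⇐ given 6 ∷ given 2 ∷
                     given 1 ∷ short X 3F 2F ∷ short X 4F 1F ∷ short Y 2F 0F ∷ []) (1 ⇐ given 7 ∷
                     given 6 ∷ given 2 ∷ given 1 ∷ short X 3F 2F ∷ short Y 2F 0F ∷ short Y 3F 1F ∷
                     short Y 4F 1F ∷ []) (1 ⇐ given 7 ∷ given 6 ∷ given 4 ∷ given 0 ∷ short X 3F 2F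
                     ∷ short X 4F 1F ∷ short X 5F 1F ∷ short Y 2F 0F ∷ []))
                  (vanish 4F (1 ⇐ given 5 ∷ given 0 ∷ short Y 2F 4F ∷ [])))
                (vanish 2F (1 ⇐ given 7 ∷ given 0 ∷ short X 3F 4F ∷ []))
                (line rising 1F 2F 3F (1 ⇐ given 6 ∷ given 5 ∷ given 1 ∷ given 0 ∷ short X 3F 2F ∷
                   short Y 2F 0F ∷ short Y 3F 1F ∷ short Y 4F 1F ∷ []) (1 ⇐ given 5 ∷ short X 2F 1F
                   ∷ []) (1 ⇐ given 6 ∷ short Y 3F 1F ∷ []) (1 ⇐ given 5 ∷ given 0 ∷ short X 3F 1F ∷
                   short Y 4F 3F ∷ []))
                (equal 1F 3F (2 ⇐ given 8 ∷ given 8 ∷ given 7 ∷ given 4 ∷ given 4 ∷ given 2 ∷ short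
                   X 0F 2F ∷ short X 3F 1F ∷ short Y 3F 0F ∷ short Y 3F 0F ∷ []) (1 ⇐ given 1 ∷
                   given 0 ∷ short Y 2F 0F ∷ short Y 3F 4F ∷ [])))
              (vanish 2F (2 ⇐ given 7 ∷ given 7 ∷ given 3 ∷ given 3 ∷ given 0 ∷ short Y 3F 0F ∷ [])))
            (split 0F 4F
              (line rising 0F 1F 2F (1 ⇐ given 5 ∷ given 4 ∷ given 2 ∷ given 0 ∷ short X 3F 2F ∷
                 short X 4F 1F ∷ short X 5F 1F ∷ short Y 2F 0F ∷ []) (1 ⇐ given 1 ∷ short X 1F 0F ∷
                 []) (1 ⇐ given 5 ∷ given 5 ∷ given 4 ∷ given 2 ∷ given 1 ∷ given 0 ∷ short X 3F 2F
                 ∷ short X 3F 2F ∷ short X 4F 1F ∷ short X 5F 1F ∷ short Y 2F 0F ∷ short Y 2F 0F ∷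
                 []) (1 ⇐ given 3 ∷ short X 2F 0F ∷ []))
              (vanish 4F (1 ⇐ given 5 ∷ given 4 ∷ given 1 ∷ given 0 ∷ short X 0F 1F ∷ short X 3F 4F
                 ∷ short Y 2F 0F ∷ []))
              (line rising 1F 2F 4F (1 ⇐ given 5 ∷ given 1 ∷ short X 3F 2F ∷ short Y 2F 0F ∷ []) (1
                 ⇐ given 4 ∷ short X 2F 1F ∷ []) (1 ⇐ given 5 ∷ given 4 ∷ given 2 ∷ given 1 ∷ short
                 X 3F 2F ∷ short X 5F 4F ∷ short Y 2F 0F ∷ short Y 4F 1F ∷ []) (1 ⇐ given 5 ∷ given
                 4 ∷ given 2 ∷ given 0 ∷ short X 3F 2F ∷ short X 4F 1F ∷ short X 5F 1F ∷ short Y 2F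
                 0F ∷ []))
              (vanish 4F (1 ⇐ given 3 ∷ given 0 ∷ short Y 2F 4F ∷ [])))
            (vanish 2F (1 ⇐ given 2 ∷ given 0 ∷ short Y 2F 1F ∷ [])))
          (vanish 1F (1 ⇐ given 5 ∷ given 4 ∷ given 1 ∷ given 0 ∷ short X 3F 5F ∷ short Y 3F 0F ∷
             []))
          (split 2F 4F
            (line rising 1F 3F 4F (1 ⇐ given 4 ∷ short Y 3F 1F ∷ []) (1 ⇐ given 3 ∷ given 1 ∷ given
               0 ∷ short X 3F 2F ∷ short X 4F 1F ∷ short Y 5F 3F ∷ []) (1 ⇐ given 4 ∷ given 3 ∷
               given 1 ∷ given 0 ∷ short X 3F 2F ∷ short Y 3F 1F ∷ short Y 4F 1F ∷ short Y 5F 3F ∷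
               []) (1 ⇐ given 3 ∷ given 1 ∷ short X 4F 1F ∷ short Y 5F 4F ∷ []))
            (vanish 2F (1 ⇐ given 5 ∷ given 0 ∷ short X 3F 4F ∷ []))
            (line rising 1F 2F 3F (1 ⇐ given 4 ∷ given 3 ∷ given 1 ∷ given 0 ∷ short X 3F 2F ∷ short
               Y 3F 1F ∷ short Y 4F 1F ∷ short Y 5F 3F ∷ []) (1 ⇐ given 3 ∷ short X 2F 1F ∷ []) (1 ⇐
               given 4 ∷ short Y 3F 1F ∷ []) (1 ⇐ given 3 ∷ given 0 ∷ short X 3F 1F ∷ short Y 4F 3F
               ∷ []))
            (vanish 3F (1 ⇐ given 6 ∷ given 3 ∷ given 1 ∷ given 0 ∷ short Y 3F 1F ∷ short Y 5F 4F ∷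
               [])))
          (equal 2F 3F (1 ⇐ given 5 ∷ given 1 ∷ short Y 3F 0F ∷ []) (1 ⇐ given 5 ∷ given 0 ∷ short Y
             3F 5F ∷ [])))
        (vanish 2F (1 ⇐ given 1 ∷ given 0 ∷ short Y 0F 1F ∷ [])))
      (split 1F 4F
        (split 0F 2F
          (split 1F 5F
            (conclude (X , true) ((1 ⇐ given 1 ∷ []) ∷ (1 ⇐ given 4 ∷ []) ∷ (1 ⇐ given 5 ∷ given 2 ∷
               given 1 ∷ short X 2F 1F ∷ short X 3F 0F ∷ []) ∷ (1 ⇐ given 5 ∷ given 2 ∷ given 1 ∷
               given 1 ∷ given 0 ∷ short X 2F 1F ∷ short X 3F 0F ∷ short X 3F 1F ∷ short X 4F 0F ∷
               []) ∷ []))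
            (vanish 4F (1 ⇐ given 4 ∷ given 0 ∷ short X 3F 5F ∷ []))
            (vanish 2F (1 ⇐ given 3 ∷ given 2 ∷ given 1 ∷ given 0 ∷ short X 2F 1F ∷ short X 4F 0F ∷
               short Y 5F 2F ∷ []))
            (vanish 1F (1 ⇐ given 6 ∷ given 5 ∷ given 5 ∷ given 2 ∷ given 1 ∷ given 1 ∷ given 0 ∷
               short X 3F 0F ∷ short X 3F 1F ∷ short X 4F 0F ∷ short Y 1F 2F ∷ short Y 3F 5F ∷ [])))
          (split 0F 1F
            (vanish 2F (2 ⇐ given 4 ∷ given 1 ∷ given 0 ∷ short X 3F 2F ∷ []))
            (equal 1F 2F (2 ⇐ given 5 ∷ given 0 ∷ short X 0F 2F ∷ short X 3F 1F ∷ []) (2 ⇐ given 4 ∷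
               given 1 ∷ short X 0F 1F ∷ short X 3F 2F ∷ []))
            (circle (spanned X 2F 3F 0F low) (position 0F (2 ⇐ given 1 ∷ short X 2F 0F ∷ []) (2 ⇐
               given 5 ∷ given 4 ∷ short X 0F 1F ∷ short X 0F 2F ∷ []) (1 ⇐ []) (2 ⇐ given 5 ∷ short
               X 2F 3F ∷ []) Y low (1 ⇐ []) ∷ position 1F (2 ⇐ given 5 ∷ given 1 ∷ short X 0F 1F ∷
               short X 3F 1F ∷ []) (2 ⇐ given 4 ∷ short X 1F 3F ∷ []) (2 ⇐ given 0 ∷ short Y 0F 1F ∷
               []) (1 ⇐ given 5 ∷ short Y 1F 0F ∷ []) Y high (1 ⇐ given 0 ∷ short X 3F 2F ∷ []) ∷
               position 2F (1 ⇐ []) (2 ⇐ given 5 ∷ short X 2F 3F ∷ []) (1 ⇐ given 0 ∷ short Y 1F 2F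
               ∷ []) (2 ⇐ given 5 ∷ given 3 ∷ given 3 ∷ short X 2F 3F ∷ short Y 1F 0F ∷ short Y 1F
               0F ∷ []) X low (1 ⇐ []) ∷ position 3F (2 ⇐ given 5 ∷ short X 2F 3F ∷ []) (1 ⇐ []) (1
               ⇐ given 6 ∷ given 0 ∷ short Y 1F 2F ∷ []) (1 ⇐ given 5 ∷ given 3 ∷ short Y 1F 0F ∷
               short Y 3F 2F ∷ []) X high (1 ⇐ []) ∷ []))
            (vanish 2F (1 ⇐ given 4 ∷ given 3 ∷ given 1 ∷ given 0 ∷ short X 0F 1F ∷ short X 3F 2F ∷
               short Y 0F 2F ∷ [])))
          (vanish 2F (1 ⇐ given 2 ∷ given 0 ∷ short Y 1F 0F ∷ []))
          (split 0F 1F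
            (line falling 0F 1F 2F (1 ⇐ given 0 ∷ short Y 0F 1F ∷ []) (1 ⇐ given 5 ∷ given 2 ∷ given
               1 ∷ short X 3F 0F ∷ short X 4F 2F ∷ short Y 1F 2F ∷ []) (1 ⇐ given 4 ∷ given 0 ∷
               short X 3F 2F ∷ short Y 0F 2F ∷ []) (1 ⇐ given 1 ∷ short X 2F 0F ∷ []))
            (circle (spanned X 1F 3F 2F low) (position 0F (2 ⇐ given 0 ∷ short X 1F 0F ∷ []) (2 ⇐
               given 5 ∷ given 4 ∷ short X 0F 1F ∷ short X 0F 2F ∷ []) (2 ⇐ given 1 ∷ short Y 2F 0F
               ∷ []) (1 ⇐ given 4 ∷ short Y 0F 2F ∷ []) Y high (1 ⇐ given 1 ∷ short X 3F 1F ∷ []) ∷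
               position 1F (1 ⇐ []) (2 ⇐ given 4 ∷ short X 1F 3F ∷ []) (2 ⇐ given 3 ∷ short Y 2F 1F
               ∷ []) (2 ⇐ given 5 ∷ given 4 ∷ given 0 ∷ short X 0F 2F ∷ short Y 1F 2F ∷ short Y 1F
               2F ∷ []) X low (1 ⇐ []) ∷ position 2F (2 ⇐ given 4 ∷ given 0 ∷ short X 0F 2F ∷ short
               X 3F 2F ∷ []) (2 ⇐ given 5 ∷ short X 2F 3F ∷ []) (1 ⇐ []) (2 ⇐ given 4 ∷ short X 1F
               3F ∷ []) Y low (1 ⇐ []) ∷ position 3F (2 ⇐ given 4 ∷ short X 1F 3F ∷ []) (1 ⇐ []) (1
               ⇐ given 6 ∷ []) (2 ⇐ given 5 ∷ given 4 ∷ given 0 ∷ short X 0F 2F ∷ short Y 3F 2F ∷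
               short Y 3F 2F ∷ []) X high (1 ⇐ []) ∷ []))
            (vanish 2F (1 ⇐ given 1 ∷ given 0 ∷ short Y 1F 2F ∷ []))
            (split 0F 3F
              (split 2F 4F
                (line falling 0F 1F 2F (1 ⇐ given 5 ∷ given 1 ∷ given 0 ∷ short X 3F 2F ∷ short X 4F
                   1F ∷ short Y 0F 2F ∷ []) (1 ⇐ given 2 ∷ short X 1F 0F ∷ []) (1 ⇐ given 6 ∷ given
                   5 ∷ given 2 ∷ given 1 ∷ given 0 ∷ short X 3F 2F ∷ short X 3F 2F ∷ short X 4F 1F ∷
                   short Y 0F 2F ∷ short Y 0F 2F ∷ []) (1 ⇐ given 3 ∷ short X 2F 0F ∷ []))
                (vanish 2F (1 ⇐ given 7 ∷ given 0 ∷ short X 3F 4F ∷ []))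
                (split 3F 5F
                  (line rising 2F 3F 4F (1 ⇐ given 8 ∷ short Y 3F 2F ∷ []) (2 ⇐ given 6 ∷ given 5 ∷
                     given 3 ∷ given 1 ∷ given 1 ∷ given 0 ∷ short X 3F 1F ∷ short X 4F 2F ∷ short X
                     5F 2F ∷ short Y 0F 2F ∷ short Y 4F 3F ∷ short Y 4F 3F ∷ []) (1 ⇐ given 8 ∷
                     given 0 ∷ short X 5F 4F ∷ short Y 4F 2F ∷ []) (1 ⇐ given 1 ∷ short X 4F 2F ∷
                     []))
                  (equal 1F 3F (1 ⇐ given 3 ∷ given 1 ∷ short Y 0F 2F ∷ short Y 4F 1F ∷ []) (1 ⇐
                     given 5 ∷ given 0 ∷ short X 3F 1F ∷ short X 4F 5F ∷ []))
                  (line rising 2F 3F 4F (1 ⇐ given 8 ∷ short Y 3F 2F ∷ []) (1 ⇐ given 6 ∷ given 3 ∷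
                     given 1 ∷ short X 3F 2F ∷ short Y 0F 2F ∷ short Y 4F 3F ∷ []) (1 ⇐ given 8 ∷
                     given 5 ∷ given 0 ∷ short X 3F 1F ∷ short Y 4F 3F ∷ short Y 5F 2F ∷ []) (1 ⇐
                     given 1 ∷ short X 4F 2F ∷ []))
                  (vanish 2F (1 ⇐ given 6 ∷ given 3 ∷ given 1 ∷ given 0 ∷ short Y 0F 2F ∷ short Y 3F
                     2F ∷ short Y 4F 5F ∷ [])))
                (vanish 1F (1 ⇐ given 8 ∷ given 5 ∷ given 2 ∷ given 0 ∷ short Y 0F 2F ∷ short Y 3F
                   4F ∷ [])))
              (vanish 3F (2 ⇐ given 6 ∷ given 5 ∷ given 0 ∷ given 0 ∷ short X 0F 1F ∷ short X 0F 2F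
                 ∷ []))
              (vanish 3F (2 ⇐ given 2 ∷ given 1 ∷ given 0 ∷ given 0 ∷ short Y 3F 1F ∷ short Y 3F 2F
                 ∷ []))
              (circle (spanned X 1F 3F 2F low) (position 0F (1 ⇐ given 7 ∷ given 5 ∷ given 0 ∷ short
                 X 3F 0F ∷ short Y 0F 2F ∷ []) (2 ⇐ given 6 ∷ given 5 ∷ short X 0F 1F ∷ short X 0F
                 2F ∷ []) (2 ⇐ given 2 ∷ short Y 2F 0F ∷ []) (1 ⇐ given 5 ∷ short Y 0F 2F ∷ []) Y
                 high (1 ⇐ given 2 ∷ short X 3F 1F ∷ []) ∷ position 1F (1 ⇐ []) (2 ⇐ given 5 ∷ short
                 X 1F 3F ∷ []) (2 ⇐ given 4 ∷ short Y 2F 1F ∷ []) (4 ⇐ given 5 ∷ given 5 ∷ given 5 ∷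
                 given 1 ∷ given 1 ∷ short X 1F 3F ∷ short Y 0F 2F ∷ short Y 0F 2F ∷ short Y 1F 2F ∷
                 short Y 1F 2F ∷ []) X low (1 ⇐ []) ∷ position 2F (4 ⇐ given 5 ∷ given 5 ∷ given 5 ∷
                 given 4 ∷ given 3 ∷ given 1 ∷ short X 0F 2F ∷ short X 3F 0F ∷ short X 3F 2F ∷ short
                 X 3F 2F ∷ short X 4F 2F ∷ short Y 0F 2F ∷ []) (2 ⇐ given 6 ∷ short X 2F 3F ∷ []) (1
                 ⇐ []) (2 ⇐ given 5 ∷ short X 1F 3F ∷ []) Y low (1 ⇐ []) ∷ position 3F (2 ⇐ given 5
                 ∷ short X 1F 3F ∷ []) (1 ⇐ []) (1 ⇐ given 7 ∷ []) (2 ⇐ given 5 ∷ given 5 ∷ given 0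
                 ∷ short Y 0F 2F ∷ short Y 0F 2F ∷ short Y 3F 0F ∷ []) X high (1 ⇐ []) ∷ [])))))
        (circle (spanned X 2F 3F 2F low) (position 1F (2 ⇐ given 3 ∷ given 3 ∷ given 0 ∷ short X 0F
           1F ∷ short X 3F 0F ∷ short X 3F 4F ∷ []) (2 ⇐ given 2 ∷ short X 1F 3F ∷ []) (2 ⇐ given 1
           ∷ short Y 2F 1F ∷ []) (1 ⇐ given 3 ∷ short Y 1F 2F ∷ []) Y high (1 ⇐ given 1 ∷ short X 3F
           2F ∷ []) ∷ position 2F (1 ⇐ []) (2 ⇐ given 3 ∷ short X 2F 3F ∷ []) (1 ⇐ []) (2 ⇐ given 3
           ∷ short X 2F 3F ∷ []) X low (1 ⇐ []) ∷ position 3F (2 ⇐ given 3 ∷ short X 2F 3F ∷ []) (1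
           ⇐ []) (1 ⇐ given 4 ∷ []) (1 ⇐ given 3 ∷ short Y 3F 2F ∷ []) X high (1 ⇐ []) ∷ position 4F
           (1 ⇐ given 3 ∷ short X 3F 4F ∷ []) (6 ⇐ given 3 ∷ given 3 ∷ given 2 ∷ given 2 ∷ given 0 ∷
           short X 4F 1F ∷ short X 4F 2F ∷ short X 4F 2F ∷ short X 4F 3F ∷ short X 4F 3F ∷ []) (2 ⇐
           given 2 ∷ given 1 ∷ given 0 ∷ short X 3F 4F ∷ short Y 1F 4F ∷ short Y 2F 4F ∷ []) (2 ⇐
           given 3 ∷ given 3 ∷ given 2 ∷ given 0 ∷ short X 3F 4F ∷ short Y 1F 2F ∷ short Y 4F 1F ∷
           short Y 4F 2F ∷ []) X low (1 ⇐ given 2 ∷ given 0 ∷ short X 0F 2F ∷ short X 3F 0F ∷ []) ∷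
           []))
        (circle (spanned X 1F 3F 2F low) (position 1F (1 ⇐ []) (2 ⇐ given 2 ∷ short X 1F 3F ∷ []) (2
           ⇐ given 1 ∷ short Y 2F 1F ∷ []) (2 ⇐ given 2 ∷ given 2 ∷ given 0 ∷ short Y 1F 4F ∷ short
           Y 4F 2F ∷ short Y 4F 2F ∷ []) X low (1 ⇐ []) ∷ position 2F (2 ⇐ given 2 ∷ given 2 ∷ given
           1 ∷ given 0 ∷ short X 0F 2F ∷ short X 3F 0F ∷ short X 3F 2F ∷ short Y 4F 2F ∷ []) (2 ⇐
           given 3 ∷ short X 2F 3F ∷ []) (1 ⇐ []) (2 ⇐ given 2 ∷ short X 1F 3F ∷ []) Y low (1 ⇐ [])
           ∷ position 3F (2 ⇐ given 2 ∷ short X 1F 3F ∷ []) (1 ⇐ []) (1 ⇐ given 4 ∷ []) (2 ⇐ given 2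
           ∷ given 2 ∷ given 1 ∷ given 0 ∷ short Y 0F 2F ∷ short Y 3F 0F ∷ short Y 3F 2F ∷ short Y
           4F 2F ∷ []) X high (1 ⇐ []) ∷ position 4F (2 ⇐ given 2 ∷ given 1 ∷ given 0 ∷ short X 1F
           4F ∷ short X 3F 4F ∷ short Y 4F 2F ∷ []) (2 ⇐ given 2 ∷ given 1 ∷ given 0 ∷ short X 4F 1F
           ∷ short X 4F 3F ∷ short Y 4F 2F ∷ []) (4 ⇐ given 4 ∷ given 4 ∷ given 1 ∷ given 1 ∷ given
           0 ∷ short Y 1F 4F ∷ short Y 3F 4F ∷ short Y 3F 4F ∷ []) (1 ⇐ given 2 ∷ short Y 4F 2F ∷
           []) Y high (1 ⇐ given 1 ∷ given 0 ∷ short X 0F 1F ∷ short X 3F 0F ∷ []) ∷ []))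
        (split 0F 1F
          (circle (spanned X 0F 3F 4F low) (position 0F (1 ⇐ []) (2 ⇐ given 4 ∷ given 3 ∷ short X 0F
             1F ∷ short X 0F 2F ∷ []) (2 ⇐ given 3 ∷ given 1 ∷ given 1 ∷ given 0 ∷ short X 3F 0F ∷
             short Y 1F 0F ∷ short Y 1F 3F ∷ short Y 3F 0F ∷ []) (1 ⇐ given 5 ∷ given 3 ∷ given 0 ∷
             short Y 0F 2F ∷ short Y 3F 4F ∷ []) X low (1 ⇐ []) ∷ position 1F (2 ⇐ given 0 ∷ short X
             0F 1F ∷ []) (2 ⇐ given 3 ∷ short X 1F 3F ∷ []) (2 ⇐ given 1 ∷ short Y 4F 1F ∷ []) (1 ⇐
             given 3 ∷ given 0 ∷ short Y 1F 2F ∷ short Y 2F 4F ∷ []) Y high (1 ⇐ given 1 ∷ short X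
             3F 0F ∷ []) ∷ position 3F (2 ⇐ given 4 ∷ given 3 ∷ short X 0F 1F ∷ short X 0F 2F ∷ [])
             (1 ⇐ []) (2 ⇐ given 3 ∷ given 1 ∷ given 0 ∷ short X 3F 0F ∷ short Y 1F 3F ∷ short Y 4F
             3F ∷ []) (2 ⇐ given 4 ∷ given 3 ∷ given 0 ∷ short X 0F 2F ∷ short Y 3F 4F ∷ short Y 3F
             4F ∷ []) X high (1 ⇐ []) ∷ position 4F (3 ⇐ given 3 ∷ given 3 ∷ given 0 ∷ given 0 ∷
             short X 0F 2F ∷ short X 2F 4F ∷ short X 3F 4F ∷ short X 3F 4F ∷ []) (1 ⇐ given 5 ∷
             given 4 ∷ given 3 ∷ given 1 ∷ given 0 ∷ short X 3F 0F ∷ short X 4F 2F ∷ short Y 1F 2F ∷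
             short Y 3F 4F ∷ []) (1 ⇐ []) (2 ⇐ given 4 ∷ given 3 ∷ short X 0F 1F ∷ short X 0F 2F ∷
             []) Y low (1 ⇐ []) ∷ []))
          (split 0F 2F
            (vanish 2F (1 ⇐ given 1 ∷ given 0 ∷ short X 2F 1F ∷ []))
            (equal 1F 2F (2 ⇐ given 5 ∷ given 1 ∷ short X 0F 2F ∷ short X 3F 1F ∷ []) (2 ⇐ given 4 ∷
               given 0 ∷ short X 0F 1F ∷ short X 3F 2F ∷ []))
            (vanish 2F (1 ⇐ given 3 ∷ given 0 ∷ short Y 1F 0F ∷ []))
            (circle (spanned X 1F 3F 2F low) (position 0F (2 ⇐ given 1 ∷ short X 1F 0F ∷ []) (2 ⇐
               given 5 ∷ given 4 ∷ short X 0F 1F ∷ short X 0F 2F ∷ []) (2 ⇐ given 0 ∷ short Y 2F 0F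
               ∷ []) (1 ⇐ given 4 ∷ short Y 0F 2F ∷ []) Y high (1 ⇐ given 0 ∷ short X 3F 1F ∷ []) ∷
               position 1F (1 ⇐ []) (2 ⇐ given 4 ∷ short X 1F 3F ∷ []) (2 ⇐ given 3 ∷ short Y 2F 1F
               ∷ []) (2 ⇐ given 5 ∷ given 4 ∷ given 1 ∷ short X 0F 2F ∷ short Y 1F 2F ∷ short Y 1F
               2F ∷ []) X low (1 ⇐ []) ∷ position 2F (2 ⇐ given 4 ∷ given 1 ∷ short X 0F 2F ∷ short
               X 3F 2F ∷ []) (2 ⇐ given 5 ∷ short X 2F 3F ∷ []) (1 ⇐ []) (2 ⇐ given 4 ∷ short X 1F
               3F ∷ []) Y low (1 ⇐ []) ∷ position 3F (2 ⇐ given 4 ∷ short X 1F 3F ∷ []) (1 ⇐ []) (1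
               ⇐ given 6 ∷ []) (2 ⇐ given 5 ∷ given 4 ∷ given 1 ∷ short X 0F 2F ∷ short Y 3F 2F ∷
               short Y 3F 2F ∷ []) X high (1 ⇐ []) ∷ [])))
          (split 0F 2F
            (circle (spanned X 0F 3F 4F low) (position 0F (1 ⇐ []) (2 ⇐ given 5 ∷ given 4 ∷ short X
               0F 1F ∷ short X 0F 2F ∷ []) (2 ⇐ given 5 ∷ given 2 ∷ given 2 ∷ given 0 ∷ short X 3F
               0F ∷ short Y 1F 0F ∷ short Y 1F 3F ∷ short Y 3F 0F ∷ []) (1 ⇐ given 6 ∷ given 5 ∷
               given 0 ∷ short Y 0F 2F ∷ short Y 3F 4F ∷ []) X low (1 ⇐ []) ∷ position 1F (2 ⇐ given
               5 ∷ given 0 ∷ short X 0F 1F ∷ short X 3F 1F ∷ []) (2 ⇐ given 4 ∷ short X 1F 3F ∷ [])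
               (2 ⇐ given 2 ∷ short Y 4F 1F ∷ []) (1 ⇐ given 5 ∷ given 0 ∷ short Y 1F 2F ∷ short Y
               2F 4F ∷ []) Y high (1 ⇐ given 2 ∷ short X 3F 0F ∷ []) ∷ position 3F (2 ⇐ given 5 ∷
               given 4 ∷ short X 0F 1F ∷ short X 0F 2F ∷ []) (1 ⇐ []) (2 ⇐ given 5 ∷ given 2 ∷ given
               0 ∷ short X 3F 0F ∷ short Y 1F 3F ∷ short Y 4F 3F ∷ []) (2 ⇐ given 5 ∷ given 5 ∷
               given 0 ∷ short X 0F 2F ∷ short Y 3F 4F ∷ short Y 3F 4F ∷ []) X high (1 ⇐ []) ∷
               position 4F (1 ⇐ given 0 ∷ short X 2F 4F ∷ []) (1 ⇐ given 6 ∷ given 5 ∷ given 5 ∷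
               given 2 ∷ given 0 ∷ short X 3F 0F ∷ short X 4F 2F ∷ short Y 1F 2F ∷ short Y 3F 4F ∷
               []) (1 ⇐ []) (2 ⇐ given 5 ∷ given 4 ∷ short X 0F 1F ∷ short X 0F 2F ∷ []) Y low (1 ⇐
               []) ∷ []))
            (circle (spanned X 2F 3F 0F low) (position 0F (2 ⇐ given 0 ∷ short X 2F 0F ∷ []) (2 ⇐
               given 5 ∷ given 4 ∷ short X 0F 1F ∷ short X 0F 2F ∷ []) (1 ⇐ []) (2 ⇐ given 5 ∷ short
               X 2F 3F ∷ []) Y low (1 ⇐ []) ∷ position 1F (2 ⇐ given 5 ∷ given 0 ∷ short X 0F 1F ∷
               short X 3F 1F ∷ []) (2 ⇐ given 4 ∷ short X 1F 3F ∷ []) (2 ⇐ given 1 ∷ short Y 0F 1F ∷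
               []) (1 ⇐ given 5 ∷ short Y 1F 0F ∷ []) Y high (1 ⇐ given 1 ∷ short X 3F 2F ∷ []) ∷
               position 2F (1 ⇐ []) (2 ⇐ given 5 ∷ short X 2F 3F ∷ []) (1 ⇐ given 1 ∷ short Y 1F 2F
               ∷ []) (2 ⇐ given 5 ∷ given 3 ∷ given 3 ∷ short X 2F 3F ∷ short Y 1F 0F ∷ short Y 1F
               0F ∷ []) X low (1 ⇐ []) ∷ position 3F (2 ⇐ given 5 ∷ short X 2F 3F ∷ []) (1 ⇐ []) (1
               ⇐ given 6 ∷ given 1 ∷ short Y 1F 2F ∷ []) (2 ⇐ given 5 ∷ given 5 ∷ given 2 ∷ short Y
               1F 0F ∷ short Y 3F 0F ∷ short Y 3F 4F ∷ []) X high (1 ⇐ []) ∷ []))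
            (vanish 2F (1 ⇐ given 3 ∷ given 0 ∷ short Y 1F 0F ∷ []))
            (vanish 2F (1 ⇐ given 1 ∷ given 0 ∷ short Y 1F 2F ∷ [])))
          (circle (spanned X 1F 3F 2F low) (position 0F (1 ⇐ given 5 ∷ given 3 ∷ given 1 ∷ given 0 ∷
             short X 3F 0F ∷ short Y 0F 2F ∷ short Y 3F 4F ∷ []) (2 ⇐ given 4 ∷ given 3 ∷ short X 0F
             1F ∷ short X 0F 2F ∷ []) (1 ⇐ given 2 ∷ short Y 1F 0F ∷ []) (1 ⇐ given 3 ∷ short Y 0F
             2F ∷ []) Y high (1 ⇐ given 2 ∷ given 0 ∷ short X 2F 1F ∷ short X 3F 2F ∷ []) ∷ position
             1F (1 ⇐ []) (2 ⇐ given 3 ∷ short X 1F 3F ∷ []) (2 ⇐ given 2 ∷ short Y 2F 1F ∷ []) (4 ⇐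
             given 3 ∷ given 3 ∷ given 3 ∷ given 0 ∷ given 0 ∷ short X 1F 3F ∷ short Y 0F 2F ∷ short
             Y 0F 2F ∷ short Y 1F 2F ∷ short Y 1F 2F ∷ []) X low (1 ⇐ []) ∷ position 2F (2 ⇐ given 3
             ∷ given 2 ∷ given 0 ∷ short X 1F 2F ∷ short X 3F 2F ∷ short Y 0F 2F ∷ []) (2 ⇐ given 4
             ∷ short X 2F 3F ∷ []) (1 ⇐ []) (2 ⇐ given 3 ∷ short X 1F 3F ∷ []) Y low (1 ⇐ []) ∷
             position 3F (2 ⇐ given 3 ∷ short X 1F 3F ∷ []) (1 ⇐ []) (1 ⇐ given 5 ∷ []) (2 ⇐ given 3
             ∷ given 3 ∷ given 0 ∷ short Y 0F 2F ∷ short Y 3F 1F ∷ short Y 3F 2F ∷ []) X high (1 ⇐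
             []) ∷ [])))))
    -- Here X₃ lies D₁ above X₂ and X₁ at least D₂ above X₃, but X₁ ≤ X₂ + D₁.
    (vanish 2F (1 ⇐ given 1 ∷ given 0 ∷ short X 1F 2F ∷ []))
    (split 1F 2F
      -- Two steps of D₁ along X give 2 D₁ ≤ D₂, while Y₃ - Y₁ = D₂ is covered by two steps of at
      -- most D₁. Hence equality throughout, and each step has slope 1.
      (line rising 1F 2F 3F (1 ⇐ given 0 ∷ short Y 2F 1F ∷ []) (1 ⇐ given 2 ∷ given 1 ∷ short X 3F
         1F ∷ short Y 3F 2F ∷ []) (1 ⇐ given 2 ∷ given 0 ∷ short Y 2F 1F ∷ short Y 3F 2F ∷ []) (1 ⇐
         given 1 ∷ short X 3F 1F ∷ []))
      (split 1F 4F
        (circle (spanned X 2F 4F 1F low) (position 1F (2 ⇐ given 1 ∷ short X 2F 1F ∷ []) (2 ⇐ given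
           0 ∷ short X 1F 4F ∷ []) (1 ⇐ []) (1 ⇐ given 3 ∷ short X 3F 4F ∷ []) Y low (1 ⇐ []) ∷
           position 2F (1 ⇐ []) (1 ⇐ given 3 ∷ short X 3F 4F ∷ []) (2 ⇐ given 2 ∷ given 2 ∷ given 1
           ∷ given 0 ∷ short X 4F 2F ∷ short Y 0F 2F ∷ short Y 3F 0F ∷ short Y 3F 2F ∷ []) (2 ⇐
           given 1 ∷ given 1 ∷ given 0 ∷ short X 1F 4F ∷ short Y 2F 1F ∷ short Y 2F 1F ∷ []) X low
           (1 ⇐ []) ∷ position 3F (2 ⇐ given 3 ∷ short X 2F 3F ∷ []) (2 ⇐ given 1 ∷ given 1 ∷ given
           0 ∷ short X 1F 4F ∷ short X 3F 2F ∷ short X 3F 2F ∷ []) (2 ⇐ given 2 ∷ short Y 1F 3F ∷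
           []) (1 ⇐ given 1 ∷ given 0 ∷ short Y 0F 1F ∷ short Y 3F 0F ∷ []) Y high (1 ⇐ given 2 ∷
           short X 4F 2F ∷ []) ∷ position 4F (1 ⇐ given 3 ∷ short X 3F 4F ∷ []) (1 ⇐ []) (2 ⇐ given
           2 ∷ given 1 ∷ given 0 ∷ short X 4F 2F ∷ short Y 1F 4F ∷ short Y 3F 4F ∷ []) (2 ⇐ given 1
           ∷ given 0 ∷ given 0 ∷ short X 2F 1F ∷ short Y 4F 1F ∷ short Y 4F 1F ∷ []) X high (1 ⇐ [])
           ∷ []))
        (split 3F 4F
          (vanish 2F (1 ⇐ given 4 ∷ given 3 ∷ given 1 ∷ given 0 ∷ short X 1F 2F ∷ short Y 0F 1F ∷
             short Y 3F 0F ∷ []))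
          (equal 1F 3F (1 ⇐ given 2 ∷ given 0 ∷ short X 1F 4F ∷ short X 3F 2F ∷ []) (1 ⇐ given 4 ∷
             given 1 ∷ short X 1F 2F ∷ short X 3F 4F ∷ []))
          (vanish 2F (1 ⇐ given 4 ∷ given 3 ∷ given 1 ∷ given 0 ∷ short X 1F 2F ∷ short X 3F 4F ∷
             short Y 4F 1F ∷ []))
          (split 2F 4F
            (circle (spanned X 2F 1F 4F low) (position 1F (2 ⇐ given 3 ∷ short X 2F 1F ∷ []) (1 ⇐
               []) (2 ⇐ given 2 ∷ given 1 ∷ given 0 ∷ short X 1F 2F ∷ short Y 3F 1F ∷ short Y 4F 1F
               ∷ []) (2 ⇐ given 4 ∷ given 3 ∷ given 2 ∷ short X 2F 4F ∷ short Y 1F 4F ∷ short Y 3F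
               4F ∷ []) X high (1 ⇐ []) ∷ position 2F (1 ⇐ []) (2 ⇐ given 3 ∷ short X 2F 1F ∷ []) (1
               ⇐ given 1 ∷ short Y 3F 2F ∷ []) (1 ⇐ given 6 ∷ given 3 ∷ short Y 3F 4F ∷ []) X low (1
               ⇐ []) ∷ position 3F (2 ⇐ given 5 ∷ short X 2F 3F ∷ []) (1 ⇐ given 3 ∷ short X 3F 2F ∷
               []) (2 ⇐ given 1 ∷ short Y 4F 3F ∷ []) (1 ⇐ given 3 ∷ short Y 3F 4F ∷ []) X high (1 ⇐
               given 5 ∷ short X 1F 2F ∷ []) ∷ position 4F (2 ⇐ given 0 ∷ short X 2F 4F ∷ []) (2 ⇐
               given 2 ∷ short X 4F 1F ∷ []) (1 ⇐ []) (2 ⇐ given 3 ∷ short X 2F 1F ∷ []) Y low (1 ⇐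
               []) ∷ []))
            (vanish 2F (1 ⇐ given 5 ∷ given 0 ∷ short X 3F 4F ∷ []))
            (vanish 2F (1 ⇐ given 1 ∷ given 0 ∷ short Y 3F 2F ∷ []))
            (circle (spanned X 2F 1F 4F low) (position 1F (2 ⇐ given 3 ∷ short X 2F 1F ∷ []) (1 ⇐
               []) (2 ⇐ given 1 ∷ given 0 ∷ short Y 2F 1F ∷ short Y 3F 1F ∷ []) (2 ⇐ given 4 ∷ given
               3 ∷ given 2 ∷ short X 2F 4F ∷ short Y 1F 4F ∷ short Y 3F 4F ∷ []) X high (1 ⇐ []) ∷
               position 2F (1 ⇐ []) (2 ⇐ given 3 ∷ short X 2F 1F ∷ []) (2 ⇐ given 0 ∷ short Y 4F 2F
               ∷ []) (1 ⇐ given 6 ∷ given 3 ∷ short Y 3F 4F ∷ []) X low (1 ⇐ []) ∷ position 3F (2 ⇐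
               given 5 ∷ short X 2F 3F ∷ []) (1 ⇐ given 3 ∷ short X 3F 2F ∷ []) (2 ⇐ given 1 ∷ short
               Y 4F 3F ∷ []) (1 ⇐ given 3 ∷ short Y 3F 4F ∷ []) X high (1 ⇐ given 5 ∷ short X 1F 2F
               ∷ []) ∷ position 4F (1 ⇐ given 5 ∷ short X 3F 4F ∷ []) (2 ⇐ given 2 ∷ short X 4F 1F ∷
               []) (1 ⇐ []) (2 ⇐ given 3 ∷ short X 2F 1F ∷ []) Y low (1 ⇐ []) ∷ []))))
        (split 0F 3F
          (split 0F 1F
            (equal 1F 3F (1 ⇐ given 5 ∷ given 0 ∷ short X 1F 2F ∷ short X 3F 0F ∷ []) (1 ⇐ given 3 ∷
               given 1 ∷ short X 1F 0F ∷ short X 3F 2F ∷ []))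
            (vanish 2F (1 ⇐ given 4 ∷ given 3 ∷ given 1 ∷ given 0 ∷ short X 3F 2F ∷ short Y 0F 1F ∷
               short Y 3F 0F ∷ []))
            (vanish 2F (1 ⇐ given 4 ∷ given 3 ∷ given 1 ∷ given 0 ∷ short X 1F 0F ∷ short X 3F 2F ∷
               short Y 3F 0F ∷ []))
            (split 0F 2F
              (vanish 2F (1 ⇐ given 4 ∷ given 0 ∷ short X 1F 0F ∷ []))
              (circle (spanned X 2F 1F 1F low) (position 0F (2 ⇐ given 0 ∷ short X 2F 0F ∷ []) (2 ⇐
                 given 4 ∷ given 4 ∷ given 2 ∷ short X 0F 3F ∷ short X 3F 2F ∷ short X 3F 2F ∷ [])
                 (2 ⇐ given 1 ∷ short Y 1F 0F ∷ []) (1 ⇐ given 4 ∷ short Y 0F 1F ∷ []) Y high (1 ⇐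
                 given 1 ∷ short X 1F 2F ∷ []) ∷ position 1F (2 ⇐ given 4 ∷ short X 2F 1F ∷ []) (1 ⇐
                 []) (1 ⇐ []) (2 ⇐ given 4 ∷ short X 2F 1F ∷ []) X high (1 ⇐ []) ∷ position 2F (1 ⇐
                 []) (2 ⇐ given 4 ∷ short X 2F 1F ∷ []) (2 ⇐ given 5 ∷ given 1 ∷ short Y 0F 2F ∷
                 short Y 3F 2F ∷ []) (1 ⇐ given 4 ∷ short Y 2F 1F ∷ []) X low (1 ⇐ []) ∷ position 3F
                 (2 ⇐ given 6 ∷ short X 2F 3F ∷ []) (1 ⇐ given 4 ∷ short X 3F 2F ∷ []) (2 ⇐ given 5
                 ∷ short Y 1F 3F ∷ []) (2 ⇐ given 4 ∷ given 4 ∷ given 2 ∷ given 0 ∷ short X 3F 2F ∷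
                 short Y 0F 1F ∷ short Y 3F 0F ∷ short Y 3F 1F ∷ []) X high (1 ⇐ given 6 ∷ short X
                 1F 2F ∷ []) ∷ []))
              (vanish 2F (1 ⇐ given 1 ∷ given 0 ∷ short Y 2F 1F ∷ []))
              (circle (spanned X 2F 1F 1F low) (position 0F (1 ⇐ given 4 ∷ short X 1F 0F ∷ []) (2 ⇐
                 given 4 ∷ given 4 ∷ given 2 ∷ short X 0F 3F ∷ short X 3F 2F ∷ short X 3F 2F ∷ [])
                 (2 ⇐ given 1 ∷ short Y 1F 0F ∷ []) (1 ⇐ given 4 ∷ short Y 0F 1F ∷ []) Y high (1 ⇐
                 given 1 ∷ short X 1F 2F ∷ []) ∷ position 1F (2 ⇐ given 4 ∷ short X 2F 1F ∷ []) (1 ⇐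
                 []) (1 ⇐ []) (2 ⇐ given 4 ∷ short X 2F 1F ∷ []) X high (1 ⇐ []) ∷ position 2F (1 ⇐
                 []) (2 ⇐ given 4 ∷ short X 2F 1F ∷ []) (2 ⇐ given 5 ∷ given 1 ∷ short Y 0F 2F ∷
                 short Y 3F 2F ∷ []) (1 ⇐ given 4 ∷ short Y 2F 1F ∷ []) X low (1 ⇐ []) ∷ position 3F
                 (2 ⇐ given 6 ∷ short X 2F 3F ∷ []) (1 ⇐ given 4 ∷ short X 3F 2F ∷ []) (2 ⇐ given 5
                 ∷ short Y 1F 3F ∷ []) (2 ⇐ given 4 ∷ given 4 ∷ given 0 ∷ short Y 0F 1F ∷ short Y 3F
                 1F ∷ short Y 3F 2F ∷ []) X high (1 ⇐ given 6 ∷ short X 1F 2F ∷ []) ∷ []))))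
          (circle (spanned X 2F 0F 1F low) (position 0F (1 ⇐ given 2 ∷ short X 1F 0F ∷ []) (1 ⇐ [])
             (2 ⇐ given 4 ∷ given 3 ∷ given 0 ∷ short X 0F 2F ∷ short Y 1F 0F ∷ short Y 3F 0F ∷ [])
             (2 ⇐ given 4 ∷ given 4 ∷ given 0 ∷ short X 3F 0F ∷ short Y 0F 1F ∷ short Y 0F 1F ∷ [])
             X high (1 ⇐ []) ∷ position 1F (2 ⇐ given 2 ∷ short X 2F 1F ∷ []) (2 ⇐ given 4 ∷ given 4
             ∷ given 0 ∷ short X 1F 2F ∷ short X 1F 2F ∷ short X 3F 0F ∷ []) (1 ⇐ []) (1 ⇐ given 2 ∷
             short X 1F 0F ∷ []) Y low (1 ⇐ []) ∷ position 2F (1 ⇐ []) (1 ⇐ given 2 ∷ short X 1F 0F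
             ∷ []) (2 ⇐ given 4 ∷ given 3 ∷ given 3 ∷ given 0 ∷ short X 0F 2F ∷ short Y 0F 2F ∷
             short Y 3F 0F ∷ short Y 3F 2F ∷ []) (2 ⇐ given 4 ∷ given 4 ∷ given 0 ∷ short X 3F 0F ∷
             short Y 2F 1F ∷ short Y 2F 1F ∷ []) X low (1 ⇐ []) ∷ position 3F (2 ⇐ given 4 ∷ short X
             2F 3F ∷ []) (2 ⇐ given 0 ∷ short X 3F 0F ∷ []) (2 ⇐ given 3 ∷ short Y 1F 3F ∷ []) (1 ⇐
             given 4 ∷ given 0 ∷ short Y 0F 1F ∷ short Y 3F 0F ∷ []) Y high (1 ⇐ given 3 ∷ short X
             0F 2F ∷ []) ∷ []))
          (split 0F 2F
            (vanish 2F (1 ⇐ given 3 ∷ given 0 ∷ short X 1F 0F ∷ []))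
            (split 0F 1F
              (vanish 2F (1 ⇐ given 1 ∷ given 0 ∷ short X 1F 2F ∷ []))
              (split 2F 4F
                (split 3F 5F
                  (line falling 0F 1F 2F (1 ⇐ given 8 ∷ given 4 ∷ given 0 ∷ short X 0F 1F ∷ short X
                     5F 2F ∷ short Y 3F 1F ∷ []) (1 ⇐ given 2 ∷ short Y 1F 0F ∷ []) (1 ⇐ given 8 ∷
                     given 4 ∷ given 0 ∷ short X 0F 2F ∷ short X 5F 2F ∷ short Y 3F 2F ∷ []) (1 ⇐
                     given 3 ∷ short Y 2F 0F ∷ []))
                  (vanish 2F (1 ⇐ given 6 ∷ given 2 ∷ given 1 ∷ given 0 ∷ short X 0F 2F ∷ short X 3F
                     2F ∷ short X 4F 5F ∷ []))
                  (line rising 2F 3F 4F (1 ⇐ given 8 ∷ short Y 3F 2F ∷ []) (1 ⇐ given 7 ∷ given 6 ∷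
                     given 2 ∷ short X 0F 2F ∷ short X 3F 2F ∷ short Y 2F 1F ∷ []) (1 ⇐ given 1 ∷
                     short Y 4F 2F ∷ []) (1 ⇐ given 7 ∷ given 6 ∷ given 2 ∷ given 0 ∷ short X 0F 2F
                     ∷ short X 4F 2F ∷ short Y 2F 1F ∷ short Y 5F 4F ∷ []))
                  (equal 1F 3F (1 ⇐ given 6 ∷ given 2 ∷ short X 0F 3F ∷ short X 3F 2F ∷ []) (1 ⇐
                     given 5 ∷ given 0 ∷ short Y 3F 1F ∷ short Y 4F 5F ∷ [])))
                (vanish 2F (1 ⇐ given 7 ∷ given 0 ∷ short X 3F 4F ∷ []))
                (line falling 0F 1F 2F (1 ⇐ given 5 ∷ given 3 ∷ given 0 ∷ short X 0F 2F ∷ short Y 3F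
                   2F ∷ short Y 4F 1F ∷ []) (1 ⇐ given 1 ∷ short Y 1F 0F ∷ []) (1 ⇐ given 6 ∷ given
                   5 ∷ given 3 ∷ given 1 ∷ given 0 ∷ short X 0F 2F ∷ short X 0F 2F ∷ short Y 3F 2F ∷
                   short Y 3F 2F ∷ short Y 4F 1F ∷ []) (1 ⇐ given 2 ∷ short Y 2F 0F ∷ []))
                (vanish 2F (1 ⇐ given 5 ∷ given 4 ∷ given 1 ∷ given 0 ∷ short X 0F 3F ∷ short X 3F
                   2F ∷ short Y 2F 1F ∷ [])))
              (line falling 0F 1F 2F (1 ⇐ given 0 ∷ short X 0F 1F ∷ []) (1 ⇐ given 5 ∷ given 3 ∷
                 given 1 ∷ given 0 ∷ short X 1F 2F ∷ short Y 2F 0F ∷ short Y 3F 0F ∷ short Y 4F 2F ∷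
                 []) (1 ⇐ given 5 ∷ given 0 ∷ short X 0F 2F ∷ short Y 3F 2F ∷ []) (1 ⇐ given 1 ∷
                 short Y 2F 0F ∷ []))
              (circle (spanned X 2F 0F 1F low) (position 0F (2 ⇐ given 1 ∷ short X 2F 0F ∷ []) (1 ⇐
                 []) (2 ⇐ given 0 ∷ short Y 1F 0F ∷ []) (2 ⇐ given 6 ∷ given 2 ∷ given 1 ∷ short X
                 3F 0F ∷ short Y 0F 1F ∷ short Y 3F 1F ∷ []) X high (1 ⇐ []) ∷ position 1F (2 ⇐
                 given 4 ∷ short X 2F 1F ∷ []) (2 ⇐ given 6 ∷ given 2 ∷ given 1 ∷ given 0 ∷ short X
                 1F 2F ∷ short X 1F 2F ∷ short X 3F 0F ∷ short Y 3F 1F ∷ []) (1 ⇐ []) (2 ⇐ given 1 ∷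
                 short X 2F 0F ∷ []) Y low (1 ⇐ []) ∷ position 2F (1 ⇐ []) (2 ⇐ given 1 ∷ short X 2F
                 0F ∷ []) (2 ⇐ given 5 ∷ given 0 ∷ short Y 0F 2F ∷ short Y 3F 2F ∷ []) (1 ⇐ given 7
                 ∷ given 1 ∷ short Y 3F 1F ∷ []) X low (1 ⇐ []) ∷ position 3F (2 ⇐ given 6 ∷ short X
                 2F 3F ∷ []) (2 ⇐ given 2 ∷ given 1 ∷ given 0 ∷ short X 3F 0F ∷ short X 3F 2F ∷
                 short Y 3F 1F ∷ []) (2 ⇐ given 5 ∷ short Y 1F 3F ∷ []) (1 ⇐ given 1 ∷ short Y 3F 1F
                 ∷ []) Y high (1 ⇐ given 5 ∷ short X 0F 2F ∷ []) ∷ [])))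
            (split 1F 5F
              (vanish 2F (1 ⇐ given 4 ∷ given 3 ∷ given 1 ∷ given 0 ∷ short X 5F 2F ∷ short Y 2F 1F
                 ∷ short Y 4F 0F ∷ []))
              (equal 3F 4F (1 ⇐ given 7 ∷ given 3 ∷ given 1 ∷ short Y 3F 1F ∷ short Y 4F 0F ∷ []) (1
                 ⇐ given 7 ∷ given 6 ∷ given 1 ∷ given 0 ∷ short X 1F 2F ∷ short X 3F 5F ∷ short Y
                 3F 0F ∷ []))
              (split 3F 4F
                (line rising 2F 3F 4F (1 ⇐ given 7 ∷ short Y 3F 2F ∷ []) (1 ⇐ given 6 ∷ given 0 ∷
                   short X 4F 2F ∷ short Y 2F 1F ∷ []) (1 ⇐ given 7 ∷ given 0 ∷ short Y 3F 2F ∷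
                   short Y 4F 3F ∷ []) (1 ⇐ given 7 ∷ given 6 ∷ given 4 ∷ given 2 ∷ given 0 ∷ short
                   X 4F 2F ∷ short X 4F 2F ∷ short Y 2F 1F ∷ short Y 2F 1F ∷ short Y 3F 0F ∷ []))
                (split 2F 4F
                  (vanish 2F (1 ⇐ given 1 ∷ given 0 ∷ short X 3F 2F ∷ []))
                  (vanish 2F (1 ⇐ given 8 ∷ given 0 ∷ short X 3F 4F ∷ []))
                  (conclude (Y , true) ((1 ⇐ given 3 ∷ []) ∷ (1 ⇐ given 7 ∷ []) ∷ (1 ⇐ given 0 ∷ [])
                     ∷ (1 ⇐ given 3 ∷ given 2 ∷ given 0 ∷ short Y 3F 1F ∷ short Y 4F 0F ∷ []) ∷ []))
                  (vanish 3F (1 ⇐ given 9 ∷ given 5 ∷ given 0 ∷ short Y 3F 1F ∷ [])))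
                -- The D₂ run along Y here although the step from 2 to 3 runs along X: the
                -- normalisation of D₁ does not fix the direction of the D₂.
                (conclude (Y , true) ((1 ⇐ given 2 ∷ []) ∷ (1 ⇐ given 6 ∷ []) ∷ (1 ⇐ given 6 ∷ given
                   0 ∷ short Y 2F 1F ∷ []) ∷ (1 ⇐ given 2 ∷ given 1 ∷ given 0 ∷ short Y 2F 1F ∷
                   short Y 4F 0F ∷ []) ∷ []))
                (vanish 2F (1 ⇐ given 4 ∷ given 2 ∷ given 0 ∷ short Y 2F 1F ∷ short Y 3F 0F ∷ [])))
              (vanish 4F (1 ⇐ given 5 ∷ given 0 ∷ short Y 3F 5F ∷ [])))
            (line rising 2F 3F 5F (1 ⇐ given 5 ∷ short Y 3F 2F ∷ []) (1 ⇐ given 1 ∷ given 0 ∷ short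
               X 0F 2F ∷ short X 3F 0F ∷ []) (1 ⇐ given 5 ∷ given 1 ∷ given 0 ∷ short X 3F 5F ∷
               short Y 3F 2F ∷ short Y 5F 2F ∷ []) (1 ⇐ given 1 ∷ given 0 ∷ short X 5F 2F ∷ short Y
               3F 5F ∷ [])))
          (circle (spanned X 2F 1F 1F low) (position 0F (1 ⇐ given 2 ∷ short X 1F 0F ∷ []) (2 ⇐
             given 3 ∷ given 2 ∷ given 2 ∷ given 0 ∷ short X 0F 2F ∷ short X 0F 3F ∷ short X 3F 2F ∷
             short Y 0F 1F ∷ []) (2 ⇐ given 3 ∷ given 0 ∷ short Y 1F 3F ∷ short Y 3F 0F ∷ []) (1 ⇐
             given 2 ∷ short Y 0F 1F ∷ []) Y high (1 ⇐ given 3 ∷ given 0 ∷ short X 1F 4F ∷ short X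
             4F 2F ∷ []) ∷ position 1F (2 ⇐ given 2 ∷ short X 2F 1F ∷ []) (1 ⇐ []) (1 ⇐ []) (2 ⇐
             given 2 ∷ short X 2F 1F ∷ []) X high (1 ⇐ []) ∷ position 2F (1 ⇐ []) (2 ⇐ given 2 ∷
             short X 2F 1F ∷ []) (2 ⇐ given 3 ∷ given 3 ∷ given 0 ∷ short Y 0F 2F ∷ short Y 0F 2F ∷
             short Y 3F 0F ∷ []) (1 ⇐ given 2 ∷ short Y 2F 1F ∷ []) X low (1 ⇐ []) ∷ position 3F (2
             ⇐ given 4 ∷ short X 2F 3F ∷ []) (1 ⇐ given 2 ∷ short X 3F 2F ∷ []) (2 ⇐ given 3 ∷ short
             Y 1F 3F ∷ []) (2 ⇐ given 2 ∷ given 2 ∷ given 0 ∷ short Y 0F 1F ∷ short Y 0F 1F ∷ short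
             Y 3F 0F ∷ []) X high (1 ⇐ given 4 ∷ short X 1F 2F ∷ []) ∷ [])))
        (circle (spanned X 2F 1F 4F low) (position 1F (2 ⇐ given 1 ∷ short X 2F 1F ∷ []) (1 ⇐ []) (2
           ⇐ given 0 ∷ short Y 4F 1F ∷ []) (2 ⇐ given 2 ∷ given 1 ∷ given 1 ∷ short Y 1F 2F ∷ short
           Y 2F 4F ∷ short Y 3F 4F ∷ []) X high (1 ⇐ []) ∷ position 2F (1 ⇐ []) (2 ⇐ given 1 ∷ short
           X 2F 1F ∷ []) (1 ⇐ given 2 ∷ given 0 ∷ short Y 0F 2F ∷ short Y 3F 0F ∷ []) (1 ⇐ given 4 ∷
           given 1 ∷ short Y 3F 4F ∷ []) X low (1 ⇐ []) ∷ position 3F (2 ⇐ given 3 ∷ short X 2F 3F ∷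
           []) (1 ⇐ given 1 ∷ short X 3F 2F ∷ []) (2 ⇐ given 2 ∷ given 0 ∷ short Y 1F 3F ∷ short Y
           4F 1F ∷ []) (1 ⇐ given 1 ∷ short Y 3F 4F ∷ []) X high (1 ⇐ given 3 ∷ short X 1F 2F ∷ [])
           ∷ position 4F (1 ⇐ given 3 ∷ short X 3F 4F ∷ []) (2 ⇐ given 2 ∷ given 1 ∷ given 0 ∷ short
           X 4F 1F ∷ short X 4F 2F ∷ short Y 3F 4F ∷ []) (1 ⇐ []) (2 ⇐ given 1 ∷ short X 2F 1F ∷ [])
           Y low (1 ⇐ []) ∷ [])))
      (split 2F 4F
        (split 1F 4F
          (split 0F 2F
            (line rising 1F 2F 3F (1 ⇐ given 5 ∷ given 1 ∷ given 0 ∷ short X 3F 0F ∷ short X 4F 2F ∷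
               short Y 2F 1F ∷ []) (1 ⇐ given 3 ∷ short X 2F 1F ∷ []) (1 ⇐ given 5 ∷ given 0 ∷ short
               X 1F 0F ∷ short Y 3F 1F ∷ []) (1 ⇐ given 4 ∷ short X 3F 1F ∷ []))
            (circle (spanned X 2F 0F 1F low) (position 0F (2 ⇐ given 0 ∷ short X 2F 0F ∷ []) (1 ⇐
               []) (2 ⇐ given 4 ∷ given 3 ∷ given 1 ∷ given 0 ∷ short X 0F 1F ∷ short X 4F 2F ∷
               short Y 2F 0F ∷ short Y 3F 0F ∷ []) (1 ⇐ given 6 ∷ given 3 ∷ given 0 ∷ short Y 0F 1F
               ∷ short Y 3F 1F ∷ []) X high (1 ⇐ []) ∷ position 1F (2 ⇐ given 5 ∷ given 0 ∷ short X
               0F 1F ∷ short X 3F 1F ∷ []) (2 ⇐ given 5 ∷ given 1 ∷ given 0 ∷ short X 1F 2F ∷ short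
               X 3F 0F ∷ short X 4F 2F ∷ []) (1 ⇐ []) (2 ⇐ given 0 ∷ short X 2F 0F ∷ []) Y low (1 ⇐
               []) ∷ position 2F (1 ⇐ []) (2 ⇐ given 0 ∷ short X 2F 0F ∷ []) (2 ⇐ given 3 ∷ short Y
               1F 2F ∷ []) (1 ⇐ given 6 ∷ given 0 ∷ short Y 3F 1F ∷ []) X low (1 ⇐ []) ∷ position 4F
               (2 ⇐ given 2 ∷ short X 2F 4F ∷ []) (1 ⇐ given 0 ∷ short X 4F 2F ∷ []) (2 ⇐ given 4 ∷
               given 3 ∷ short Y 2F 4F ∷ short Y 3F 4F ∷ []) (2 ⇐ given 5 ∷ given 1 ∷ given 1 ∷
               given 0 ∷ given 0 ∷ given 0 ∷ short X 0F 1F ∷ short X 3F 1F ∷ short X 4F 2F ∷ short X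
               4F 2F ∷ short Y 4F 1F ∷ short Y 4F 1F ∷ []) X high (1 ⇐ given 2 ∷ short X 0F 2F ∷ [])
               ∷ []))
            (split 2F 5F
              (split 0F 4F
                (line rising 0F 1F 3F (1 ⇐ given 6 ∷ given 1 ∷ given 0 ∷ short X 4F 2F ∷ short X 5F
                   1F ∷ short Y 3F 0F ∷ []) (1 ⇐ given 7 ∷ given 3 ∷ given 2 ∷ short X 3F 0F ∷ short
                   X 4F 2F ∷ short Y 2F 1F ∷ []) (1 ⇐ given 7 ∷ given 6 ∷ given 3 ∷ given 2 ∷ given
                   1 ∷ given 0 ∷ short X 4F 2F ∷ short X 4F 2F ∷ short X 5F 1F ∷ short Y 2F 1F ∷
                   short Y 3F 0F ∷ short Y 3F 0F ∷ []) (1 ⇐ given 7 ∷ given 6 ∷ given 3 ∷ given 2 ∷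
                   short X 3F 0F ∷ short X 3F 1F ∷ short X 4F 2F ∷ short Y 2F 1F ∷ []))
                (vanish 4F (1 ⇐ given 4 ∷ given 0 ∷ short X 0F 2F ∷ []))
                (line rising 1F 3F 4F (1 ⇐ given 7 ∷ given 3 ∷ given 2 ∷ short X 4F 2F ∷ short Y 2F
                   1F ∷ short Y 3F 0F ∷ []) (1 ⇐ given 6 ∷ short X 3F 1F ∷ []) (1 ⇐ given 3 ∷ short
                   Y 4F 1F ∷ []) (1 ⇐ given 6 ∷ given 1 ∷ given 0 ∷ short X 4F 2F ∷ short X 5F 1F ∷
                   short Y 3F 0F ∷ []))
                (vanish 4F (1 ⇐ given 2 ∷ given 0 ∷ short Y 2F 4F ∷ [])))
              (vanish 1F (1 ⇐ given 7 ∷ given 6 ∷ given 1 ∷ given 0 ∷ short X 3F 5F ∷ short Y 3F 0F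
                 ∷ []))
              (line rising 1F 3F 4F (1 ⇐ given 6 ∷ given 2 ∷ given 1 ∷ short X 4F 2F ∷ short Y 2F 1F
                 ∷ short Y 3F 0F ∷ []) (1 ⇐ given 5 ∷ short X 3F 1F ∷ []) (1 ⇐ given 2 ∷ short Y 4F
                 1F ∷ []) (1 ⇐ given 4 ∷ given 0 ∷ short X 4F 1F ∷ short Y 5F 4F ∷ []))
              (equal 1F 3F (1 ⇐ given 7 ∷ given 7 ∷ given 4 ∷ given 1 ∷ short Y 3F 0F ∷ short Y 3F
                 1F ∷ []) (1 ⇐ given 5 ∷ given 0 ∷ short Y 2F 1F ∷ short Y 3F 5F ∷ [])))
            (vanish 2F (1 ⇐ given 3 ∷ given 0 ∷ short Y 0F 1F ∷ [])))
          (vanish 3F (1 ⇐ given 5 ∷ given 2 ∷ given 1 ∷ given 0 ∷ short X 1F 2F ∷ short Y 3F 1F ∷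
             []))
          (split 3F 4F
            (split 3F 5F
              (line rising 2F 3F 4F (1 ⇐ given 6 ∷ short Y 3F 2F ∷ []) (1 ⇐ given 5 ∷ given 1 ∷
                 short X 4F 2F ∷ short Y 2F 1F ∷ []) (1 ⇐ given 3 ∷ short Y 4F 2F ∷ []) (1 ⇐ given 6
                 ∷ given 2 ∷ given 0 ∷ short X 4F 2F ∷ short X 5F 2F ∷ short Y 2F 1F ∷ []))
              (vanish 2F (1 ⇐ given 1 ∷ given 0 ∷ short X 4F 5F ∷ []))
              (line rising 2F 3F 4F (1 ⇐ given 6 ∷ short Y 3F 2F ∷ []) (1 ⇐ given 5 ∷ given 1 ∷
                 short X 4F 2F ∷ short Y 2F 1F ∷ []) (1 ⇐ given 3 ∷ short Y 4F 2F ∷ []) (1 ⇐ given 6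
                 ∷ given 5 ∷ given 1 ∷ given 0 ∷ short X 4F 2F ∷ short X 4F 2F ∷ short Y 2F 1F ∷
                 short Y 5F 4F ∷ []))
              (equal 1F 3F (1 ⇐ given 6 ∷ given 1 ∷ short X 1F 2F ∷ short X 4F 1F ∷ []) (1 ⇐ given 2
                 ∷ given 0 ∷ short Y 3F 1F ∷ short Y 4F 5F ∷ [])))
            (vanish 2F (1 ⇐ given 2 ∷ given 0 ∷ short X 3F 2F ∷ []))
            (split 0F 3F
              (split 2F 5F
                (conclude (X , true) ((1 ⇐ given 6 ∷ given 2 ∷ given 1 ∷ short X 3F 2F ∷ short Y 4F
                   1F ∷ []) ∷ (1 ⇐ given 6 ∷ given 2 ∷ given 1 ∷ short X 1F 0F ∷ short Y 4F 1F ∷ [])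
                   ∷ (1 ⇐ given 4 ∷ []) ∷ (1 ⇐ given 6 ∷ given 2 ∷ given 0 ∷ short X 3F 2F ∷ short Y
                   4F 1F ∷ []) ∷ []))
                (vanish 1F (2 ⇐ given 7 ∷ given 6 ∷ given 2 ∷ given 0 ∷ short X 3F 5F ∷ short Y 4F
                   1F ∷ []))
                (line rising 1F 2F 3F (1 ⇐ given 6 ∷ given 2 ∷ given 2 ∷ given 1 ∷ given 0 ∷ short X
                   1F 0F ∷ short X 3F 2F ∷ short Y 4F 1F ∷ short Y 4F 1F ∷ short Y 5F 3F ∷ []) (1 ⇐
                   given 5 ∷ short X 2F 1F ∷ []) (1 ⇐ given 2 ∷ given 1 ∷ short X 1F 0F ∷ short Y 4F
                   1F ∷ []) (1 ⇐ given 6 ∷ short X 3F 1F ∷ []))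
                (vanish 3F (1 ⇐ given 8 ∷ given 2 ∷ given 0 ∷ short Y 4F 5F ∷ [])))
              (vanish 1F (2 ⇐ given 6 ∷ given 5 ∷ given 1 ∷ given 0 ∷ short X 0F 2F ∷ short Y 4F 1F
                 ∷ []))
              (line rising 2F 3F 4F (1 ⇐ given 6 ∷ short Y 3F 2F ∷ []) (1 ⇐ given 5 ∷ given 1 ∷
                 given 0 ∷ short X 3F 2F ∷ short Y 2F 0F ∷ short Y 4F 1F ∷ []) (1 ⇐ given 3 ∷ short
                 Y 4F 2F ∷ []) (1 ⇐ given 5 ∷ given 1 ∷ short X 4F 2F ∷ short Y 2F 1F ∷ []))
              (vanish 3F (1 ⇐ given 7 ∷ given 4 ∷ given 0 ∷ short Y 0F 1F ∷ [])))
            (circle (spanned X 2F 4F 1F low) (position 1F (2 ⇐ given 2 ∷ given 1 ∷ given 0 ∷ short X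
               2F 1F ∷ short X 4F 1F ∷ short Y 3F 1F ∷ []) (2 ⇐ given 2 ∷ given 1 ∷ given 0 ∷ short
               X 1F 2F ∷ short X 1F 4F ∷ short Y 3F 1F ∷ []) (1 ⇐ []) (2 ⇐ given 2 ∷ short X 2F 4F ∷
               []) Y low (1 ⇐ []) ∷ position 2F (1 ⇐ []) (2 ⇐ given 2 ∷ short X 2F 4F ∷ []) (2 ⇐
               given 3 ∷ short Y 1F 2F ∷ []) (1 ⇐ given 6 ∷ given 2 ∷ short Y 3F 1F ∷ []) X low (1 ⇐
               []) ∷ position 3F (2 ⇐ given 5 ∷ short X 2F 3F ∷ []) (2 ⇐ given 2 ∷ given 2 ∷ given 1
               ∷ given 0 ∷ short X 0F 2F ∷ short X 3F 0F ∷ short X 3F 2F ∷ short Y 3F 1F ∷ []) (2 ⇐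
               given 4 ∷ short Y 1F 3F ∷ []) (1 ⇐ given 2 ∷ short Y 3F 1F ∷ []) Y high (1 ⇐ given 4
               ∷ short X 4F 2F ∷ []) ∷ position 4F (2 ⇐ given 2 ∷ short X 2F 4F ∷ []) (1 ⇐ []) (2 ⇐
               given 1 ∷ short Y 1F 4F ∷ []) (2 ⇐ given 2 ∷ given 2 ∷ given 0 ∷ short Y 2F 1F ∷
               short Y 3F 1F ∷ short Y 4F 2F ∷ []) X high (1 ⇐ []) ∷ [])))
          (vanish 3F (2 ⇐ given 3 ∷ given 2 ∷ given 0 ∷ given 0 ∷ short Y 2F 4F ∷ short Y 3F 4F ∷
             [])))
        (vanish 2F (1 ⇐ given 3 ∷ given 0 ∷ short X 3F 4F ∷ []))
        (split 0F 3F
          (split 2F 5F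
            (conclude (X , true) ((1 ⇐ given 3 ∷ given 2 ∷ given 1 ∷ short X 3F 2F ∷ short Y 4F 1F ∷
               []) ∷ (1 ⇐ given 3 ∷ given 2 ∷ given 1 ∷ short X 1F 0F ∷ short Y 4F 1F ∷ []) ∷ (1 ⇐
               given 3 ∷ given 2 ∷ given 0 ∷ short X 5F 4F ∷ short Y 4F 1F ∷ []) ∷ (1 ⇐ given 3 ∷
               given 2 ∷ given 0 ∷ short X 3F 2F ∷ short Y 4F 1F ∷ []) ∷ []))
            (vanish 1F (2 ⇐ given 5 ∷ given 3 ∷ given 2 ∷ given 0 ∷ short X 3F 5F ∷ short Y 4F 1F ∷
               []))
            (line rising 1F 2F 3F (1 ⇐ given 3 ∷ given 3 ∷ given 2 ∷ given 2 ∷ given 1 ∷ given 0 ∷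
               short X 1F 0F ∷ short X 3F 2F ∷ short Y 3F 1F ∷ short Y 4F 1F ∷ short Y 4F 1F ∷ short
               Y 5F 3F ∷ []) (1 ⇐ given 3 ∷ short X 2F 1F ∷ []) (1 ⇐ given 3 ∷ given 2 ∷ given 1 ∷
               short X 1F 0F ∷ short Y 3F 1F ∷ short Y 4F 1F ∷ []) (1 ⇐ given 4 ∷ short X 3F 1F ∷
               []))
            (vanish 1F (1 ⇐ given 6 ∷ given 3 ∷ given 2 ∷ given 0 ∷ short Y 3F 5F ∷ short Y 4F 1F ∷
               [])))
          (vanish 1F (2 ⇐ given 4 ∷ given 2 ∷ given 1 ∷ given 0 ∷ short X 0F 2F ∷ short Y 4F 1F ∷
             []))
          (split 1F 5F
            (line rising 1F 2F 3F (1 ⇐ given 2 ∷ given 1 ∷ given 0 ∷ short X 5F 2F ∷ short Y 3F 1F ∷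
               short Y 4F 0F ∷ []) (1 ⇐ given 3 ∷ short X 2F 1F ∷ []) (1 ⇐ given 5 ∷ given 2 ∷ given
               1 ∷ given 0 ∷ short X 5F 2F ∷ short Y 3F 1F ∷ short Y 3F 2F ∷ short Y 4F 0F ∷ []) (1
               ⇐ given 4 ∷ short X 3F 1F ∷ []))
            (vanish 2F (1 ⇐ given 5 ∷ given 3 ∷ given 2 ∷ given 2 ∷ given 1 ∷ given 0 ∷ short X 1F
               2F ∷ short X 3F 5F ∷ short Y 3F 2F ∷ short Y 4F 0F ∷ short Y 4F 1F ∷ []))
            (conclude (Y , true) ((1 ⇐ given 3 ∷ given 2 ∷ given 1 ∷ short Y 3F 2F ∷ short Y 4F 1F ∷
               []) ∷ (1 ⇐ given 4 ∷ []) ∷ (1 ⇐ given 2 ∷ []) ∷ (1 ⇐ given 3 ∷ given 2 ∷ given 2 ∷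
               given 1 ∷ given 0 ∷ short Y 3F 1F ∷ short Y 3F 2F ∷ short Y 4F 0F ∷ short Y 4F 1F ∷
               []) ∷ []))
            (vanish 4F (1 ⇐ given 4 ∷ given 0 ∷ short Y 3F 5F ∷ [])))
          (vanish 3F (1 ⇐ given 5 ∷ given 2 ∷ given 0 ∷ short Y 0F 1F ∷ [])))
        (equal 1F 2F (1 ⇐ given 4 ∷ given 1 ∷ short Y 3F 1F ∷ []) (2 ⇐ given 2 ∷ given 0 ∷ short Y
           2F 1F ∷ short Y 3F 4F ∷ [])))
      (vanish 2F (1 ⇐ given 1 ∷ given 0 ∷ short Y 3F 2F ∷ [])))
    (split 3F 4F
      (vanish 1F (1 ⇐ given 3 ∷ given 2 ∷ given 1 ∷ given 0 ∷ short X 4F 2F ∷ short Y 1F 2F ∷ []))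
      (split 4F 5F
        (split 2F 5F
          (equal 1F 3F (1 ⇐ given 4 ∷ given 1 ∷ short X 3F 4F ∷ short X 5F 2F ∷ []) (1 ⇐ given 2 ∷
             given 0 ∷ short X 3F 2F ∷ short X 5F 4F ∷ []))
          (vanish 1F (2 ⇐ given 4 ∷ given 4 ∷ given 1 ∷ given 1 ∷ given 0 ∷ short X 3F 4F ∷ short X
             3F 4F ∷ short X 5F 2F ∷ []))
          (equal 1F 3F (1 ⇐ given 4 ∷ given 1 ∷ short X 3F 4F ∷ short X 5F 2F ∷ []) (1 ⇐ given 3 ∷
             given 0 ∷ short Y 1F 2F ∷ short Y 5F 3F ∷ []))
          (equal 1F 3F (1 ⇐ given 4 ∷ given 1 ∷ short X 3F 4F ∷ short X 5F 2F ∷ []) (1 ⇐ given 5 ∷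
             given 5 ∷ given 3 ∷ given 0 ∷ short Y 1F 2F ∷ short Y 3F 5F ∷ [])))
        (vanish 1F (1 ⇐ given 4 ∷ given 2 ∷ given 1 ∷ given 0 ∷ short X 3F 5F ∷ short Y 1F 2F ∷ []))
        -- A square of width D₁: points 2 and 3 lie on its vertical sides as X₃ = X₂ + D₁, points 4
        -- and 5 on its horizontal sides as Y₅ = Y₄ + D₁.
        (circle (spanned X 2F 3F 4F low) (position 2F (1 ⇐ []) (2 ⇐ given 3 ∷ short X 2F 3F ∷ []) (1
           ⇐ given 2 ∷ given 0 ∷ short Y 1F 2F ∷ short Y 5F 3F ∷ []) (1 ⇐ given 4 ∷ given 3 ∷ short
           Y 3F 4F ∷ []) X low (1 ⇐ []) ∷ position 3F (2 ⇐ given 3 ∷ short X 2F 3F ∷ []) (1 ⇐ []) (1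
           ⇐ given 4 ∷ given 2 ∷ given 0 ∷ short Y 1F 2F ∷ short Y 5F 3F ∷ []) (1 ⇐ given 3 ∷ short
           Y 3F 4F ∷ []) X high (1 ⇐ []) ∷ position 4F (1 ⇐ given 3 ∷ short X 3F 4F ∷ []) (2 ⇐ given
           1 ∷ short X 4F 3F ∷ []) (1 ⇐ []) (2 ⇐ given 3 ∷ short X 2F 3F ∷ []) Y low (1 ⇐ []) ∷
           position 5F (1 ⇐ given 4 ∷ given 3 ∷ given 2 ∷ short X 3F 5F ∷ short Y 1F 2F ∷ []) (1 ⇐
           given 1 ∷ short X 5F 4F ∷ []) (2 ⇐ given 0 ∷ short Y 4F 5F ∷ []) (1 ⇐ given 3 ∷ short Y
           5F 4F ∷ []) Y high (1 ⇐ given 0 ∷ short X 3F 2F ∷ []) ∷ []))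
        (circle (spanned X 2F 3F 1F high) (position 1F (1 ⇐ given 4 ∷ given 3 ∷ given 2 ∷ short X 3F
           1F ∷ short Y 1F 2F ∷ []) (1 ⇐ given 3 ∷ short X 1F 2F ∷ []) (2 ⇐ given 3 ∷ short X 2F 3F
           ∷ []) (1 ⇐ []) Y high (1 ⇐ []) ∷ position 2F (1 ⇐ []) (2 ⇐ given 3 ∷ short X 2F 3F ∷ [])
           (1 ⇐ given 3 ∷ short Y 1F 2F ∷ []) (2 ⇐ given 4 ∷ given 4 ∷ given 2 ∷ short Y 3F 1F ∷ [])
           X low (1 ⇐ []) ∷ position 3F (2 ⇐ given 3 ∷ short X 2F 3F ∷ []) (1 ⇐ []) (1 ⇐ given 4 ∷
           given 3 ∷ short Y 1F 2F ∷ []) (2 ⇐ given 2 ∷ short Y 3F 1F ∷ []) X high (1 ⇐ []) ∷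
           position 4F (1 ⇐ given 3 ∷ short X 3F 4F ∷ []) (2 ⇐ given 1 ∷ short X 4F 3F ∷ []) (1 ⇐
           given 4 ∷ given 4 ∷ given 3 ∷ given 2 ∷ given 0 ∷ short Y 1F 2F ∷ short Y 1F 2F ∷ short Y
           3F 5F ∷ []) (1 ⇐ given 4 ∷ given 2 ∷ short Y 4F 2F ∷ []) X low (1 ⇐ given 1 ∷ short X 3F
           2F ∷ []) ∷ [])))
      -- Both halves rest on the normalisation Y₂ ≤ Y₃: with Y₃ + D₁ ≤ Y₄ ≤ Y₂ + D₂ it gives D₁ ≤
      -- D₂, and with Y₃ + D₂ ≤ Y₁ ≤ Y₂ + D₁ it gives D₂ ≤ D₁.
      (equal 1F 2F (1 ⇐ given 3 ∷ given 0 ∷ short Y 4F 2F ∷ []) (1 ⇐ given 3 ∷ given 1 ∷ short Y 1F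
         2F ∷ []))
      (split 0F 3F
        (circle (spanned X 0F 3F 4F low) (position 0F (1 ⇐ []) (2 ⇐ given 0 ∷ short X 0F 3F ∷ []) (3
           ⇐ given 2 ∷ given 2 ∷ given 1 ∷ given 1 ∷ short Y 1F 0F ∷ short Y 1F 0F ∷ short Y 2F 0F ∷
           short Y 4F 2F ∷ []) (1 ⇐ given 4 ∷ given 2 ∷ given 0 ∷ short Y 0F 2F ∷ short Y 1F 4F ∷
           []) X low (1 ⇐ []) ∷ position 1F (2 ⇐ given 2 ∷ given 1 ∷ given 0 ∷ short X 0F 1F ∷ short
           X 3F 1F ∷ short Y 1F 4F ∷ []) (1 ⇐ given 3 ∷ short X 1F 2F ∷ []) (2 ⇐ given 2 ∷ given 1 ∷
           short Y 2F 1F ∷ short Y 4F 2F ∷ []) (1 ⇐ given 0 ∷ short Y 1F 4F ∷ []) Y high (1 ⇐ given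
           2 ∷ given 1 ∷ short X 1F 0F ∷ short X 3F 1F ∷ []) ∷ position 3F (2 ⇐ given 0 ∷ short X 0F
           3F ∷ []) (1 ⇐ []) (2 ⇐ given 1 ∷ short Y 4F 3F ∷ []) (2 ⇐ given 3 ∷ given 2 ∷ given 0 ∷
           short X 0F 2F ∷ short Y 1F 4F ∷ short Y 3F 4F ∷ []) X high (1 ⇐ []) ∷ position 4F (2 ⇐
           given 3 ∷ given 2 ∷ given 1 ∷ given 0 ∷ short X 0F 2F ∷ short X 3F 4F ∷ short X 3F 4F ∷
           short Y 1F 4F ∷ []) (1 ⇐ given 4 ∷ given 3 ∷ given 2 ∷ short X 4F 2F ∷ short Y 1F 2F ∷
           []) (1 ⇐ []) (2 ⇐ given 0 ∷ short X 0F 3F ∷ []) Y low (1 ⇐ []) ∷ []))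
        (vanish 3F (1 ⇐ given 4 ∷ given 3 ∷ given 2 ∷ given 0 ∷ short X 0F 2F ∷ short Y 1F 2F ∷ []))
        (vanish 2F (2 ⇐ given 2 ∷ given 2 ∷ given 1 ∷ given 0 ∷ short Y 1F 0F ∷ short Y 1F 4F ∷ []))
        (vanish 1F (1 ⇐ given 4 ∷ given 2 ∷ given 1 ∷ given 0 ∷ short Y 0F 2F ∷ short Y 1F 4F ∷ []))))

progression-certificate : Certificate Axis
progression-certificate =
  split 0F 4F
    (split 1F 5F
      (split 0F 3F
        (split 0F 5F
          (split 0F 1F
            (split 1F 6F
              -- Every choice made on this branch is increasing X. The first combination is the one
              -- through point 6 that bounds 2 X₁ by X₀ + X₂; the second gets the converse from X₂ ≤
              -- X₁ + D₁ and X₀ + D₁ ≤ X₁.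
              (conclude X ((1 ⇐ given 4 ∷ given 0 ∷ short X 5F 0F ∷ short X 6F 2F ∷ []) ∷ (1 ⇐ given
                 1 ∷ short X 2F 1F ∷ []) ∷ (1 ⇐ given 8 ∷ given 1 ∷ short X 2F 0F ∷ short X 2F 1F ∷
                 []) ∷ (1 ⇐ given 6 ∷ given 5 ∷ given 0 ∷ short X 4F 2F ∷ short X 5F 0F ∷ short X 6F
                 2F ∷ []) ∷ (1 ⇐ given 6 ∷ given 5 ∷ given 0 ∷ short X 3F 1F ∷ short X 5F 0F ∷ short
                 X 6F 2F ∷ []) ∷ (1 ⇐ given 8 ∷ given 3 ∷ short X 2F 0F ∷ short X 4F 1F ∷ []) ∷ (1 ⇐
                 given 4 ∷ given 3 ∷ short X 4F 0F ∷ short X 4F 1F ∷ []) ∷ (1 ⇐ given 7 ∷ given 5 ∷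
                 given 0 ∷ short X 3F 1F ∷ short X 5F 0F ∷ short X 6F 2F ∷ []) ∷ (1 ⇐ given 5 ∷
                 given 0 ∷ short X 5F 0F ∷ short X 5F 1F ∷ []) ∷ (1 ⇐ given 4 ∷ given 2 ∷ short X 4F
                 0F ∷ short X 6F 1F ∷ []) ∷ []))
              (vanish 4F (2 ⇐ given 4 ∷ given 4 ∷ given 1 ∷ given 0 ∷ short X 5F 0F ∷ short X 5F 6F
                 ∷ []))
              (line rising 1F 3F 5F (1 ⇐ given 8 ∷ short Y 3F 1F ∷ []) (1 ⇐ given 6 ∷ given 3 ∷
                 given 0 ∷ short X 3F 1F ∷ short X 5F 0F ∷ short Y 6F 3F ∷ []) (1 ⇐ given 4 ∷ short
                 Y 5F 1F ∷ []) (1 ⇐ given 1 ∷ given 0 ∷ short X 5F 0F ∷ short Y 6F 5F ∷ []))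
              (line falling 1F 3F 5F (1 ⇐ given 8 ∷ short Y 1F 3F ∷ []) (1 ⇐ given 6 ∷ given 1 ∷
                 given 0 ∷ short X 5F 0F ∷ short Y 3F 5F ∷ short Y 5F 6F ∷ []) (1 ⇐ given 4 ∷ short
                 Y 1F 5F ∷ []) (1 ⇐ given 1 ∷ given 0 ∷ short X 5F 0F ∷ short Y 5F 6F ∷ [])))
            (vanish 2F (1 ⇐ given 8 ∷ given 0 ∷ short X 2F 1F ∷ []))
            (split 1F 6F
              (conclude X ((1 ⇐ given 4 ∷ given 0 ∷ short X 5F 0F ∷ short X 6F 2F ∷ []) ∷ (1 ⇐ given
                 7 ∷ given 3 ∷ short X 3F 1F ∷ short X 4F 1F ∷ []) ∷ (1 ⇐ given 7 ∷ given 3 ∷ short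
                 X 2F 0F ∷ short X 4F 1F ∷ []) ∷ (1 ⇐ given 6 ∷ given 5 ∷ given 0 ∷ short X 4F 2F ∷
                 short X 5F 0F ∷ short X 6F 2F ∷ []) ∷ (1 ⇐ given 6 ∷ given 5 ∷ given 0 ∷ short X 3F
                 1F ∷ short X 5F 0F ∷ short X 6F 2F ∷ []) ∷ (1 ⇐ given 8 ∷ given 3 ∷ short X 2F 0F ∷
                 short X 4F 1F ∷ []) ∷ (1 ⇐ given 4 ∷ given 3 ∷ short X 4F 0F ∷ short X 4F 1F ∷ [])
                 ∷ (1 ⇐ given 7 ∷ given 5 ∷ given 0 ∷ short X 3F 1F ∷ short X 5F 0F ∷ short X 6F 2F
                 ∷ []) ∷ (1 ⇐ given 5 ∷ given 0 ∷ short X 5F 0F ∷ short X 5F 1F ∷ []) ∷ (1 ⇐ given 4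
                 ∷ given 2 ∷ short X 4F 0F ∷ short X 6F 1F ∷ []) ∷ []))
              (vanish 2F (3 ⇐ given 9 ∷ given 8 ∷ given 7 ∷ given 6 ∷ given 0 ∷ short X 4F 6F ∷
                 short X 5F 0F ∷ []))
              (line rising 1F 2F 3F (1 ⇐ given 8 ∷ given 1 ∷ short X 3F 2F ∷ short Y 2F 0F ∷ []) (1
                 ⇐ given 6 ∷ given 5 ∷ given 3 ∷ given 0 ∷ short X 2F 0F ∷ short X 4F 1F ∷ short X
                 5F 0F ∷ short Y 6F 2F ∷ []) (1 ⇐ given 8 ∷ short Y 3F 1F ∷ []) (1 ⇐ given 6 ∷ given
                 3 ∷ given 0 ∷ short X 3F 1F ∷ short X 5F 0F ∷ short Y 6F 3F ∷ []))
              (split 2F 3F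
                (line falling 1F 3F 5F (1 ⇐ given 9 ∷ short Y 1F 3F ∷ []) (1 ⇐ given 7 ∷ given 4 ∷
                   given 1 ∷ short X 3F 1F ∷ short X 5F 0F ∷ short Y 3F 6F ∷ []) (1 ⇐ given 5 ∷
                   short Y 1F 5F ∷ []) (1 ⇐ given 10 ∷ given 1 ∷ given 0 ∷ short X 3F 1F ∷ short X
                   5F 0F ∷ short Y 5F 6F ∷ []))
                (vanish 2F (1 ⇐ given 9 ∷ given 0 ∷ short X 2F 1F ∷ []))
                (vanish 2F (1 ⇐ given 7 ∷ given 4 ∷ given 1 ∷ given 0 ∷ short X 5F 0F ∷ short Y 1F
                   2F ∷ short Y 3F 6F ∷ []))
                (line falling 2F 3F 5F (1 ⇐ given 8 ∷ given 5 ∷ given 4 ∷ given 1 ∷ short X 4F 1F ∷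
                   short X 5F 0F ∷ short Y 1F 3F ∷ short Y 2F 6F ∷ []) (1 ⇐ given 0 ∷ short X 3F 2F
                   ∷ []) (1 ⇐ given 7 ∷ given 4 ∷ short X 2F 0F ∷ short Y 2F 5F ∷ []) (1 ⇐ given 10
                   ∷ given 1 ∷ given 0 ∷ short X 5F 0F ∷ short Y 1F 3F ∷ short Y 5F 6F ∷ []))))
            -- The normalisation Y₀ ≤ Y₁ rules out this orientation at once.
            (vanish 1F (1 ⇐ given 9 ∷ given 0 ∷ [])))
          (vanish 3F (2 ⇐ given 4 ∷ given 1 ∷ given 1 ∷ given 0 ∷ short X 3F 5F ∷ short X 5F 0F ∷
             []))
          (line rising 0F 2F 3F (1 ⇐ given 7 ∷ short Y 2F 0F ∷ []) (1 ⇐ given 4 ∷ given 1 ∷ given 0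
             ∷ short X 2F 0F ∷ short X 5F 0F ∷ short Y 5F 2F ∷ []) (1 ⇐ given 1 ∷ short Y 3F 0F ∷
             []) (1 ⇐ given 4 ∷ given 0 ∷ short X 5F 0F ∷ short Y 5F 3F ∷ []))
          (vanish 2F (1 ⇐ given 8 ∷ given 8 ∷ given 4 ∷ given 3 ∷ given 2 ∷ given 1 ∷ given 0 ∷
             given 0 ∷ short X 4F 1F ∷ short X 5F 0F ∷ short X 5F 0F ∷ short Y 1F 5F ∷ short Y 1F 5F
             ∷ [])))
        (vanish 2F (3 ⇐ given 6 ∷ given 5 ∷ given 4 ∷ given 0 ∷ short X 4F 1F ∷ []))
        (split 0F 1F
          (line rising 0F 2F 3F (1 ⇐ given 7 ∷ short Y 2F 0F ∷ []) (1 ⇐ given 6 ∷ given 1 ∷ given 0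
             ∷ short X 2F 0F ∷ short X 3F 0F ∷ short Y 3F 2F ∷ []) (1 ⇐ given 6 ∷ given 0 ∷ short Y
             1F 0F ∷ short Y 3F 1F ∷ []) (1 ⇐ given 1 ∷ short X 3F 0F ∷ []))
          (vanish 2F (1 ⇐ given 7 ∷ given 0 ∷ short X 2F 1F ∷ []))
          (split 2F 3F
            (line rising 0F 2F 3F (1 ⇐ given 8 ∷ short Y 2F 0F ∷ []) (1 ⇐ given 2 ∷ given 0 ∷ short
               X 3F 0F ∷ short Y 3F 2F ∷ []) (1 ⇐ given 8 ∷ given 0 ∷ short Y 1F 0F ∷ short Y 3F 1F
               ∷ []) (1 ⇐ given 2 ∷ short X 3F 0F ∷ []))
            (vanish 2F (1 ⇐ given 7 ∷ given 0 ∷ short X 2F 1F ∷ []))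
            (split 1F 2F
              (split 2F 5F
                (line rising 0F 2F 3F (1 ⇐ given 10 ∷ short Y 2F 0F ∷ []) (1 ⇐ given 8 ∷ given 4 ∷
                   given 1 ∷ short X 2F 0F ∷ short X 4F 1F ∷ short Y 3F 2F ∷ []) (1 ⇐ given 10 ∷
                   given 0 ∷ short X 5F 3F ∷ short Y 3F 0F ∷ []) (1 ⇐ given 4 ∷ short X 3F 0F ∷ []))
                (vanish 2F (3 ⇐ given 9 ∷ given 8 ∷ given 7 ∷ given 0 ∷ short X 4F 1F ∷ []))
                (line rising 1F 3F 5F (1 ⇐ given 9 ∷ short Y 3F 1F ∷ []) (1 ⇐ given 8 ∷ given 4 ∷
                   given 1 ∷ short X 3F 1F ∷ short X 4F 1F ∷ short Y 1F 0F ∷ []) (1 ⇐ given 5 ∷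
                   short Y 5F 1F ∷ []) (1 ⇐ given 8 ∷ given 6 ∷ given 4 ∷ given 1 ∷ given 1 ∷ given
                   0 ∷ short X 2F 0F ∷ short X 4F 1F ∷ short X 4F 1F ∷ short X 5F 1F ∷ short Y 1F 0F
                   ∷ short Y 3F 2F ∷ []))
                (vanish 1F (2 ⇐ given 8 ∷ given 2 ∷ given 1 ∷ given 0 ∷ short X 4F 1F ∷ short Y 3F
                   5F ∷ [])))
              (vanish 2F (1 ⇐ given 9 ∷ given 0 ∷ short X 1F 0F ∷ []))
              (line rising 0F 2F 3F (1 ⇐ given 9 ∷ short Y 2F 0F ∷ []) (2 ⇐ given 8 ∷ given 3 ∷
                 given 2 ∷ given 0 ∷ short X 2F 0F ∷ short X 2F 1F ∷ short X 3F 0F ∷ short Y 3F 2F ∷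
                 []) (1 ⇐ given 9 ∷ given 7 ∷ given 0 ∷ short X 4F 3F ∷ short Y 2F 0F ∷ short Y 3F
                 1F ∷ []) (1 ⇐ given 3 ∷ short X 3F 0F ∷ []))
              (equal 1F 3F (1 ⇐ given 2 ∷ given 1 ∷ short Y 1F 2F ∷ short Y 3F 0F ∷ []) (1 ⇐ given 3
                 ∷ given 0 ∷ short Y 1F 0F ∷ short Y 3F 2F ∷ [])))
            (vanish 4F (1 ⇐ given 7 ∷ given 4 ∷ given 2 ∷ given 2 ∷ given 0 ∷ given 0 ∷ short X 3F
               0F ∷ short X 4F 1F ∷ short Y 1F 0F ∷ short Y 2F 0F ∷ short Y 2F 1F ∷ [])))
          (vanish 1F (1 ⇐ given 8 ∷ given 0 ∷ [])))
        (vanish 2F (1 ⇐ given 7 ∷ given 7 ∷ given 6 ∷ given 5 ∷ given 4 ∷ given 0 ∷ given 0 ∷ short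
           X 3F 0F ∷ short X 4F 1F ∷ short Y 1F 3F ∷ short Y 1F 3F ∷ [])))
      (vanish 4F (2 ⇐ given 4 ∷ given 2 ∷ given 1 ∷ given 0 ∷ short X 2F 0F ∷ short X 4F 2F ∷ []))
      (line rising 1F 3F 5F (1 ⇐ given 4 ∷ short Y 3F 1F ∷ []) (1 ⇐ given 2 ∷ given 0 ∷ short X 5F
         1F ∷ short Y 5F 3F ∷ []) (1 ⇐ given 4 ∷ given 2 ∷ short Y 3F 1F ∷ short Y 5F 3F ∷ []) (1 ⇐
         given 0 ∷ short X 5F 1F ∷ []))
      (line falling 1F 3F 5F (1 ⇐ given 4 ∷ short Y 1F 3F ∷ []) (1 ⇐ given 2 ∷ given 0 ∷ short X 5F
         1F ∷ short Y 3F 5F ∷ []) (1 ⇐ given 4 ∷ given 2 ∷ short Y 1F 3F ∷ short Y 3F 5F ∷ []) (1 ⇐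
         given 0 ∷ short X 5F 1F ∷ [])))
    (vanish 4F (1 ⇐ given 2 ∷ given 0 ∷ short X 0F 2F ∷ []))
    -- The chain of two D₂ along X against D₄ along Y: 2 D₂ ≤ D₄ ≤ 2 D₂.
    (line rising 0F 2F 4F (1 ⇐ given 4 ∷ short Y 2F 0F ∷ []) (1 ⇐ given 2 ∷ given 0 ∷ short X 4F 0F
       ∷ short Y 4F 2F ∷ []) (1 ⇐ given 4 ∷ given 2 ∷ short Y 2F 0F ∷ short Y 4F 2F ∷ []) (1 ⇐ given
       0 ∷ short X 4F 0F ∷ []))
    (line falling 0F 2F 4F (1 ⇐ given 4 ∷ short Y 0F 2F ∷ []) (1 ⇐ given 2 ∷ given 0 ∷ short X 4F 0F
       ∷ short Y 2F 4F ∷ []) (1 ⇐ given 4 ∷ given 2 ∷ short Y 0F 2F ∷ short Y 2F 4F ∷ []) (1 ⇐ given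
       0 ∷ short X 4F 0F ∷ []))

-- Checking certificates, and soundness of the check.

module Proof {c ℓ₁ ℓ₂ : Level} (ℝ : RealNumbers c ℓ₁ ℓ₂) where

  open RealNumbers ℝ
  open CommutativeRing commutativeRing
    using (+-cong; +-congˡ; +-congʳ; +-comm; +-assoc; +-identityˡ; +-identityʳ; -‿inverseʳ; -‿cong; *-identityˡ;
           *-congˡ; *-congʳ; *-assoc; *-comm; *-identityʳ; zeroˡ; zeroʳ; distribˡ; distribʳ;
           +-commutativeMonoid; +-abelianGroup)
    renaming (refl to ≈-refl; sym to ≈-sym; trans to ≈-trans; reflexive to ≈-reflexive)
  module Ord = DecTotalOrder decTotalOrder
  open Ord using (total; antisym; poset) renaming (refl to ≤-refl; trans to ≤-trans; reflexive to ≤-reflexive; _≤?_ to _≤?_)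
  open PosetReasoning poset
  open AbelianGroupProperties +-abelianGroup using (//-rightDividesˡ; //-rightDividesʳ; \\-leftDividesʳ; ⁻¹-∙-comm; ⁻¹-involutive; ⁻¹-injective)
  open RingProperties (CommutativeRing.ring commutativeRing) using (-1*x≈-x; -0#≈0#; -‿distribˡ-*; -‿distribʳ-*)
  open CommutativeSemigroupProperties (CommutativeRing.+-commutativeSemigroup commutativeRing) using (interchange)
  module Bag = CommutativeMonoidNormal +-commutativeMonoid

  +-mono-≤ : ∀ {x y u v} → x ≤ y → u ≤ v → x + u ≤ y + v
  +-mono-≤ {x} {y} {u} {v} x≤y u≤v = begin
    x + u ≤⟨ +-monoˡ-≤ u x≤y ⟩
    y + u ≈⟨ +-comm y u ⟩
    u + y ≤⟨ +-monoˡ-≤ y u≤v ⟩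
    v + y ≈⟨ +-comm v y ⟩
    y + v ∎

  +-cancelʳ-≤ : ∀ z {x y} → x + z ≤ y + z → x ≤ y
  +-cancelʳ-≤ z {x} {y} le = begin
    x           ≈⟨ //-rightDividesʳ z x ⟨
    (x + z) - z ≤⟨ +-monoˡ-≤ (- z) le ⟩
    (y + z) - z ≈⟨ //-rightDividesʳ z y ⟩
    y           ∎

  -- Variables 0 to 6 are the X coordinates, 7 to 13 the Y coordinates and 14 to 20 the distances.
  bag : Term → Bag.Expr 21
  bag (at X i) = Bag.var (i ↑ˡ 14)
  bag (at Y i) = Bag.var (7 ↑ʳ (i ↑ˡ 7))
  bag (dist k) = Bag.var (7 ↑ʳ (7 ↑ʳ k))
  bag 𝟘        = Bag.id
  bag (s ⊞ t)  = bag s Bag.⊕ bag t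

  infix 4 _≟ᵇ_

  _≟ᵇ_ : (s t : Term) → Dec (Bag.normalise (bag s) ≡ Bag.normalise (bag t))
  s ≟ᵇ t = Bag.normalise (bag s) Bag.≟ Bag.normalise (bag t)

  -- Let the facts add up to L ≤ R. If L + m rhs and R + m lhs are the same multiset, then adding m
  -- lhs to L ≤ R gives m lhs + L ≤ m rhs + L, and L cancels. The multiple m = 0 would certify
  -- anything and is rejected.
  proves : Context → Farkas → Inequality → Bool
  proves Γ (zero  ⇐ c) h = false
  proves Γ (suc m ⇐ c) h =
    ⌊ lhs (combine Γ c) ⊞ suc m ⊠ rhs h ≟ᵇ rhs (combine Γ c) ⊞ suc m ⊠ lhs h ⌋

  provesAll : Context → List Farkas → List Inequality → Bool
  provesAll Γ []       []       = true
  provesAll Γ (f ∷ fs) (h ∷ hs) = proves Γ f h ∧ provesAll Γ fs hs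
  provesAll Γ _        _        = false

  places : Context → Square → Position → Bool
  places Γ S p =
    provesAll Γ (X-low p ∷ X-high p ∷ Y-low p ∷ Y-high p ∷ border p ∷ [])
      (within S X low (vertex p) ∷ within S X high (vertex p) ∷
       within S Y low (vertex p) ∷ within S Y high (vertex p) ∷
       beyond S (axis p) (side p) (vertex p) ∷ [])

  module Checker {I : Set} (goal : I → List Inequality) where

    check : Context → Certificate I → Bool
    check Γ (split i j c₁ c₂ c₃ c₄) =
      check (reaching X i j ∷ Γ) c₁ ∧ check (reaching X j i ∷ Γ) c₂ ∧
      check (reaching Y i j ∷ Γ) c₃ ∧ check (reaching Y j i ∷ Γ) c₄
    check Γ (vanish k f) = ⌊ ¬? (k ≟ 0F) ⌋ ∧ proves Γ f (dist k ≼ 𝟘)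
    check Γ (equal k l f g) =
      ⌊ ¬? (k ≟ l) ⌋ ∧ proves Γ f (dist k ≼ dist l) ∧ proves Γ g (dist l ≼ dist k)
    check Γ (line s i j k f₁ f₂ f₃ f₄) =
      ⌊ injective? (lookup (i ∷ j ∷ k ∷ [])) ⌋ ∧
      provesAll Γ (f₁ ∷ f₂ ∷ f₃ ∷ f₄ ∷ []) (levels s i j k)
    check Γ (circle S ps) =
      ⌊ injective? (vertex ∘ lookup ps) ⌋ ∧ allFin (places Γ S ∘ lookup ps)
    check Γ (conclude i fs) = provesAll Γ fs (goal i)

  -- Configurations of seven points.

  Layout : Set c
  Layout = Axis → Fin 7 → Carrier

  -- A width `w` ≤ 0 is allowed, so no certificate has to prove positivity; distinct points cannot
  -- share such a degenerate square anyway.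
  OnSquare : Layout → (Axis → Carrier) → Carrier → Fin 7 → Set ℓ₂
  OnSquare P lo w i =
    (∀ a → lo a ≤ P a i × P a i ≤ lo a + w) ×
    ∃ λ a → P a i ≤ lo a ⊎ lo a + w ≤ P a i

  -- All that a tree may use or contradict, in a form on which the symmetries act easily: lines are
  -- given by an equation and squares by lower left corner and width, so interchanging the axes
  -- renames and reflecting changes signs. The second alternative of `attained` has `gap j i`, which
  -- makes both alternatives literal instances of `reaching`.
  record Configuration (P : Layout) (D : Fin 7 → Carrier) : Set (c ⊔ ℓ₁ ⊔ ℓ₂) where
    field
      bound        : ∀ a i j → P a i ≤ P a j + D (gap i j)
      attained     : ∀ i j → ∃ λ a → P a i + D (gap i j) ≤ P a j ⊎ P a j + D (gap j i) ≤ P a i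
      positive     : ∀ k → k ≢ 0F → ¬ D k ≤ 0#
      distinct     : ∀ k l → D k ≈ D l → k ≡ l
      notCollinear : (f : Fin 3 → Fin 7) → Injective f →
                     (α : Axis → Carrier) (γ : Carrier) → ¬ (∀ a → α a ≈ 0#) →
                     ¬ (∀ i → α X * P X (f i) + α Y * P Y (f i) ≈ γ)
      notConcyclic : (f : Fin 4 → Fin 7) → Injective f →
                     (lo : Axis → Carrier) (w : Carrier) → ¬ (∀ i → OnSquare P lo w (f i))

  module Semantics (P : Layout) (D : Fin 7 → Carrier) where

    ⟦_⟧ : Term → Carrier
    ⟦ at a i ⟧ = P a i
    ⟦ dist k ⟧ = D k
    ⟦ 𝟘 ⟧      = 0#
    ⟦ s ⊞ t ⟧  = ⟦ s ⟧ + ⟦ t ⟧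

    Holds : Inequality → Set ℓ₂
    Holds (s ≼ t) = ⟦ s ⟧ ≤ ⟦ t ⟧

    env : Bag.Env 21
    env = tabulate (P X) ++ (tabulate (P Y) ++ tabulate D)

    bag-correct : ∀ t → Bag.⟦ bag t ⟧ env ≡ ⟦ t ⟧
    bag-correct (at X i) = ≡.trans (lookup-++ˡ (tabulate (P X)) _ i) (lookup∘tabulate (P X) i)
    bag-correct (at Y i) = ≡.trans
      (lookup-++ʳ (tabulate (P X)) (tabulate (P Y) ++ tabulate D) (i ↑ˡ 7))
      (≡.trans (lookup-++ˡ (tabulate (P Y)) (tabulate D) i) (lookup∘tabulate (P Y) i))
    bag-correct (dist k) = ≡.trans
      (lookup-++ʳ (tabulate (P X)) (tabulate (P Y) ++ tabulate D) (7 ↑ʳ k))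
      (≡.trans (lookup-++ʳ (tabulate (P Y)) (tabulate D) k) (lookup∘tabulate D k))
    bag-correct 𝟘        = refl
    bag-correct (s ⊞ t)  = ≡.cong₂ _+_ (bag-correct s) (bag-correct t)

    ≟ᵇ-sound : ∀ s t → T ⌊ s ≟ᵇ t ⌋ → ⟦ s ⟧ ≈ ⟦ t ⟧
    ≟ᵇ-sound s t same = begin-equality
      ⟦ s ⟧                               ≡⟨ bag-correct s ⟨
      Bag.⟦ bag s ⟧ env                   ≈⟨ Bag.correct (bag s) env ⟨
      Bag.⟦ Bag.normalise (bag s) ⟧⇓ env  ≡⟨ cong (λ b → Bag.⟦ b ⟧⇓ env) (toWitness same) ⟩
      Bag.⟦ Bag.normalise (bag t) ⟧⇓ env  ≈⟨ Bag.correct (bag t) env ⟩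
      Bag.⟦ bag t ⟧ env                   ≡⟨ bag-correct t ⟩
      ⟦ t ⟧                               ∎

    ⊠-mono-≤ : ∀ m {s t} → ⟦ s ⟧ ≤ ⟦ t ⟧ → ⟦ m ⊠ s ⟧ ≤ ⟦ m ⊠ t ⟧
    ⊠-mono-≤ zero    s≤t = ≤-refl
    ⊠-mono-≤ (suc m) s≤t = +-mono-≤ s≤t (⊠-mono-≤ m s≤t)

    -- Totality replaces division: if t ≤ s, then m t ≤ m s, so s + m s ≤ t + m t ≤ t + m s, and m s
    -- cancels.
    ⊠-cancel-≤ : ∀ m s t → ⟦ suc m ⊠ s ⟧ ≤ ⟦ suc m ⊠ t ⟧ → ⟦ s ⟧ ≤ ⟦ t ⟧
    ⊠-cancel-≤ m s t le with total ⟦ s ⟧ ⟦ t ⟧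
    ... | inj₁ s≤t = s≤t
    ... | inj₂ t≤s = +-cancelʳ-≤ ⟦ m ⊠ s ⟧ (≤-trans le (+-mono-≤ ≤-refl (⊠-mono-≤ m t≤s)))

    fact-sound : Configuration P D → ∀ {Γ} → All Holds Γ → ∀ f → Holds (fact Γ f)
    fact-sound C hs       (short a i j)   = Configuration.bound C a i j
    fact-sound C []       (given k)       = ≤-refl
    fact-sound C (h ∷ hs) (given zero)    = h
    fact-sound C (h ∷ hs) (given (suc k)) = fact-sound C hs (given k)

    combine-sound : Configuration P D → ∀ {Γ} → All Holds Γ → ∀ c → Holds (combine Γ c)
    combine-sound C hs []      = ≤-refl
    combine-sound C hs (f ∷ c) = +-mono-≤ (fact-sound C hs f) (combine-sound C hs c)

    proves-sound : Configuration P D → ∀ {Γ} → All Holds Γ → ∀ f h → T (proves Γ f h) → Holds h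
    proves-sound C {Γ} hs (suc m ⇐ c) h ok =
      ⊠-cancel-≤ m (lhs h) (rhs h) $ +-cancelʳ-≤ ⟦ lhs (combine Γ c) ⟧ $ begin
        ⟦ suc m ⊠ lhs h ⟧ + ⟦ lhs (combine Γ c) ⟧ ≤⟨ +-mono-≤ ≤-refl (combine-sound C hs c) ⟩
        ⟦ suc m ⊠ lhs h ⟧ + ⟦ rhs (combine Γ c) ⟧ ≈⟨ +-comm _ _ ⟩
        ⟦ rhs (combine Γ c) ⟧ + ⟦ suc m ⊠ lhs h ⟧
          ≈⟨ ≟ᵇ-sound (lhs (combine Γ c) ⊞ suc m ⊠ rhs h) (rhs (combine Γ c) ⊞ suc m ⊠ lhs h) ok ⟨
        ⟦ lhs (combine Γ c) ⟧ + ⟦ suc m ⊠ rhs h ⟧ ≈⟨ +-comm _ _ ⟩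
        ⟦ suc m ⊠ rhs h ⟧ + ⟦ lhs (combine Γ c) ⟧ ∎

    provesAll-sound : Configuration P D → ∀ {Γ} → All Holds Γ → ∀ fs gs → T (provesAll Γ fs gs) → All Holds gs
    provesAll-sound C hs []       []       ok = []
    provesAll-sound C hs (f ∷ fs) (g ∷ gs) ok with ∧-split (proves _ f g) ok
    ... | ok₁ , ok₂ = proves-sound C hs f g ok₁ ∷ provesAll-sound C hs fs gs ok₂

    corner : Square → Axis → Carrier
    corner S a = ⟦ corner⁺ S a ⟧ - ⟦ corner⁻ S a ⟧

    width : Square → Carrier
    width S = ⟦ width⁺ S ⟧ - ⟦ width⁻ S ⟧

    -- Adding the subtracted parts turns the high edge into the subtraction-free form in which
    -- `within` and `beyond` state it.
    opposite : ∀ S a → (corner S a + width S) + (⟦ corner⁻ S a ⟧ + ⟦ width⁻ S ⟧) ≈ ⟦ corner⁺ S a ⟧ + ⟦ width⁺ S ⟧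
    opposite S a = begin-equality
      (corner S a + width S) + (⟦ corner⁻ S a ⟧ + ⟦ width⁻ S ⟧)   ≈⟨ interchange _ _ _ _ ⟩
      (corner S a + ⟦ corner⁻ S a ⟧) + (width S + ⟦ width⁻ S ⟧)   ≈⟨ +-cong (//-rightDividesˡ _ _) (//-rightDividesˡ _ _) ⟩
      ⟦ corner⁺ S a ⟧ + ⟦ width⁺ S ⟧                             ∎

    low-edge : ∀ S a i → Holds (within S a low i) → corner S a ≤ P a i
    low-edge S a i le = +-cancelʳ-≤ ⟦ corner⁻ S a ⟧ (≤-trans (≤-reflexive (//-rightDividesˡ _ _)) le)

    low-edge′ : ∀ S a i → Holds (beyond S a low i) → P a i ≤ corner S a
    low-edge′ S a i le = +-cancelʳ-≤ ⟦ corner⁻ S a ⟧ (≤-trans le (≤-reflexive (≈-sym (//-rightDividesˡ _ _))))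

    high-edge : ∀ S a i → Holds (within S a high i) → P a i ≤ corner S a + width S
    high-edge S a i le = +-cancelʳ-≤ (⟦ corner⁻ S a ⟧ + ⟦ width⁻ S ⟧) (≤-trans le (≤-reflexive (≈-sym (opposite S a))))

    high-edge′ : ∀ S a i → Holds (beyond S a high i) → corner S a + width S ≤ P a i
    high-edge′ S a i le = +-cancelʳ-≤ (⟦ corner⁻ S a ⟧ + ⟦ width⁻ S ⟧) (≤-trans (≤-reflexive (opposite S a)) le)

    places-sound : Configuration P D → ∀ {Γ} → All Holds Γ → ∀ S p → T (places Γ S p) →
                   OnSquare P (corner S) (width S) (vertex p)
    places-sound C {Γ} hs S p ok with provesAll-sound C hs
        (X-low p ∷ X-high p ∷ Y-low p ∷ Y-high p ∷ border p ∷ [])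
        (within S X low (vertex p) ∷ within S X high (vertex p) ∷
         within S Y low (vertex p) ∷ within S Y high (vertex p) ∷
         beyond S (axis p) (side p) (vertex p) ∷ []) ok
    ... | xl ∷ xh ∷ yl ∷ yh ∷ b ∷ [] = inside , axis p , edge (side p) b
      where
      inside : ∀ a → corner S a ≤ P a (vertex p) × P a (vertex p) ≤ corner S a + width S
      inside X = low-edge S X (vertex p) xl , high-edge S X (vertex p) xh
      inside Y = low-edge S Y (vertex p) yl , high-edge S Y (vertex p) yh
      edge : ∀ s → Holds (beyond S (axis p) s (vertex p)) →
             P (axis p) (vertex p) ≤ corner S (axis p) ⊎ corner S (axis p) + width S ≤ P (axis p) (vertex p)
      edge low  b = inj₁ (low-edge′ S (axis p) (vertex p) b)
      edge high b = inj₂ (high-edge′ S (axis p) (vertex p) b)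

    allFin-sound : ∀ {n} (f : Fin n → Bool) → T (allFin f) → ∀ i → T (f i)
    allFin-sound f ok zero    = proj₁ (∧-split (f zero) ok)
    allFin-sound f ok (suc i) = allFin-sound (f ∘ suc) (proj₂ (∧-split (f zero) ok)) i

    -- A normal vector of the lines of that slope; `height` is then constant exactly along them.
    tilt : Slope → Axis → Carrier
    tilt s       X = 1#
    tilt rising  Y = - 1#
    tilt falling Y = 1#

    height : Slope → Fin 7 → Carrier
    height s i = tilt s X * P X i + tilt s Y * P Y i

    level-sound : ∀ s i j → Holds (level s i j) → height s i ≤ height s j
    level-sound rising i j le = begin
      1# * P X i + - 1# * P Y i ≈⟨ +-cong (*-identityˡ _) (-1*x≈-x _) ⟩
      P X i - P Y i             ≤⟨ +-cancelʳ-≤ (P Y i + P Y j) shifted ⟩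
      P X j - P Y j             ≈⟨ +-cong (*-identityˡ _) (-1*x≈-x _) ⟨
      1# * P X j + - 1# * P Y j ∎
      where
      shifted : (P X i - P Y i) + (P Y i + P Y j) ≤ (P X j - P Y j) + (P Y i + P Y j)
      shifted = begin
        (P X i - P Y i) + (P Y i + P Y j) ≈⟨ +-assoc _ _ _ ⟨
        (P X i - P Y i + P Y i) + P Y j   ≈⟨ +-congʳ (//-rightDividesˡ _ _) ⟩
        P X i + P Y j                     ≤⟨ le ⟩
        P X j + P Y i                     ≈⟨ +-congʳ (//-rightDividesˡ _ _) ⟨
        (P X j - P Y j + P Y j) + P Y i   ≈⟨ +-assoc _ _ _ ⟩
        (P X j - P Y j) + (P Y j + P Y i) ≈⟨ +-congˡ (+-comm _ _) ⟩
        (P X j - P Y j) + (P Y i + P Y j) ∎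
    level-sound falling i j le = begin
      1# * P X i + 1# * P Y i ≈⟨ +-cong (*-identityˡ _) (*-identityˡ _) ⟩
      P X i + P Y i           ≤⟨ le ⟩
      P X j + P Y j           ≈⟨ +-cong (*-identityˡ _) (*-identityˡ _) ⟨
      1# * P X j + 1# * P Y j ∎

    module Soundness (C : Configuration P D) {I : Set} (goal : I → List Inequality) where

      open Configuration C
      open Checker goal

      -- At a `split`, `attained` picks the subtree whose extra assumption is true. Following these
      -- picks ends in a leaf, which cannot be a contradiction, as each kind is refuted by one field
      -- of `Configuration`.
      sound : ∀ {Γ} → All Holds Γ → ∀ c → T (check Γ c) → ∃ λ i → All Holds (goal i)
      sound {Γ} hs (split i j c₁ c₂ c₃ c₄) ok
        with ok₁ , ok  ← ∧-split (check (reaching X i j ∷ Γ) c₁) ok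
        with ok₂ , ok  ← ∧-split (check (reaching X j i ∷ Γ) c₂) ok
        with ok₃ , ok₄ ← ∧-split (check (reaching Y i j ∷ Γ) c₃) ok
        with attained i j
      ... | X , inj₁ r = sound (r ∷ hs) c₁ ok₁
      ... | X , inj₂ r = sound (r ∷ hs) c₂ ok₂
      ... | Y , inj₁ r = sound (r ∷ hs) c₃ ok₃
      ... | Y , inj₂ r = sound (r ∷ hs) c₄ ok₄
      sound hs (vanish k f) ok
        with k≢0 , ok ← ∧-split ⌊ ¬? (k ≟ 0F) ⌋ ok
        = ⊥-elim (positive k (toWitness {a? = ¬? (k ≟ 0F)} k≢0) (proves-sound C hs f (dist k ≼ 𝟘) ok))
      sound {Γ} hs (equal k l f g) ok
        with k≢l , ok  ← ∧-split ⌊ ¬? (k ≟ l) ⌋ ok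
        with ok₁ , ok₂ ← ∧-split (proves Γ f (dist k ≼ dist l)) ok
        = ⊥-elim (toWitness {a? = ¬? (k ≟ l)} k≢l (distinct k l (antisym
            (proves-sound C hs f (dist k ≼ dist l) ok₁) (proves-sound C hs g (dist l ≼ dist k) ok₂))))
      sound hs (line s i j k f₁ f₂ f₃ f₄) ok
        with inj , ok ← ∧-split ⌊ injective? (lookup (i ∷ j ∷ k ∷ [])) ⌋ ok
        with ij ∷ ji ∷ ik ∷ ki ∷ [] ← provesAll-sound C hs (f₁ ∷ f₂ ∷ f₃ ∷ f₄ ∷ []) (levels s i j k) ok
        = ⊥-elim (notCollinear (lookup (i ∷ j ∷ k ∷ []))
            (toWitness {a? = injective? (lookup (i ∷ j ∷ k ∷ []))} inj)
            (tilt s) (height s i) (λ α≈0 → 1≉0 (α≈0 X)) same)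
        where
        same : ∀ l → height s (lookup (i ∷ j ∷ k ∷ []) l) ≈ height s i
        same 0F = ≈-refl
        same 1F = antisym (level-sound s j i ji) (level-sound s i j ij)
        same 2F = antisym (level-sound s k i ki) (level-sound s i k ik)
      sound {Γ} hs (circle S ps) ok
        with inj , ok ← ∧-split ⌊ injective? (vertex ∘ lookup ps) ⌋ ok
        = ⊥-elim (notConcyclic (vertex ∘ lookup ps) (toWitness {a? = injective? (vertex ∘ lookup ps)} inj)
            (corner S) (width S)
            (λ i → places-sound C hs S (lookup ps i) (allFin-sound (places Γ S ∘ lookup ps) ok i)))
      sound hs (conclude i fs) ok = i , provesAll-sound C hs fs (goal i) ok

  -- Symmetries of the square, and reduction to the normalised cases of the trees.

  neg-≤ : ∀ {x y} → x ≤ y → - y ≤ - x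
  neg-≤ {x} {y} x≤y = +-cancelʳ-≤ (x + y) $ begin
    - y + (x + y) ≈⟨ +-congˡ (+-comm x y) ⟩
    - y + (y + x) ≈⟨ \\-leftDividesʳ y x ⟩
    x             ≤⟨ x≤y ⟩
    y             ≈⟨ \\-leftDividesʳ x y ⟨
    - x + (x + y) ∎

  neg-shift : ∀ {x y z} → x ≤ y + z → - y ≤ - x + z
  neg-shift {x} {y} {z} le = begin
    - y               ≈⟨ //-rightDividesˡ z (- y) ⟨
    - y - z + z       ≈⟨ +-congʳ (⁻¹-∙-comm y z) ⟩
    - (y + z) + z     ≤⟨ +-monoˡ-≤ z (neg-≤ le) ⟩
    - x + z           ∎

  neg-shift′ : ∀ {x y z} → x + z ≤ y → - y + z ≤ - x
  neg-shift′ {x} {y} {z} le = begin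
    - y + z           ≤⟨ +-monoˡ-≤ z (neg-≤ le) ⟩
    - (x + z) + z     ≈⟨ +-congʳ (⁻¹-∙-comm x z) ⟨
    - x - z + z       ≈⟨ //-rightDividesˡ z (- x) ⟩
    - x               ∎

  gap-comm : ∀ {n} (i j : Fin n) → gap i j ≡ gap j i
  gap-comm zero    zero    = refl
  gap-comm zero    (suc j) = refl
  gap-comm (suc i) zero    = refl
  gap-comm (suc i) (suc j) = cong inject₁ (gap-comm i j)

  swap reflect : Layout → Layout
  swap P a = P (other a)
  reflect P X i = - P X i
  reflect P Y i = P Y i

  -- The axis is left existential because an interchange of the axes moves it.
  Straight : Layout → Set ℓ₁
  Straight P = ∃ λ a → ∀ (i : Fin 5) →
    P a (inject₁ (suc i)) + P a (inject₁ (suc i)) ≈ P a (inject₁ (inject₁ i)) + P a (suc (suc i))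

  straight-swap : ∀ P → Straight (swap P) → Straight P
  straight-swap P (a , eq) = other a , eq

  straight-reflect : ∀ P → Straight (reflect P) → Straight P
  straight-reflect P (X , eq) = X , λ i → ⁻¹-injective
    (≈-trans (≈-sym (⁻¹-∙-comm _ _)) (≈-trans (eq i) (⁻¹-∙-comm _ _)))
  straight-reflect P (Y , eq) = Y , eq

  swap-configuration : ∀ {P D} → Configuration P D → Configuration (swap P) D
  swap-configuration {P} {D} C = record
    { bound        = λ a → bound (other a)
    ; attained     = λ i j → attained′ i j (attained i j)
    ; positive     = positive
    ; distinct     = distinct
    ; notCollinear = λ f inj α γ α≉0 same → notCollinear f inj (α ∘ other) γ (α≉0 ∘ both α)
        (λ i → ≈-trans (+-comm _ _) (same i))
    ; notConcyclic = λ f inj lo w on → notConcyclic f inj (lo ∘ other) w (λ i → onSquare lo w (on i))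
    }
    where
    open Configuration C
    attained′ : ∀ i j → ∃ (λ a → P a i + D (gap i j) ≤ P a j ⊎ P a j + D (gap j i) ≤ P a i) →
                ∃ (λ a → swap P a i + D (gap i j) ≤ swap P a j ⊎ swap P a j + D (gap j i) ≤ swap P a i)
    attained′ i j (X , r) = Y , r
    attained′ i j (Y , r) = X , r
    both : ∀ (α : Axis → Carrier) → (∀ a → α (other a) ≈ 0#) → ∀ a → α a ≈ 0#
    both α α≈0 X = α≈0 Y
    both α α≈0 Y = α≈0 X
    onSquare : ∀ lo w {i} → OnSquare (swap P) lo w i → OnSquare P (lo ∘ other) w i
    onSquare lo w (inside , X , e) = (λ { X → inside Y ; Y → inside X }) , Y , e
    onSquare lo w (inside , Y , e) = (λ { X → inside Y ; Y → inside X }) , X , e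

  reflect-configuration : ∀ {P D} → Configuration P D → Configuration (reflect P) D
  reflect-configuration {P} {D} C = record
    { bound        = bound′
    ; attained     = λ i j → attained′ i j (attained i j)
    ; positive     = positive
    ; distinct     = distinct
    ; notCollinear = λ f inj α γ α≉0 same → notCollinear f inj (α′ α) γ (α≉0 ∘ both α) (λ i → begin-equality
        - α X * P X (f i) + α Y * P Y (f i) ≈⟨ +-congʳ (-‿distribˡ-* (α X) (P X (f i))) ⟨
        - (α X * P X (f i)) + α Y * P Y (f i) ≈⟨ +-congʳ (-‿distribʳ-* (α X) (P X (f i))) ⟩
        α X * - P X (f i) + α Y * P Y (f i) ≈⟨ same i ⟩
        γ ∎)
    ; notConcyclic = λ f inj lo w on → notConcyclic f inj (lo′ lo w) w (λ i → onSquare lo w (on i))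
    }
    where
    open Configuration C
    bound′ : ∀ a i j → reflect P a i ≤ reflect P a j + D (gap i j)
    bound′ X i j = neg-shift (subst (λ k → P X j ≤ P X i + D k) (gap-comm j i) (bound X j i))
    bound′ Y i j = bound Y i j
    attained′ : ∀ i j → ∃ (λ a → P a i + D (gap i j) ≤ P a j ⊎ P a j + D (gap j i) ≤ P a i) →
                ∃ (λ a → reflect P a i + D (gap i j) ≤ reflect P a j ⊎ reflect P a j + D (gap j i) ≤ reflect P a i)
    -- Reflection reverses the order of the X coordinates, so the two alternatives change places,
    -- and with them the arguments of `gap`.
    attained′ i j (X , inj₁ r) = X , inj₂ (neg-shift′ (subst (λ k → P X i + D k ≤ P X j) (gap-comm i j) r))
    attained′ i j (X , inj₂ r) = X , inj₁ (neg-shift′ (subst (λ k → P X j + D k ≤ P X i) (gap-comm j i) r))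
    attained′ i j (Y , r)      = Y , r
    α′ : (Axis → Carrier) → Axis → Carrier
    α′ α X = - α X
    α′ α Y = α Y
    both : ∀ (α : Axis → Carrier) → (∀ a → α′ α a ≈ 0#) → ∀ a → α a ≈ 0#
    both α α≈0 X = ⁻¹-injective (≈-trans (α≈0 X) (≈-sym -0#≈0#))
    both α α≈0 Y = α≈0 Y
    -- Negation maps the interval from lo to lo + w onto that from -(lo + w) to -lo: the former high
    -- side becomes the low one.
    lo′ : (Axis → Carrier) → Carrier → Axis → Carrier
    lo′ lo w X = - (lo X + w)
    lo′ lo w Y = lo Y
    cancelled : ∀ x w → - (x + w) + w ≈ - x
    cancelled x w = begin-equality
      - (x + w) + w ≈⟨ +-congʳ (⁻¹-∙-comm x w) ⟨
      - x - w + w   ≈⟨ //-rightDividesˡ w (- x) ⟩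
      - x           ∎
    unneg-≤ : ∀ {x y} → - x ≤ y → - y ≤ x
    unneg-≤ {x} {y} le = begin
      - y     ≤⟨ neg-≤ le ⟩
      - - x   ≈⟨ ⁻¹-involutive x ⟩
      x       ∎
    unneg-≥ : ∀ {x y} → x ≤ - y → y ≤ - x
    unneg-≥ {x} {y} le = begin
      y       ≈⟨ ⁻¹-involutive y ⟨
      - - y   ≤⟨ neg-≤ le ⟩
      - x     ∎
    onSquare : ∀ lo w {i} → OnSquare (reflect P) lo w i → OnSquare P (lo′ lo w) w i
    onSquare lo w {i} (inside , a , e) = inside′ , a , edge a e
      where
      inside′ : ∀ a → lo′ lo w a ≤ P a i × P a i ≤ lo′ lo w a + w
      inside′ X with l , h ← inside X =
        unneg-≤ h , ≤-trans (unneg-≥ l) (≤-reflexive (≈-sym (cancelled (lo X) w)))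
      inside′ Y = inside Y
      edge : ∀ a → reflect P a i ≤ lo a ⊎ lo a + w ≤ reflect P a i →
             P a i ≤ lo′ lo w a ⊎ lo′ lo w a + w ≤ P a i
      edge X (inj₁ l) = inj₂ (≤-trans (≤-reflexive (cancelled (lo X) w)) (unneg-≤ l))
      edge X (inj₂ h) = inj₁ (unneg-≥ h)
      edge Y e = e

  -- The normalising assumptions at the roots of the trees. Their order matters: the indices in
  -- `given` count through the splits down to these lists.
  base-half base-progression : Context
  base-half        = reaching X 2F 3F ∷ below Y 2F 3F ∷ []
  base-progression =
    reaching X 3F 5F ∷ reaching X 2F 4F ∷ reaching X 1F 3F ∷ reaching X 0F 2F ∷ below Y 0F 1F ∷ []

  -- `check` inspects only syntax and normal forms of natural multiplicities, so it evaluates to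
  -- `true` over an abstract `ℝ`; type checking `tt` is the verification of the whole tree.
  half-checked : T (Checker.check half base-half half-certificate)
  half-checked = tt

  progression-checked : T (Checker.check progression base-progression progression-certificate)
  progression-checked = tt

  half-sound : ∀ P D → Configuration P D → All (Semantics.Holds P D) base-half → ∃ λ g → All (Semantics.Holds P D) (half g)
  half-sound P D C hs = Semantics.Soundness.sound P D C half {base-half} hs half-certificate half-checked

  progression-sound : ∀ P D → Configuration P D → All (Semantics.Holds P D) base-progression → Straight P
  progression-sound P D C hs
    with Semantics.Soundness.sound P D C progression {base-progression} hs progression-certificate progression-checked
  ... | a , h₀ ∷ l₀ ∷ h₁ ∷ l₁ ∷ h₂ ∷ l₂ ∷ h₃ ∷ l₃ ∷ h₄ ∷ l₄ ∷ [] = a , λ where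
    0F → antisym h₀ l₀
    1F → antisym h₁ l₁
    2F → antisym h₂ l₂
    3F → antisym h₃ l₃
    4F → antisym h₄ l₄

  straight-reflectY : ∀ P → Straight (swap (reflect (swap P))) → Straight P
  straight-reflectY P = straight-swap P ∘ straight-reflect (swap P) ∘ straight-swap (reflect (swap P))

  reflectY-configuration : ∀ {P D} → Configuration P D → Configuration (swap (reflect (swap P))) D
  reflectY-configuration = swap-configuration ∘ reflect-configuration ∘ swap-configuration

  -- The D₂ are already oriented along X, so reflecting Y is still free and is used to arrange Y₀ ≤
  -- Y₁. This is independent of the orientation chosen for the first tree, whose outcome may lie on
  -- either axis.
  increasing-straight : ∀ P D → Configuration P D → All (Semantics.Holds P D) (half (X , true)) → Straight P
  increasing-straight P D C (r₀ ∷ r₁ ∷ r₂ ∷ r₃ ∷ []) with total (P Y 0F) (P Y 1F)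
  ... | inj₁ y≤ = progression-sound P D C (r₃ ∷ r₂ ∷ r₁ ∷ r₀ ∷ y≤ ∷ [])
  ... | inj₂ y≥ = straight-reflectY P
          (progression-sound _ D (reflectY-configuration C) (r₃ ∷ r₂ ∷ r₁ ∷ r₀ ∷ neg-≤ y≥ ∷ []))

  half-straight : ∀ P D → Configuration P D → (∃ λ g → All (Semantics.Holds P D) (half g)) → Straight P
  half-straight P D C ((X , true) , h) = increasing-straight P D C h
  half-straight P D C ((Y , true) , r₀ ∷ r₁ ∷ r₂ ∷ r₃ ∷ []) =
    -- The facts for `P` along Y are by computation those for `swap P` along X; only the list that
    -- indexes `All` differs, so it is rebuilt.
    straight-swap P (increasing-straight (swap P) D (swap-configuration C) (r₀ ∷ r₁ ∷ r₂ ∷ r₃ ∷ []))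
  half-straight P D C ((X , false) , r₀ ∷ r₁ ∷ r₂ ∷ r₃ ∷ []) =
    straight-reflect P (increasing-straight (reflect P) D (reflect-configuration C)
      (neg-shift′ r₀ ∷ neg-shift′ r₁ ∷ neg-shift′ r₂ ∷ neg-shift′ r₃ ∷ []))
  half-straight P D C ((Y , false) , r₀ ∷ r₁ ∷ r₂ ∷ r₃ ∷ []) =
    straight-swap P (straight-reflect (swap P) (increasing-straight _ D (reflect-configuration (swap-configuration C))
      (neg-shift′ r₀ ∷ neg-shift′ r₁ ∷ neg-shift′ r₂ ∷ neg-shift′ r₃ ∷ [])))

  -- Reflecting Y yields Y₂ ≤ Y₃ and leaves the hypothesis on X literally unchanged.
  oriented-straight : ∀ P D → Configuration P D → P X 2F + D 1F ≤ P X 3F → Straight P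
  oriented-straight P D C r with total (P Y 2F) (P Y 3F)
  ... | inj₁ y≤ = half-straight P D C (half-sound P D C (r ∷ y≤ ∷ []))
  ... | inj₂ y≥ = straight-reflectY P (half-straight _ D C′ (half-sound _ D C′ (r ∷ neg-≤ y≥ ∷ [])))
    where
    C′ = reflectY-configuration C

  straight : ∀ P D → Configuration P D → Straight P
  straight P D C with Configuration.attained C 2F 3F
  ... | X , inj₁ r = oriented-straight P D C r
  ... | X , inj₂ r = straight-reflect P (oriented-straight _ D (reflect-configuration C) (neg-shift′ r))
  ... | Y , inj₁ r = straight-swap P (oriented-straight _ D (swap-configuration C) r)
  ... | Y , inj₂ r = straight-swap P (straight-reflect (swap P)
          (oriented-straight _ D (reflect-configuration (swap-configuration C)) (neg-shift′ r)))

  -- The maximum norm and some ordered algebra.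

  open NaturalMax Ord.totalOrder using (maxOperator)
  open MaxOperatorProperties maxOperator using (x≤x⊔y; x≤y⊔x; ⊔-lub; ⊔-sel)
  open Plane ℝ

  x≤∣x∣ : ∀ x → x ≤ ∣ x ∣
  x≤∣x∣ x = x≤x⊔y x (- x)

  -x≤∣x∣ : ∀ x → - x ≤ ∣ x ∣
  -x≤∣x∣ x = x≤y⊔x x (- x)

  0≤∣x∣ : ∀ x → 0# ≤ ∣ x ∣
  0≤∣x∣ x with total 0# x
  ... | inj₁ 0≤x = ≤-trans 0≤x (x≤∣x∣ x)
  ... | inj₂ x≤0 = ≤-trans (≤-trans (≤-reflexive (≈-sym -0#≈0#)) (neg-≤ x≤0)) (-x≤∣x∣ x)

  abs-cases : ∀ x → ∣ x ∣ ≈ x ⊎ ∣ x ∣ ≈ - x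
  abs-cases x = ⊔-sel x (- x)

  coordinate : Axis → ℝ² → Carrier
  coordinate X = proj₁
  coordinate Y = proj₂

  ≈₂-intro : ∀ {p q} → (∀ a → coordinate a p ≈ coordinate a q) → p ≈₂ q
  ≈₂-intro eq = eq X , eq Y

  ∣coordinate∣≤∥∥ : ∀ a p → ∣ coordinate a p ∣ ≤ ∥ p ∥∞
  ∣coordinate∣≤∥∥ X (x , y) = x≤x⊔y ∣ x ∣ ∣ y ∣
  ∣coordinate∣≤∥∥ Y (x , y) = x≤y⊔x ∣ x ∣ ∣ y ∣

  ∥∥-attained : ∀ p → ∃ λ a → ∥ p ∥∞ ≈ ∣ coordinate a p ∣
  ∥∥-attained (x , y) with ⊔-sel ∣ x ∣ ∣ y ∣
  ... | inj₁ eq = X , eq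
  ... | inj₂ eq = Y , eq

  ∥∥-least : ∀ p {r} → (∀ a → ∣ coordinate a p ∣ ≤ r) → ∥ p ∥∞ ≤ r
  ∥∥-least p le = ⊔-lub (le X) (le Y)

  coordinate-⊖ : ∀ a p q → coordinate a (p ⊖ q) ≡ coordinate a p - coordinate a q
  coordinate-⊖ X p q = refl
  coordinate-⊖ Y p q = refl

  x-y≤z⇒x≤y+z : ∀ {x y z} → x - y ≤ z → x ≤ y + z
  x-y≤z⇒x≤y+z {x} {y} {z} le = begin
    x         ≈⟨ //-rightDividesˡ y x ⟨
    x - y + y ≤⟨ +-monoˡ-≤ y le ⟩
    z + y     ≈⟨ +-comm z y ⟩
    y + z     ∎

  x≤y+z⇒x-y≤z : ∀ {x y z} → x ≤ y + z → x - y ≤ z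
  x≤y+z⇒x-y≤z {x} {y} {z} le = +-cancelʳ-≤ y $ begin
    x - y + y ≈⟨ //-rightDividesˡ y x ⟩
    x         ≤⟨ le ⟩
    y + z     ≈⟨ +-comm y z ⟩
    z + y     ∎

  neg-difference : ∀ x y → - (x - y) ≈ y - x
  neg-difference x y = begin-equality
    - (x - y)     ≈⟨ ⁻¹-∙-comm x (- y) ⟨
    - x - - y     ≈⟨ +-congˡ (⁻¹-involutive y) ⟩
    - x + y       ≈⟨ +-comm (- x) y ⟩
    y - x         ∎

  toℕ-gap : ∀ {n} (i j : Fin n) → toℕ (gap i j) ≡ ℕ.∣ toℕ i - toℕ j ∣
  toℕ-gap zero    j       = refl
  toℕ-gap (suc i) zero    = refl
  toℕ-gap (suc i) (suc j) = ≡.trans (toℕ-inject₁ (gap i j)) (toℕ-gap i j)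

  0≤1 : 0# ≤ 1#
  0≤1 with total 0# 1#
  ... | inj₁ le = le
  ... | inj₂ 1≤0 = begin
    0#          ≤⟨ *-nonneg 0≤-1 0≤-1 ⟩
    - 1# * - 1# ≈⟨ -1*x≈-x (- 1#) ⟩
    - - 1#      ≈⟨ ⁻¹-involutive 1# ⟩
    1#          ∎
    where
    0≤-1 : 0# ≤ - 1#
    0≤-1 = ≤-trans (≤-reflexive (≈-sym -0#≈0#)) (neg-≤ 1≤0)

  -- Needed to pass from a corner and a width to a centre and a radius. The order makes 1 + 1
  -- nonzero, hence invertible.
  halve : ∀ x → ∃ λ h → x ≈ h + h
  halve x = x * u , (begin-equality
      x                 ≈⟨ *-identityʳ x ⟨
      x * 1#            ≈⟨ *-congˡ 2u≈1 ⟨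
      x * ((1# + 1#) * u) ≈⟨ *-congˡ (≈-trans (distribʳ u 1# 1#) (+-cong (*-identityˡ u) (*-identityˡ u))) ⟩
      x * (u + u)       ≈⟨ distribˡ x u u ⟩
      x * u + x * u     ∎)
    where
    2≉0 : 1# + 1# ≉ 0#
    2≉0 2≈0 = 1≉0 (antisym 1≤0 0≤1)
      where
      1≤0 : 1# ≤ 0#
      1≤0 = begin
        1#      ≈⟨ +-identityʳ 1# ⟨
        1# + 0# ≤⟨ +-mono-≤ ≤-refl 0≤1 ⟩
        1# + 1# ≈⟨ 2≈0 ⟩
        0#      ∎
    u = proj₁ (invertible (1# + 1#) 2≉0)
    2u≈1 = proj₂ (invertible (1# + 1#) 2≉0)

  -- Crescent configurations in coordinates.

  module Points {n} (S : PointSet n) (crescent : LineLikeCrescent S) where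

    open LineLikeCrescent crescent

    φ : Permutation′ n
    φ = proj₁ lineLike

    P : Fin n → ℝ²
    P i = point S (φ ⟨$⟩ˡ i)

    φ⁻¹-injective : ∀ {i j} → φ ⟨$⟩ˡ i ≡ φ ⟨$⟩ˡ j → i ≡ j
    φ⁻¹-injective {i} {j} eq = ≡.trans (≡.sym (inverseʳ φ)) (≡.trans (cong (φ ⟨$⟩ʳ_) eq) (inverseʳ φ))

    P-injective : ∀ {i j} → P i ≈₂ P j → i ≡ j
    P-injective eq = φ⁻¹-injective (Injection.injective S eq)

    equidistant⇔ : ∀ i j k l → ∥ P i ⊖ P j ∥∞ ≈ ∥ P k ⊖ P l ∥∞ ⇔
                   ℕ.∣ toℕ i - toℕ j ∣ ≡ ℕ.∣ toℕ k - toℕ l ∣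
    equidistant⇔ i j k l = subst (∥ P i ⊖ P j ∥∞ ≈ ∥ P k ⊖ P l ∥∞ ⇔_)
      (≡.cong₂ _≡_ (≡.cong₂ gapℕ (inverseʳ φ) (inverseʳ φ)) (≡.cong₂ gapℕ (inverseʳ φ) (inverseʳ φ)))
      (proj₂ lineLike (φ ⟨$⟩ˡ i) (φ ⟨$⟩ˡ j) (φ ⟨$⟩ˡ k) (φ ⟨$⟩ˡ l))
      where
      gapℕ : Fin n → Fin n → ℕ
      gapℕ a b = ℕ.∣ toℕ a - toℕ b ∣

    notOnLine : (f : Fin 3 → Fin n) → Injective f → (l : Line) → ¬ (∀ i → P (f i) ∈ˡ l)
    notOnLine f inj l on = noThreeOnALine (mk↣ (λ {i} {j} eq → inj i j (φ⁻¹-injective eq))) (l , on)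

    notOnCircle : (f : Fin 4 → Fin n) → Injective f → (C : Circle∞) → ¬ (∀ i → P (f i) ∈ᶜ C)
    notOnCircle f inj C on = noFourOnACircle∞ (mk↣ (λ {i} {j} eq → inj i j (φ⁻¹-injective eq))) (C , on)

    -- Turns the equation of a line into a parametrisation by the other coordinate: base point (u g,
    -- 0) and direction (-(u b), 1) when x is the unknown.
    solve-for : ∀ {u a b x y g} → a * u ≈ 1# → a * x + b * y ≈ g → x ≈ u * g + y * - (u * b)
    solve-for {u} {a} {b} {x} {y} {g} au≈1 eq = ≈-sym $ begin-equality
      u * g + y * - (u * b)                       ≈⟨ +-cong (*-congˡ eq) (-‿distribʳ-* y (u * b)) ⟨
      u * (a * x + b * y) - y * (u * b)           ≈⟨ +-congʳ (distribˡ u (a * x) (b * y)) ⟩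
      u * (a * x) + u * (b * y) - y * (u * b)     ≈⟨ +-congʳ (+-cong (*-assoc u a x) (*-assoc u b y)) ⟨
      u * a * x + u * b * y - y * (u * b)         ≈⟨ +-cong (+-congʳ (*-congʳ (≈-trans (*-comm u a) au≈1))) (-‿cong (*-comm y (u * b))) ⟩
      1# * x + u * b * y - u * b * y              ≈⟨ //-rightDividesʳ (u * b * y) (1# * x) ⟩
      1# * x                                      ≈⟨ *-identityˡ x ⟩
      x                                           ∎

    notAligned : (f : Fin 3 → Fin n) → Injective f → (α : Axis → Carrier) (γ : Carrier) →
              ¬ (∀ a → α a ≈ 0#) → ¬ (∀ i → α X * proj₁ (P (f i)) + α Y * proj₂ (P (f i)) ≈ γ)
    notAligned f inj α γ α≉0 same with α X Ord.≟ 0# | α Y Ord.≟ 0#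
    ... | yes x≈0 | yes y≈0 = α≉0 λ { X → x≈0 ; Y → y≈0 }
    ... | no x≉0 | _ with u , αu≈1 ← invertible (α X) x≉0 = notOnLine f inj
      record { base = u * γ , 0# ; direction = - (u * α Y) , 1# ; direction≉0 = 1≉0 ∘ proj₂ }
      λ i → proj₂ (P (f i)) , solve-for αu≈1 (same i) , ≈-sym (≈-trans (+-identityˡ _) (*-identityʳ _))
    ... | yes x≈0 | no y≉0 with u , αu≈1 ← invertible (α Y) y≉0 = notOnLine f inj
      record { base = 0# , u * γ ; direction = 1# , - (u * α X) ; direction≉0 = 1≉0 ∘ proj₁ }
      λ i → proj₁ (P (f i)) , ≈-sym (≈-trans (+-identityˡ _) (*-identityʳ _)) ,
        solve-for αu≈1 (≈-trans (+-comm _ _) (same i))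

    -- For w > 0 the boundary of the square is the circle of radius w/2 about its centre:
    -- containment bounds the norm from above, the tight side from below. For w ≤ 0 the square
    -- leaves room for at most one point.
    notOnSquare : (f : Fin 4 → Fin n) → Injective f → (lo : Axis → Carrier) (w : Carrier) →
      ¬ (∀ i → (∀ a → lo a ≤ coordinate a (P (f i)) × coordinate a (P (f i)) ≤ lo a + w) ×
               ∃ λ a → coordinate a (P (f i)) ≤ lo a ⊎ lo a + w ≤ coordinate a (P (f i)))
    notOnSquare f inj lo w on with w ≤? 0#
    ... | yes w≤0 = contradiction (inj 0F 1F (P-injective (≈₂-intro (λ a → antisym (squeezed a 0F 1F) (squeezed a 1F 0F))))) λ ()
      where
      squeezed : ∀ a i j → coordinate a (P (f i)) ≤ coordinate a (P (f j))
      squeezed a i j = begin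
        coordinate a (P (f i)) ≤⟨ proj₂ (proj₁ (on i) a) ⟩
        lo a + w               ≤⟨ +-mono-≤ ≤-refl w≤0 ⟩
        lo a + 0#              ≈⟨ +-identityʳ (lo a) ⟩
        lo a                   ≤⟨ proj₁ (proj₁ (on j) a) ⟩
        coordinate a (P (f j)) ∎
    ... | no w≰0 with h , w≈h+h ← halve w =
      notOnCircle f inj (record { centre = mid X , mid Y ; radius = h ; radius>0 = 0≤h , h≰0 ∘ ≤-reflexive ∘ ≈-sym })
        λ i → antisym (∥∥-least (P (f i) ⊖ _) (λ a → ⊔-lub (upper i a) (lower i a))) (attains i (proj₂ (on i)))
      where
      mid : Axis → Carrier
      mid a = lo a + h
      h≰0 : ¬ h ≤ 0#
      h≰0 h≤0 = w≰0 (begin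
        w       ≈⟨ w≈h+h ⟩
        h + h   ≤⟨ +-mono-≤ h≤0 h≤0 ⟩
        0# + 0# ≈⟨ +-identityˡ 0# ⟩
        0#      ∎)
      0≤h : 0# ≤ h
      0≤h = [ id , (λ h≤0 → ⊥-elim (h≰0 h≤0)) ]′ (total 0# h)
      far : ∀ a → lo a + w ≈ mid a + h
      far a = ≈-trans (+-congˡ w≈h+h) (≈-sym (+-assoc (lo a) h h))
      offset : ∀ i a → coordinate a (P (f i) ⊖ (mid X , mid Y)) ≡ coordinate a (P (f i)) - mid a
      offset i X = refl
      offset i Y = refl
      upper : ∀ i a → coordinate a (P (f i) ⊖ (mid X , mid Y)) ≤ h
      upper i a = begin
        coordinate a (P (f i) ⊖ _)     ≡⟨ offset i a ⟩
        coordinate a (P (f i)) - mid a ≤⟨ x≤y+z⇒x-y≤z (≤-trans (proj₂ (proj₁ (on i) a)) (≤-reflexive (far a))) ⟩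
        h                              ∎
      lower : ∀ i a → - coordinate a (P (f i) ⊖ (mid X , mid Y)) ≤ h
      lower i a = begin
        - coordinate a (P (f i) ⊖ _)       ≡⟨ cong -_ (offset i a) ⟩
        - (coordinate a (P (f i)) - mid a) ≈⟨ neg-difference _ _ ⟩
        mid a - coordinate a (P (f i))     ≤⟨ x≤y+z⇒x-y≤z (+-mono-≤ (proj₁ (proj₁ (on i) a)) ≤-refl) ⟩
        h                                  ∎
      attains : ∀ i → (∃ λ a → coordinate a (P (f i)) ≤ lo a ⊎ lo a + w ≤ coordinate a (P (f i))) →
                h ≤ ∥ P (f i) ⊖ (mid X , mid Y) ∥∞
      attains i (a , inj₁ e) = begin
        h                                  ≈⟨ //-rightDividesʳ (coordinate a (P (f i))) h ⟨
        h + coordinate a (P (f i)) - coordinate a (P (f i)) ≤⟨ +-monoˡ-≤ _ (+-mono-≤ ≤-refl e) ⟩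
        h + lo a - coordinate a (P (f i))  ≈⟨ +-congʳ (+-comm h (lo a)) ⟩
        mid a - coordinate a (P (f i))     ≈⟨ neg-difference _ _ ⟨
        - (coordinate a (P (f i)) - mid a) ≡⟨ cong -_ (offset i a) ⟨
        - coordinate a (P (f i) ⊖ _)       ≤⟨ -x≤∣x∣ _ ⟩
        ∣ coordinate a (P (f i) ⊖ _) ∣     ≤⟨ ∣coordinate∣≤∥∥ a _ ⟩
        ∥ P (f i) ⊖ _ ∥∞                   ∎
      attains i (a , inj₂ e) = begin
        h                                  ≈⟨ //-rightDividesʳ (mid a) h ⟨
        h + mid a - mid a                  ≈⟨ +-congʳ (≈-trans (+-comm h (mid a)) (≈-sym (far a))) ⟩
        lo a + w - mid a                   ≤⟨ +-monoˡ-≤ _ e ⟩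
        coordinate a (P (f i)) - mid a     ≡⟨ offset i a ⟨
        coordinate a (P (f i) ⊖ _)         ≤⟨ x≤∣x∣ _ ⟩
        ∣ coordinate a (P (f i) ⊖ _) ∣     ≤⟨ ∣coordinate∣≤∥∥ a _ ⟩
        ∥ P (f i) ⊖ _ ∥∞                   ∎

    -- Seven points with consecutive labels form a `Configuration`.

    module Window (m : ℕ) (w : Fin 7 → Fin n) (toℕ-w : ∀ i → toℕ (w i) ≡ toℕ i ℕ.+ m) where

      layout : Layout
      layout a i = coordinate a (P (w i))

      -- Distances depend on label differences only, so measuring all of them from the first point
      -- of the window loses nothing.
      distance : Fin 7 → Carrier
      distance k = ∥ P (w 0F) ⊖ P (w k) ∥∞

      w-injective : ∀ {i j} → w i ≡ w j → i ≡ j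
      w-injective {i} {j} eq = toℕ-injective (ℕ.+-cancelʳ-≡ m (toℕ i) (toℕ j)
        (≡.trans (≡.sym (toℕ-w i)) (≡.trans (cong toℕ eq) (toℕ-w j))))

      separation : ∀ i j → ℕ.∣ toℕ (w i) - toℕ (w j) ∣ ≡ ℕ.∣ toℕ i - toℕ j ∣
      separation i j = ≡.trans
        (≡.cong₂ ℕ.∣_-_∣ (≡.trans (toℕ-w i) (ℕ.+-comm (toℕ i) m)) (≡.trans (toℕ-w j) (ℕ.+-comm (toℕ j) m)))
        (ℕ.∣m+n-m+o∣≡∣n-o∣ m (toℕ i) (toℕ j))

      distance-gap : ∀ i j → ∥ P (w i) ⊖ P (w j) ∥∞ ≈ distance (gap i j)
      distance-gap i j = Equivalence.from (equidistant⇔ (w i) (w j) (w 0F) (w (gap i j)))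
        (≡.trans (separation i j) (≡.trans (≡.sym (toℕ-gap i j)) (≡.sym (separation 0F (gap i j)))))

      distance-injective : ∀ k l → distance k ≈ distance l → k ≡ l
      distance-injective k l eq = toℕ-injective (≡.trans (≡.sym (separation 0F k))
        (≡.trans (Equivalence.to (equidistant⇔ (w 0F) (w k) (w 0F) (w l)) eq) (separation 0F l)))

      -- A nonpositive distance is 0 and so equals the distance for the difference 0; line-likeness
      -- then identifies the differences.
      distance-positive : ∀ k → k ≢ 0F → ¬ distance k ≤ 0#
      distance-positive k k≢0 d≤0 = k≢0 (distance-injective k 0F (≈-trans
        (antisym d≤0 (≤-trans (0≤∣x∣ _) (∣coordinate∣≤∥∥ X _)))
        (≈-sym (antisym (∥∥-least (P (w 0F) ⊖ P (w 0F)) (λ a → ⊔-lub (zero≤ a) (zero≥ a)))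
          (≤-trans (0≤∣x∣ _) (∣coordinate∣≤∥∥ X _))))))
        where
        vanishing : ∀ a → coordinate a (P (w 0F) ⊖ P (w 0F)) ≈ 0#
        vanishing X = -‿inverseʳ _
        vanishing Y = -‿inverseʳ _
        zero≤ : ∀ a → coordinate a (P (w 0F) ⊖ P (w 0F)) ≤ 0#
        zero≤ a = ≤-reflexive (vanishing a)
        zero≥ : ∀ a → - coordinate a (P (w 0F) ⊖ P (w 0F)) ≤ 0#
        zero≥ a = ≤-reflexive (≈-trans (-‿cong (vanishing a)) -0#≈0#)

      config : Configuration layout distance
      config = record
        { bound        = λ a i j → x-y≤z⇒x≤y+z (begin
            layout a i - layout a j               ≡⟨ coordinate-⊖ a _ _ ⟨
            coordinate a (P (w i) ⊖ P (w j))      ≤⟨ x≤∣x∣ _ ⟩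
            ∣ coordinate a (P (w i) ⊖ P (w j)) ∣  ≤⟨ ∣coordinate∣≤∥∥ a _ ⟩
            ∥ P (w i) ⊖ P (w j) ∥∞                ≈⟨ distance-gap i j ⟩
            distance (gap i j)                    ∎)
        ; attained     = attained
        ; positive     = distance-positive
        ; distinct     = distance-injective
        ; notCollinear = λ f inj → notAligned (w ∘ f) (λ i j → inj i j ∘ w-injective)
        ; notConcyclic = λ f inj → notOnSquare (w ∘ f) (λ i j → inj i j ∘ w-injective)
        }
        where
        reached : ∀ {x y d} → d ≈ y - x → x + d ≤ y
        reached {x} {y} {d} eq = ≤-reflexive (≈-trans (+-congˡ eq) (≈-trans (+-comm x (y - x)) (//-rightDividesˡ x y)))
        attained : ∀ i j → ∃ λ a → layout a i + distance (gap i j) ≤ layout a j ⊎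
                                   layout a j + distance (gap j i) ≤ layout a i
        attained i j with a , eq ← ∥∥-attained (P (w i) ⊖ P (w j)) | abs-cases (coordinate a (P (w i) ⊖ P (w j)))
        ... | inj₁ e = a , inj₂ (reached (begin-equality
          distance (gap j i)                    ≡⟨ cong distance (gap-comm j i) ⟩
          distance (gap i j)                    ≈⟨ distance-gap i j ⟨
          ∥ P (w i) ⊖ P (w j) ∥∞                ≈⟨ eq ⟩
          ∣ coordinate a (P (w i) ⊖ P (w j)) ∣  ≈⟨ e ⟩
          coordinate a (P (w i) ⊖ P (w j))      ≡⟨ coordinate-⊖ a _ _ ⟩
          layout a i - layout a j               ∎))
        ... | inj₂ e = a , inj₁ (reached (begin-equality
          distance (gap i j)                    ≈⟨ distance-gap i j ⟨
          ∥ P (w i) ⊖ P (w j) ∥∞                ≈⟨ eq ⟩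
          ∣ coordinate a (P (w i) ⊖ P (w j)) ∣  ≈⟨ e ⟩
          - coordinate a (P (w i) ⊖ P (w j))    ≡⟨ cong -_ (coordinate-⊖ a _ _) ⟩
          - (layout a i - layout a j)           ≈⟨ neg-difference _ _ ⟩
          layout a j - layout a i               ∎))

    -- From windows of seven points to all points.

    module Glue .{{_ : NonZero n}} where

      -- P indexed by ℕ; the points beyond P (n-1) are junk.
      V : ℕ → ℝ²
      V i = P (i mod n)

      x : Axis → ℕ → Carrier
      x a i = coordinate a (V i)

      toℕ-mod : ∀ {i} → i ℕ.< n → toℕ (i mod n) ≡ i
      toℕ-mod {i} i<n = ≡.trans (toℕ-fromℕ< (m%n<n i n)) (m<n⇒m%n≡m i<n)

      V-toℕ : ∀ i → V (toℕ i) ≡ P i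
      V-toℕ i = cong P (toℕ-injective (toℕ-mod (toℕ<n i)))

      V-injective : ∀ {i j} → i ℕ.< n → j ℕ.< n → V i ≈₂ V j → i ≡ j
      V-injective i<n j<n eq =
        ≡.trans (≡.sym (toℕ-mod i<n)) (≡.trans (cong toℕ (P-injective eq)) (toℕ-mod j<n))

      Midpoint : Axis → ℕ → Set ℓ₁
      Midpoint a i = x a (1 ℕ.+ i) + x a (1 ℕ.+ i) ≈ x a i + x a (2 ℕ.+ i)

      Midpoints : Axis → ℕ → Set ℓ₁
      Midpoints a m = ∀ i → i ℕ.< 5 → Midpoint a (i ℕ.+ m)

      window : ∀ m → m ℕ.+ 7 ℕ.≤ n → ∃ λ a → Midpoints a m
      window m m+7≤n with straight _ _ (Window.config m (λ i → (toℕ i ℕ.+ m) mod n) (λ i → toℕ-mod (in-range i)))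
        where
        in-range : ∀ (i : Fin 7) → toℕ i ℕ.+ m ℕ.< n
        in-range i = ℕ.<-≤-trans (ℕ.+-monoˡ-< m (toℕ<n i)) (ℕ.≤-trans (ℕ.≤-reflexive (ℕ.+-comm 7 m)) m+7≤n)
      ... | a , eq = a , λ where
        0 _ → eq 0F
        1 _ → eq 1F
        2 _ → eq 2F
        3 _ → eq 3F
        4 _ → eq 4F
        (suc (suc (suc (suc (suc _))))) (s≤s (s≤s (s≤s (s≤s (s≤s ())))))

      three : ∀ {m} → 2 ℕ.+ m ℕ.< n → (i : Fin 3) → toℕ i ℕ.+ m ℕ.< n
      three {m} lt i = ℕ.<-≤-trans (s≤s (ℕ.+-monoˡ-≤ m (ℕ.s≤s⁻¹ (toℕ<n i)))) lt

      three-injective : ∀ {m} → 2 ℕ.+ m ℕ.< n → ∀ (i j : Fin 3) →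
                        (toℕ i ℕ.+ m) mod n ≡ (toℕ j ℕ.+ m) mod n → i ≡ j
      three-injective {m} lt i j eq = toℕ-injective (ℕ.+-cancelʳ-≡ m (toℕ i) (toℕ j)
        (≡.trans (≡.sym (toℕ-mod (three lt i))) (≡.trans (cong toℕ eq) (toℕ-mod (three lt j)))))

      next : ∀ a i → Midpoint a i → x a (2 ℕ.+ i) ≈ x a (1 ℕ.+ i) + (x a (1 ℕ.+ i) - x a i)
      next a i mid = begin-equality
        x a (2 ℕ.+ i)                                   ≈⟨ //-rightDividesʳ (x a i) _ ⟨
        x a (2 ℕ.+ i) + x a i - x a i                   ≈⟨ +-congʳ (+-comm _ (x a i)) ⟩
        x a i + x a (2 ℕ.+ i) - x a i                   ≈⟨ +-congʳ mid ⟨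
        x a (1 ℕ.+ i) + x a (1 ℕ.+ i) - x a i           ≈⟨ +-assoc _ _ _ ⟩
        x a (1 ℕ.+ i) + (x a (1 ℕ.+ i) - x a i)         ∎

      notBoth : ∀ {m} → 2 ℕ.+ m ℕ.< n → ¬ (∀ a → Midpoint a m)
      notBoth {m} lt mid = notOnLine (λ i → (toℕ i ℕ.+ m) mod n) (three-injective lt)
        -- The three points have parameters 0, 1 and 2 on this line.
        (record { base = V m ; direction = V (1 ℕ.+ m) ⊖ V m ; direction≉0 = different })
        λ where
          0F → 0# , ≈₂-intro (λ { X → first X ; Y → first Y })
          1F → 1# , ≈₂-intro (λ { X → second X ; Y → second Y })
          2F → 1# + 1# , ≈₂-intro (λ { X → third X ; Y → third Y })
        where
        first : ∀ a → x a m ≈ x a m + 0# * (x a (1 ℕ.+ m) - x a m)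
        first a = ≈-sym (≈-trans (+-congˡ (zeroˡ _)) (+-identityʳ _))
        second : ∀ a → x a (1 ℕ.+ m) ≈ x a m + 1# * (x a (1 ℕ.+ m) - x a m)
        second a = ≈-sym (≈-trans (+-congˡ (*-identityˡ _)) (≈-trans (+-comm _ _) (//-rightDividesˡ _ _)))
        third : ∀ a → x a (2 ℕ.+ m) ≈ x a m + (1# + 1#) * (x a (1 ℕ.+ m) - x a m)
        third a = begin-equality
          x a (2 ℕ.+ m)                                             ≈⟨ next a m (mid a) ⟩
          x a (1 ℕ.+ m) + d                                         ≈⟨ +-cong (second a) (≈-sym (*-identityˡ d)) ⟩
          x a m + 1# * d + 1# * d                                   ≈⟨ +-assoc _ _ _ ⟩
          x a m + (1# * d + 1# * d)                                 ≈⟨ +-congˡ (distribʳ d 1# 1#) ⟨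
          x a m + (1# + 1#) * d                                     ∎
          where d = x a (1 ℕ.+ m) - x a m
        different : ¬ (V (1 ℕ.+ m) ⊖ V m ≈₂ 0₂)
        different (dx , dy) = ℕ.1+n≢n (V-injective (ℕ.<-trans (ℕ.n<1+n _) lt) (ℕ.<-trans (ℕ.n<1+n _) (ℕ.<-trans (ℕ.n<1+n _) lt))
          (x-y≈0 dx , x-y≈0 dy))
          where
          x-y≈0 : ∀ {u v} → u - v ≈ 0# → u ≈ v
          x-y≈0 {u} {v} eq = begin-equality
            u         ≈⟨ //-rightDividesˡ v u ⟨
            u - v + v ≈⟨ +-congʳ eq ⟩
            0# + v    ≈⟨ +-identityˡ v ⟩
            v         ∎

      -- Each window comes with some axis of its own; induction on its start shows that this axis
      -- never changes.
      windows : ∀ a → Midpoints a 0 → ∀ m → m ℕ.+ 7 ℕ.≤ n → Midpoints a m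
      windows a mids zero    le = mids
      windows a mids (suc m) le = agree a (windows a mids m (ℕ.≤-trans (ℕ.n≤1+n _) le)) (window (suc m) le)
        where
        lt : 2 ℕ.+ suc m ℕ.< n
        lt = ℕ.≤-trans (ℕ.+-monoʳ-≤ 4 (ℕ.m≤m+n m 4)) (ℕ.≤-trans (ℕ.≤-reflexive rearranged) le)
          where
          rearranged : 4 ℕ.+ (m ℕ.+ 4) ≡ suc m ℕ.+ 7
          rearranged = ≡.trans (ℕ.+-comm 4 (m ℕ.+ 4)) (≡.trans (ℕ.+-assoc m 4 4) (ℕ.+-suc m 7))
        agree : ∀ a → Midpoints a m → (∃ λ b → Midpoints b (suc m)) → Midpoints a (suc m)
        agree X old (X , new) = new
        agree Y old (Y , new) = new
        -- Position 1 of the window at m and position 0 of the window at m + 1 are the same triple m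
        -- + 1, m + 2, m + 3.
        agree X old (Y , new) = ⊥-elim (notBoth lt λ { X → old 1 (s≤s (s≤s z≤n)) ; Y → new 0 (s≤s z≤n) })
        agree Y old (X , new) = ⊥-elim (notBoth lt λ { X → new 0 (s≤s z≤n) ; Y → old 1 (s≤s (s≤s z≤n)) })

      midpoints : ∀ a → Midpoints a 0 → ∀ i → i ℕ.+ 3 ℕ.≤ n → Midpoint a i
      midpoints a mids i le with i ℕ.<? 5
      ... | yes i<5 = subst (Midpoint a) (ℕ.+-identityʳ i) (mids i i<5)
      -- The triple starting at i is taken as the last one of its window. That window starts at i -
      -- 4 and ends at i + 2, so it fits exactly when the triple does.
      ... | no i≮5 = subst (Midpoint a) (ℕ.m+[n∸m]≡n 4≤i) (windows a mids (i ℕ.∸ 4) le′ 4 (s≤s ℕ.≤-refl))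
        where
        4≤i : 4 ℕ.≤ i
        4≤i = ℕ.≤-trans (ℕ.n≤1+n 4) (ℕ.≮⇒≥ i≮5)
        le′ : i ℕ.∸ 4 ℕ.+ 7 ℕ.≤ n
        le′ = ℕ.≤-trans (ℕ.≤-reflexive (≡.trans (≡.sym (ℕ.+-assoc (i ℕ.∸ 4) 4 3)) (cong (ℕ._+ 3) (ℕ.m∸n+n≡m 4≤i)))) le

      module Equidistant (a : Axis) (mids : ∀ i → i ℕ.+ 3 ℕ.≤ n → Midpoint a i) where

        v : Carrier
        v = x a 1 - x a 0

        step : ∀ i → i ℕ.+ 2 ℕ.≤ n → x a (suc i) ≈ x a i + v
        step zero le = ≈-sym (≈-trans (+-comm _ _) (//-rightDividesˡ _ _))
        step (suc i) le = begin-equality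
          x a (2 ℕ.+ i)                           ≈⟨ next a i (mids i (ℕ.≤-trans (ℕ.≤-reflexive (ℕ.+-suc i 2)) le)) ⟩
          x a (1 ℕ.+ i) + (x a (1 ℕ.+ i) - x a i) ≈⟨ +-congˡ (+-congʳ (step i (ℕ.≤-trans (ℕ.n≤1+n _) le))) ⟩
          x a (1 ℕ.+ i) + (x a i + v - x a i)     ≈⟨ +-congˡ (+-congʳ (+-comm (x a i) v)) ⟩
          x a (1 ℕ.+ i) + (v + x a i - x a i)     ≈⟨ +-congˡ (//-rightDividesʳ (x a i) v) ⟩
          x a (1 ℕ.+ i) + v                       ∎

        spaced : ∀ i → i ℕ.< n → x a i ≈ x a 0 + (i ℕ× 1#) * v
        spaced zero lt = ≈-sym (≈-trans (+-congˡ (zeroˡ v)) (+-identityʳ _))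
        spaced (suc i) lt = begin-equality
          x a (suc i)                     ≈⟨ step i (ℕ.≤-trans (ℕ.≤-reflexive (ℕ.+-comm i 2)) lt) ⟩
          x a i + v                       ≈⟨ +-congʳ (spaced i (ℕ.<-trans (ℕ.n<1+n i) lt)) ⟩
          x a 0 + (i ℕ× 1#) * v + v       ≈⟨ +-assoc _ _ _ ⟩
          x a 0 + ((i ℕ× 1#) * v + v)     ≈⟨ +-congˡ (+-comm _ v) ⟩
          x a 0 + (v + (i ℕ× 1#) * v)     ≈⟨ +-congˡ (+-congʳ (*-identityˡ v)) ⟨
          x a 0 + (1# * v + (i ℕ× 1#) * v) ≈⟨ +-congˡ (distribʳ v 1# (i ℕ× 1#)) ⟨
          x a 0 + (suc i ℕ× 1#) * v       ∎

        -- With step 0 the first three points would share the coordinate `a` and lie on an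
        -- axis-parallel line.
        v≉0 : 7 ℕ.≤ n → v ≉ 0#
        v≉0 7≤n v≈0 = notAligned (λ i → (toℕ i ℕ.+ 0) mod n) (three-injective lt) (indicator a) (x a 0)
          (λ zeros → 1≉0 (≈-trans (≈-sym (indicates a)) (zeros a))) constant
          where
          lt : 2 ℕ.< n
          lt = ℕ.≤-trans (s≤s (s≤s (s≤s z≤n))) 7≤n
          indicator : Axis → Axis → Carrier
          indicator X X = 1#
          indicator Y Y = 1#
          indicator _ _ = 0#
          indicates : ∀ a → indicator a a ≈ 1#
          indicates X = ≈-refl
          indicates Y = ≈-refl
          selects : ∀ a p → indicator a X * proj₁ p + indicator a Y * proj₂ p ≈ coordinate a p
          selects X p = ≈-trans (+-cong (*-identityˡ _) (zeroˡ _)) (+-identityʳ _)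
          selects Y p = ≈-trans (+-cong (zeroˡ _) (*-identityˡ _)) (+-identityˡ _)
          constant : ∀ (i : Fin 3) → indicator a X * proj₁ (V (toℕ i ℕ.+ 0)) + indicator a Y * proj₂ (V (toℕ i ℕ.+ 0)) ≈ x a 0
          constant i = begin-equality
            _                                       ≈⟨ selects a (V (toℕ i ℕ.+ 0)) ⟩
            x a (toℕ i ℕ.+ 0)                       ≈⟨ spaced (toℕ i ℕ.+ 0) (three lt i) ⟩
            x a 0 + ((toℕ i ℕ.+ 0) ℕ× 1#) * v       ≈⟨ +-congˡ (≈-trans (*-congˡ v≈0) (zeroʳ _)) ⟩
            x a 0 + 0#                              ≈⟨ +-identityʳ _ ⟩
            x a 0                                   ∎

  -- Orthogonal projection onto a coordinate axis.

  along : Axis → Carrier → ℝ²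
  along X u = u , 0#
  along Y u = 0# , u

  -- The line through the origin: orthogonal projection onto it keeps one coordinate and sets the
  -- other to 0.
  axisLine : Axis → Line
  axisLine a = record { base = 0₂ ; direction = along a 1# ; direction≉0 = nonzero a }
    where
    nonzero : ∀ a → ¬ (along a 1# ≈₂ 0₂)
    nonzero X = 1≉0 ∘ proj₁
    nonzero Y = 1≉0 ∘ proj₂

  axisLine-direction : ∀ a → Horizontal (axisLine a) ⊎ Vertical (axisLine a)
  axisLine-direction X = inj₁ ≈-refl
  axisLine-direction Y = inj₂ ≈-refl

  along-∥ : ∀ a u → along a u ∥ axisLine a
  along-∥ X u = u , ≈-sym (*-identityʳ u) , ≈-sym (zeroʳ u)
  along-∥ Y u = u , ≈-sym (zeroʳ u) , ≈-sym (*-identityʳ u)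

  along-∈ˡ : ∀ a u → along a u ∈ˡ axisLine a
  along-∈ˡ a u with t , x≈ , y≈ ← along-∥ a u =
    t , ≈-trans x≈ (≈-sym (+-identityˡ _)) , ≈-trans y≈ (≈-sym (+-identityˡ _))

  along-≉0 : ∀ a {u} → u ≉ 0# → ¬ (along a u ≈₂ 0₂)
  along-≉0 X u≉0 = u≉0 ∘ proj₁
  along-≉0 Y u≉0 = u≉0 ∘ proj₂

  along-affine : ∀ a {u q t v} → u ≈ q + t * v → along a u ≈₂ along a q ⊕ t · along a v
  along-affine X {t = t} eq = eq , ≈-sym (≈-trans (+-identityˡ _) (zeroʳ t))
  along-affine Y {t = t} eq = ≈-sym (≈-trans (+-identityˡ _) (zeroʳ t)) , eq

  along-orthogonal : ∀ a p → ⟨ p ⊖ along a (coordinate a p) , direction (axisLine a) ⟩ ≈ 0#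
  along-orthogonal X (x , y) = ≈-trans (+-cong (≈-trans (*-congʳ (-‿inverseʳ x)) (zeroˡ _)) (zeroʳ _)) (+-identityˡ _)
  along-orthogonal Y (x , y) = ≈-trans (+-cong (zeroʳ _) (≈-trans (*-congʳ (-‿inverseʳ y)) (zeroˡ _))) (+-identityˡ _)

  theorem : (n : ℕ) → 7 ℕ.≤ n → (S : PointSet n) → LineLikeCrescent S →
            ∃ λ (l : Line) → (Horizontal l ⊎ Vertical l) × PerpendicularPerturbation S l
  -- The axis of the window at label 0 becomes that of the whole configuration. The bound on `n`
  -- also provides the nonzero modulus for the indexing by ℕ.
  theorem n 7≤n S crescent with Glue.window 0 7≤n
    where
    instance
      _ : NonZero n
      _ = ℕ.>-nonZero (ℕ.≤-trans (s≤s z≤n) 7≤n)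
    open Points S crescent
  -- The points are enumerated by label, hence by the inverse of `φ`, and the equally spaced points
  -- keep only the coordinate on the axis `a`.
  ... | a , mids = axisLine a , axisLine-direction a , flip φ , (λ i → along a (coordinate a (P i))) ,
    ((λ i → along-∈ˡ a _) , along a (x a 0) , along a v , along-≉0 a (v≉0 7≤n) , along-∥ a v ,
      λ i → along-affine a (≈-trans (≈-reflexive (cong (coordinate a) (≡.sym (V-toℕ i)))) (spaced (toℕ i) (toℕ<n i)))) ,
    λ i → along-∈ˡ a _ , along-orthogonal a (P i)
    where
    instance
      _ : NonZero n
      _ = ℕ.>-nonZero (ℕ.≤-trans (s≤s z≤n) 7≤n)
    open Points S crescent
    open Glue
    open Equidistant a (midpoints a mids)

open import Data.Nat.Base using (_≤_)

theorem1p5 : ∀ {c ℓ₁ ℓ₂ : Level} (ℝ : RealNumbers c ℓ₁ ℓ₂) →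
    let open Plane ℝ in
    (n : ℕ) → 7 ≤ n → (S : PointSet n) → LineLikeCrescent S →
    ∃ λ (l : Line) → (Horizontal l ⊎ Vertical l) × PerpendicularPerturbation S l
theorem1p5 = Proof.theorem
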